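{- For every integer $g\ge 5$ there exist infinitely many cyclically $5$-edge-connected snarks whose girth equals exactly $g$.
   Context: Graphs are finite; multiple edges and loops are permitted. A snark is a $2$-connected cubic graph that admits no proper $3$-edge-colouring. A cubic graph is cyclically $k$-edge-connected if the removal of fewer than $k$ edges cannot create a graph with at least two components containing circuits. The girth of a graph is the length of a shortest circuit. -}

module Defs where

open import Data.Nat using (ℕ; zero; suc; _+_; _<_; _≤_; _>_)
open import Data.Nat.DivMod using (_%_; m%n<n)
open import Data.Fin using (Fin; toℕ; fromℕ<; _≟_)
open import Data.Fin.Subset using (Subset; _∈_; _∉_; ∣_∣)
open import Data.List using (List; map; allFin)
open import Data.Nat.ListAction using (sum)
open import Data.Product using (Σ; _×_; _,_; proj₁; proj₂; ∃)
open import Data.Sum using (_⊎_)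
open import Data.Bool using (if_then_else_)
open import Relation.Nullary using (¬_)
open import Relation.Nullary.Decidable using (⌊_⌋)
open import Relation.Binary.PropositionalEquality using (_≡_)
open import Function.Definitions using (Injective)

-- A finite graph with multiple edges and loops allowed:
-- vertices Fin n, edges Fin m, each edge has an (unordered) pair of ends.
-- A loop is an edge whose two ends coincide.
record Graph : Set where
  field
    n    : ℕ
    m    : ℕ
    ends : Fin m → Fin n × Fin n

module _ (G : Graph) where
  open Graph G

  end : Fin m → Fin 2 → Fin n
  end e Fin.zero = proj₁ (ends e)
  end e (Fin.suc _) = proj₂ (ends e)

  Joins : Fin m → Fin n → Fin n → Set
  Joins e u w = (proj₁ (ends e) ≡ u × proj₂ (ends e) ≡ w)
              ⊎ (proj₁ (ends e) ≡ w × proj₂ (ends e) ≡ u)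

  -- degree of v: number of edge-ends at v (a loop counts twice)
  [_≟v_] : Fin n → Fin n → ℕ
  [ a ≟v v ] = if ⌊ a ≟ v ⌋ then 1 else 0

  degree : Fin n → ℕ
  degree v = sum (map (λ e → [ proj₁ (ends e) ≟v v ] + [ proj₂ (ends e) ≟v v ]) (allFin m))

  Cubic : Set
  Cubic = ∀ v → degree v ≡ 3

  data Walk (VOk : Fin n → Set) (EOk : Fin m → Set) : Fin n → Fin n → Set where
    here  : ∀ {u} → VOk u → Walk VOk EOk u u
    there : ∀ {u w v} (e : Fin m) → VOk u → EOk e → Joins e u w →
            Walk VOk EOk w v → Walk VOk EOk u v

  ConnectedOn : (Fin n → Set) → (Fin m → Set) → Set
  ConnectedOn VOk EOk = ∀ u v → VOk u → VOk v → Walk VOk EOk u v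

  AllE : Fin m → Set
  AllE _ = Data.Unit.⊤ where import Data.Unit

  Connected : Set
  Connected = ConnectedOn (λ _ → Data.Unit.⊤) AllE where import Data.Unit

  -- 2-connected (Diestel): more than 2 vertices, connected, and G - v connected
  -- for every vertex v.
  TwoConnected : Set
  TwoConnected = 2 < n × Connected × (∀ v → ConnectedOn (λ u → ¬ (u ≡ v)) AllE)

  -- proper 3-edge-colouring: distinct edge-ends (half-edges) at a common
  -- vertex get distinct colours (so a loop is never properly coloured).
  Proper3EdgeColouring : (Fin m → Fin 3) → Set
  Proper3EdgeColouring c =
    ∀ (e f : Fin m) (i j : Fin 2) → ¬ ((e , i) ≡ (f , j)) →
      end e i ≡ end f j → ¬ (c e ≡ c f)

  ThreeEdgeColourable : Set
  ThreeEdgeColourable = Σ (Fin m → Fin 3) Proper3EdgeColouring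

  IsSnark : Set
  IsSnark = TwoConnected × Cubic × ¬ ThreeEdgeColourable

  next : ∀ {l} → Fin (suc l) → Fin (suc l)
  next {l} i = fromℕ< (m%n<n (suc (toℕ i)) (suc l))

  -- A circuit of length suc l: distinct vertices vs 0..l and distinct edges
  -- es 0..l, edge es i joining vs i and vs (i+1 mod (suc l)).
  -- (A loop is a circuit of length 1, two parallel edges one of length 2.)
  record Circuit : Set where
    field
      l     : ℕ
      vs    : Fin (suc l) → Fin n
      es    : Fin (suc l) → Fin m
      vs-inj : Injective _≡_ _≡_ vs
      es-inj : Injective _≡_ _≡_ es
      joins : ∀ i → Joins (es i) (vs i) (vs (next i))

  length : Circuit → ℕ
  length C = suc (Circuit.l C)

  AvoidsS : Subset m → Circuit → Set
  AvoidsS S C = ∀ i → Circuit.es C i ∉ S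

  CyclicallyEdgeConnected : ℕ → Set
  CyclicallyEdgeConnected k =
    ∀ (S : Subset m) → ∣ S ∣ < k →
    ∀ (C D : Circuit) → AvoidsS S C → AvoidsS S D →
      Walk (λ _ → Data.Unit.⊤) (λ e → e ∉ S) (Circuit.vs C Fin.zero) (Circuit.vs D Fin.zero)
    where import Data.Unit

  HasGirth : ℕ → Set
  HasGirth g = Σ Circuit (λ C → length C ≡ g) × (∀ (C : Circuit) → g ≤ length C)

{-# OPTIONS --safe #-}
module Submission where

-- A connected vertex-transitive cubic graph of large girth has no small edge cut with many
-- vertices on both sides: two translates of a minimal side that meet coincide by uncrossing,
-- so every vertex of that side has a neighbour across the cut. Copies of such a graph,
-- opened along a few edges that are far apart, serve as hubs: the colours on the edges
-- leaving a hub add up to zero in the Klein four-group (parity lemma), every path through a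
-- hub is long, and deleting four edges leaves essentially one component of it.
--
-- It remains to find a graph without nowhere-zero flow over the Klein four-group in which the
-- vertices of degree at least 5, to be replaced by hubs, meet all circuits and are pairwise
-- joined by five edge-disjoint paths. Deleting three vertices a, b, z from the Petersen graph
-- suitably leaves a tree, and in it the values leaving towards a, b, z are not all zero.
-- Replacing two distant edges of a Petersen graph by such trees, each running between the ends
-- of its edge, gives a gadget that transmits a nonzero value from the third terminal of one
-- tree to that of the other. Replacing the edges of a path of length four in a Petersen graph
-- by such gadgets gives the graph. Finally a circuit of length g is attached to one hub by g
-- spokes; it is the only circuit that does not run far inside a hub.

open import Defs hiding (length; next)
import Defs
open import Algebra.Bundles using (CommutativeRing)
import Algebra.Properties.CommutativeMonoid.Sum
open import Data.Bool using (Bool; true; false; not; if_then_else_; _∧_; _∨_; _xor_; T)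
open import Data.Bool.ListAction using (all)
import Data.Bool.Properties as Bool
open import Data.Bool.Solver using (module xor-∧-Solver)
open import Data.Empty using (⊥; ⊥-elim)
open import Data.Fin using (Fin; zero; suc; _≟_; toℕ; fromℕ; fromℕ<; inject₁; inject≤; punchOut; splitAt; _↑ˡ_; _↑ʳ_; remQuot; combine; funToFin; finToFun; #_)
open import Data.Fin.Patterns using (0F; 1F; 2F; 3F; 4F; 5F; 6F; 7F; 8F; 9F)
open import Data.Fin.Permutation using (Permutation; permutation)
import Data.Fin.Properties as Fin
import Data.Fin.Subset as Subset
open import Data.List as List using (List; []; _∷_; length; _++_; reverse; _∷ʳ_; _ʳ++_)
open import Data.List.Membership.Propositional using (_∈_)
open import Data.List.Membership.Propositional.Properties using (∈-++⁻; ∈-++⁺ˡ; ∈-map⁺)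
import Data.List.Properties as List
open import Data.List.Relation.Unary.Any using (here; there)
open import Data.List.Relation.Unary.Linked as Linked using (Linked; []; [-]; _∷_; linked?)
open import Data.Nat using (ℕ; zero; suc; _+_; _*_; _∸_; _≤_; _<_; z≤n; s≤s; _^_; _<?_; _≤?_; ∣_-_∣; _≡ᵇ_; _<ᵇ_)
open import Data.Nat.DivMod using (_%_; _/_; _mod_; m%n<n; n%n≡0; m<n⇒m%n≡m)
open import Data.Nat.Induction using (<-wellFounded)
import Data.Nat.ListAction
import Data.Nat.Properties as ℕ
open import Data.Product using (Σ; ∃; _×_; _,_; proj₁; proj₂)
open import Data.Product.Properties using (≡-dec)
open import Data.Sum using (_⊎_; inj₁; inj₂; [_,_]′)
import Data.Sum.Properties as Sum
open import Data.Unit using (⊤; tt)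
open import Data.Vec using (Vec; []; _∷_; lookup)
open import Data.Vec.Properties using (lookup⇒[]=; []=⇒lookup)
open import Function using (_∘_; id; const)
open import Induction.WellFounded using (Acc; acc)
open import Relation.Binary.Definitions using (tri<; tri≈; tri>)
open import Relation.Binary.PropositionalEquality using (_≡_; _≢_; _≗_; refl; sym; trans; cong; cong₂; subst; subst₂; module ≡-Reasoning)
open import Relation.Nullary using (¬_; Dec; yes; no; does)
open import Relation.Nullary.Decidable using (True; toWitness; dec-true; dec-false; ¬?; ⌊_⌋; _×-dec_; _⊎-dec_; _→-dec_)
open import Algebra.Properties.CommutativeMonoid.Sum ℕ.+-0-commutativeMonoid using (sum; sum-cong-≗; sum-permute; ∑-distrib-+; ∑-comm; sum-replicate-zero)

-- The obstruction to colouring lives on Petersen graphs, whose circuits are short, while the girth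
-- is to be arbitrary. The parity lemma reconciles the two: it sees only the edges leaving a vertex
-- set, so any cubic graph can take the place of a vertex without disturbing the flow equations.
-- Hubs need degree at least 5, but a Petersen graph is cubic. Trees make up for this, since each of
-- their terminals is reached by three edges. One tree alone only excludes that all three terminal
-- values vanish; the middle copies turn this into a nonzero value at one prescribed terminal, which
-- is what an edge of the outer copy has to carry. The transitive graph is the Cayley graph of the
-- group generated by the three involutions of a ball in the cubic tree: a short reduced word moves
-- the root of the ball, hence no short reduced word is trivial in the group. The girth bound,
-- cyclic connectivity and 2-connectivity share one device: an endless non-backtracking walk must at
-- some time run far inside a hub or go once round the ring. Circuits unroll into such walks, and
-- every vertex starts one while all vertices keep at least two edges.

true≢false : true ≢ false
true≢false ()

<-flip : ∀ a b → a ≢ b → does (b <? a) ≡ not (does (a <? b))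
<-flip a b a≢b with ℕ.<-cmp a b
... | tri< lt _ gt = trans (dec-false (b <? a) gt) (cong not (sym (dec-true (a <? b) lt)))
... | tri≈ _ e _ = ⊥-elim (a≢b e)
... | tri> nlt _ gt = trans (dec-true (b <? a) gt) (cong not (sym (dec-false (a <? b) nlt)))

-- Sums and counts over Fin

⟦_⟧ : Bool → ℕ
⟦ true ⟧ = 1
⟦ false ⟧ = 0

cnt : ∀ {n} → (Fin n → Bool) → ℕ
cnt P = sum (λ i → ⟦ P i ⟧)

sum-mono : ∀ {n} {f g : Fin n → ℕ} → (∀ i → f i ≤ g i) → sum f ≤ sum g
sum-mono {zero} h = z≤n
sum-mono {suc n} h = ℕ.+-mono-≤ (h zero) (sum-mono (h ∘ suc))

sum-const : ∀ n c → sum {n} (λ _ → c) ≡ n * c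
sum-const zero c = refl
sum-const (suc n) c = cong (c +_) (sum-const n c)

sum-indicator : ∀ {n} (i : Fin n) → sum (λ j → ⟦ does (i ≟ j) ⟧) ≡ 1
sum-indicator {suc n} zero = cong suc (sum-replicate-zero n)
sum-indicator {suc n} (suc i) = sum-indicator i

sum-++ : ∀ a {b} (f : Fin (a + b) → ℕ) → sum f ≡ sum (λ i → f (i ↑ˡ b)) + sum (λ i → f (a ↑ʳ i))
sum-++ zero f = refl
sum-++ (suc a) f = trans (cong (f zero +_) (sum-++ a (f ∘ suc))) (sym (ℕ.+-assoc (f zero) _ _))

sum-* : ∀ a b (f : Fin (a * b) → ℕ) → sum f ≡ sum (λ i → sum (λ j → f (combine {a} {b} i j)))
sum-* zero b f = refl
sum-* (suc a) b f = trans (sum-++ b f) (cong (sum (λ i → f (i ↑ˡ (a * b))) +_) (sum-* a b (λ i → f (b ↑ʳ i))))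

sum-select : ∀ {n} (f : Fin n → ℕ) v → sum (λ u → if does (v ≟ u) then f u else 0) ≡ f v
sum-select {suc n} f zero = trans (cong (f zero +_) (sum-replicate-zero n)) (ℕ.+-identityʳ _)
sum-select {suc n} f (suc v) = sum-select (f ∘ suc) v

enum : ∀ {n} (P : Fin n → Bool) → Fin (cnt P) → Fin n
enum {suc n} P i with P zero
enum {suc n} P zero | true = zero
enum {suc n} P (suc i) | true = suc (enum (P ∘ suc) i)
enum {suc n} P i | false = suc (enum (P ∘ suc) i)

enum-sat : ∀ {n} (P : Fin n → Bool) i → P (enum P i) ≡ true
enum-sat {suc n} P i with P zero in eq
enum-sat {suc n} P zero | true = eq
enum-sat {suc n} P (suc i) | true = enum-sat (P ∘ suc) i
enum-sat {suc n} P i | false = enum-sat (P ∘ suc) i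

locate : ∀ {n} (P : Fin n → Bool) v → P v ≡ true → ∃ λ i → enum P i ≡ v
locate {suc n} P zero p with P zero
... | true = zero , refl
locate {suc n} P (suc v) p with P zero | locate (P ∘ suc) v p
... | true | i , e = suc i , cong suc e
... | false | i , e = i , cong suc e

index : ∀ {n} (P : Fin n → Bool) v → P v ≡ true → Fin (cnt P)
index P v p = proj₁ (locate P v p)

enum-index : ∀ {n} (P : Fin n → Bool) v p → enum P (index P v p) ≡ v
enum-index P v p = proj₂ (locate P v p)

enum-injective : ∀ {n} (P : Fin n → Bool) {i j} → enum P i ≡ enum P j → i ≡ j
enum-injective {suc n} P {i} {j} e with P zero
enum-injective {suc n} P {zero} {zero} e | true = refl
enum-injective {suc n} P {suc i} {suc j} e | true =
  cong suc (enum-injective (P ∘ suc) (Fin.suc-injective e))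
enum-injective {suc n} P {i} {j} e | false = enum-injective (P ∘ suc) (Fin.suc-injective e)

sum-enum : ∀ {n} (P : Fin n → Bool) (F : Fin n → ℕ) →
           sum (F ∘ enum P) ≡ sum (λ v → if P v then F v else 0)
sum-enum {zero} P F = refl
sum-enum {suc n} P F with P zero
... | true = cong (F zero +_) (sum-enum (P ∘ suc) (F ∘ suc))
... | false = sum-enum (P ∘ suc) (F ∘ suc)

cnt-inject : ∀ {m n} (P : Fin m → Bool) (Q : Fin n → Bool) (f : ∀ i → P i ≡ true → Fin n) →
             (∀ i p → Q (f i p) ≡ true) → (∀ i j p q → f i p ≡ f j q → i ≡ j) → cnt P ≤ cnt Q
cnt-inject P Q f hits inj = Fin.injective⇒≤ {f = g} λ {i} {j} e →
  enum-injective P (inj _ _ _ _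
    (trans (sym (enum-index Q _ _)) (trans (cong (enum Q) e) (enum-index Q _ _))))
  where
  g : Fin (cnt P) → Fin (cnt Q)
  g i = index Q (f (enum P i) (enum-sat P i)) (hits _ _)

cnt-mono : ∀ {n} {P Q : Fin n → Bool} → (∀ i → P i ≡ true → Q i ≡ true) → cnt P ≤ cnt Q
cnt-mono {P = P} {Q} h = cnt-inject P Q (λ i _ → i) h (λ _ _ _ _ e → e)

≤-cnt : ∀ {m n} (P : Fin n → Bool) (f : Fin m → Fin n) → (∀ i → P (f i) ≡ true) →
        (∀ {i j} → f i ≡ f j → i ≡ j) → m ≤ cnt P
≤-cnt P f hits inj = Fin.injective⇒≤ {f = λ i → index P (f i) (hits i)} λ e →
  inj (trans (sym (enum-index P _ _)) (trans (cong (enum P) e) (enum-index P _ _)))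

pick : ∀ {n} m (P : Fin n → Bool) → m ≤ cnt P →
       Σ (Fin m → Fin n) λ f → (∀ i → P (f i) ≡ true) × (∀ {i j} → f i ≡ f j → i ≡ j)
pick m P le = (λ i → enum P (inject≤ i le)) , (λ i → enum-sat P _) ,
  λ e → Fin.inject≤-injective le le _ _ (enum-injective P e)

cnt-strict : ∀ {n} {P Q : Fin n → Bool} → (∀ i → P i ≡ true → Q i ≡ true) →
             ∀ v → P v ≡ false → Q v ≡ true → cnt P < cnt Q
cnt-strict {suc n} {P} {Q} h zero p q with P zero | Q zero
... | false | true = s≤s (cnt-mono (h ∘ suc))
cnt-strict {suc n} {P} {Q} h (suc v) p q with P zero in e | Q zero in e'
... | false | false = cnt-strict (h ∘ suc) v p q
... | false | true = ℕ.m<n⇒m<1+n (cnt-strict (h ∘ suc) v p q)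
... | true | true = s≤s (cnt-strict (h ∘ suc) v p q)
... | true | false = ⊥-elim (true≢false (trans (sym (h zero e)) e'))

cnt-not : ∀ {n} (P : Fin n → Bool) → cnt P + cnt (not ∘ P) ≡ n
cnt-not {n} P = begin
  cnt P + cnt (not ∘ P)                          ≡⟨ ∑-distrib-+ (λ i → ⟦ P i ⟧) (λ i → ⟦ not (P i) ⟧) ⟨
  sum (λ i → ⟦ P i ⟧ + ⟦ not (P i) ⟧)            ≡⟨ sum-cong-≗ (λ i → lem (P i)) ⟩
  sum {n} (λ _ → 1)                              ≡⟨ sum-const n 1 ⟩
  n * 1                                          ≡⟨ ℕ.*-identityʳ n ⟩
  n                                              ∎
  where
  open ≡-Reasoning
  lem : ∀ b → ⟦ b ⟧ + ⟦ not b ⟧ ≡ 1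
  lem true = refl
  lem false = refl

injective⇒surjective : ∀ {n} (f : Fin n → Fin n) → (∀ {i j} → f i ≡ f j → i ≡ j) →
                       ∀ v → ∃ λ u → f u ≡ v
injective⇒surjective {suc n} f inj v with Fin.any? (λ u → f u ≟ v)
... | yes p = p
... | no ¬p = ⊥-elim (ℕ.<-irrefl refl (Fin.injective⇒≤ {f = λ u → punchOut (λ e → ¬p (u , sym e))}
                λ {x} {y} e → inj (Fin.punchOut-injective (λ e → ¬p (x , sym e)) (λ e → ¬p (y , sym e)) e)))

injective⇒permutation : ∀ {n} (f : Fin n → Fin n) → (∀ {i j} → f i ≡ f j → i ≡ j) → Permutation n n
injective⇒permutation f inj = permutation f (λ v → proj₁ (injective⇒surjective f inj v))
  (λ v → proj₂ (injective⇒surjective f inj v))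
  (λ u → inj (proj₂ (injective⇒surjective f inj (f u))))

-- Components of a graph with labelled edges

module Reachability {n k} (nb : Fin n → Fin k → Fin n) (ok : Fin n → Fin k → Bool) where

  data Reach : Fin n → Fin n → Set where
    stop : ∀ {u} → Reach u u
    _▻_  : ∀ {u v} → Reach u v → (s : Fin k) → {ok v s ≡ true} → Reach u (nb v s)

  record Closure (u : Fin n) : Set where
    field
      R       : Fin n → Bool
      start   : R u ≡ true
      sound   : ∀ v → R v ≡ true → Reach u v
      closed  : ∀ v s → R v ≡ true → ok v s ≡ true → R (nb v s) ≡ true

  -- The set grows by one endpoint of an admissible edge leaving it until there is none; the
  -- shrinking complement is the termination measure.
  closure : ∀ u → Closure u
  closure u = grow (λ v → does (u ≟ v)) (dec-true (u ≟ u) refl) sound₀ (<-wellFounded _)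
    where
    sound₀ : ∀ v → does (u ≟ v) ≡ true → Reach u v
    sound₀ v e with u ≟ v
    sound₀ v e | yes refl = stop

    grow : (R : Fin n → Bool) → R u ≡ true → (∀ v → R v ≡ true → Reach u v) →
           Acc _<_ (cnt (not ∘ R)) → Closure u
    grow R st sd (acc rs)
      with Fin.any? (λ v → Fin.any? (λ s → (R v ∧ ok v s ∧ not (R (nb v s))) Data.Bool.≟ true))
    ... | no ¬p = record { R = R ; start = st ; sound = sd ; closed = cl }
      where
      cl : ∀ v s → R v ≡ true → ok v s ≡ true → R (nb v s) ≡ true
      cl v s r o with R (nb v s) in eq
      ... | true = refl
      ... | false = ⊥-elim (¬p (v , s , lem))
        where
        lem : (R v ∧ ok v s ∧ not (R (nb v s))) ≡ true
        lem rewrite r | o | eq = refl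
    ... | yes (v , s , e) = grow R' st' sd' (rs dec)
      where
      parts : R v ≡ true × ok v s ≡ true × R (nb v s) ≡ false
      parts with R v | ok v s | R (nb v s)
      parts | true | true | false = refl , refl , refl
      R' : Fin n → Bool
      R' w = R w ∨ does (nb v s ≟ w)
      st' : R' u ≡ true
      st' rewrite st = refl
      sd' : ∀ w → R' w ≡ true → Reach u w
      sd' w e with R w in eq | nb v s ≟ w
      ... | true | _ = sd w eq
      ... | false | yes refl = _▻_ (sd v (proj₁ parts)) s {proj₁ (proj₂ parts)}
      new : R' (nb v s) ≡ true
      new rewrite proj₂ (proj₂ parts) = dec-true (nb v s ≟ nb v s) refl
      dec : cnt (not ∘ R') < cnt (not ∘ R)
      dec = cnt-strict (λ w → lem (R w)) (nb v s) (cong not new) (cong not (proj₂ (proj₂ parts)))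
        where
        lem : ∀ a {b} → not (a ∨ b) ≡ true → not a ≡ true
        lem false e = refl

-- Words in three involutions

Letter : Set
Letter = Fin 3

Word : Set
Word = List Letter

Reduced : Word → Set
Reduced = Linked _≢_

act : ∀ {A : Set} → (Letter → A → A) → Word → A → A
act σ [] v = v
act σ (s ∷ w) v = act σ w (σ s v)

act-++ : ∀ {A : Set} (σ : Letter → A → A) u w v → act σ (u ++ w) v ≡ act σ w (act σ u v)
act-++ σ [] w v = refl
act-++ σ (s ∷ u) w v = act-++ σ u w (σ s v)

act-reverse : ∀ {A : Set} (σ : Letter → A → A) → (∀ s v → σ s (σ s v) ≡ v) →
              ∀ w v → act σ (reverse w) (act σ w v) ≡ v
act-reverse σ inv [] v = refl
act-reverse σ inv (s ∷ w) v = begin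
  act σ (reverse (s ∷ w)) (act σ w (σ s v))         ≡⟨ cong (λ x → act σ x (act σ w (σ s v))) (List.unfold-reverse s w) ⟩
  act σ (reverse w ∷ʳ s) (act σ w (σ s v))          ≡⟨ act-++ σ (reverse w) (s ∷ []) _ ⟩
  σ s (act σ (reverse w) (act σ w (σ s v)))         ≡⟨ cong (σ s) (act-reverse σ inv w (σ s v)) ⟩
  σ s (σ s v)                                       ≡⟨ inv s v ⟩
  v                                                 ∎
  where open ≡-Reasoning

-- A connected vertex-transitive cubic graph of girth greater than r, presented
-- by three involutions; the edge labelled s at v leads to σ s v.
record Tower (r : ℕ) : Set where
  field
    n       : ℕ
    σ       : Letter → Fin n → Fin n
    σ-invol : ∀ s v → σ s (σ s v) ≡ v
    base    : Fin n
    word    : ∀ v → ∃ λ w → act σ w base ≡ v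
    shift   : Fin n → Fin n → Fin n
    shift-base : ∀ v → shift v base ≡ v
    shift-σ    : ∀ v s u → shift v (σ s u) ≡ σ s (shift v u)
    shift-inj  : ∀ v {x y} → shift v x ≡ shift v y → x ≡ y
    girth   : ∀ w v → Reduced w → 1 ≤ length w → length w ≤ r → act σ w v ≢ v

-- The three involutions of the ball of radius r in the 3-regular tree: a vertex
-- is a reduced word and s acts by left multiplication, fixing the vertices that
-- it would move out of the ball.
module Ball (r : ℕ) where

  grow : Letter → Word → Word
  grow s w with length w <? r
  ... | yes _ = s ∷ w
  ... | no _ = w

  move′ : Letter → Word → Word
  move′ s [] = grow s []
  move′ s (x ∷ w) with s ≟ x
  ... | yes _ = w
  ... | no _ = grow s (x ∷ w)

  reduced? : ∀ w → Dec (Reduced w)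
  reduced? = linked? (λ x y → ¬? (x ≟ y))

  -- `code` numbers all words of length at most r, reduced or not. The non-reduced ones are left
  -- fixed, so that each letter is an involution on the whole set.
  move : Letter → Word → Word
  move s w with reduced? w
  ... | yes _ = move′ s w
  ... | no _ = w

  move-reduced : ∀ s {w} → Reduced w → move s w ≡ move′ s w
  move-reduced s {w} red with reduced? w
  ... | yes _ = refl
  ... | no ¬red = ⊥-elim (¬red red)

  move′-reduced : ∀ s {w} → Reduced w → Reduced (move′ s w)
  move′-reduced s {[]} red with 0 <? r
  ... | yes _ = [-]
  ... | no _ = []
  move′-reduced s {x ∷ w} red with s ≟ x
  ... | yes _ = Linked.tail red
  ... | no s≢x with length (x ∷ w) <? r
  ... | yes _ = s≢x ∷ red
  ... | no _ = red

  grow-< : ∀ s w → length w < r → grow s w ≡ s ∷ w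
  grow-< s w lt with length w <? r
  ... | yes _ = refl
  ... | no ¬lt = ⊥-elim (¬lt lt)

  move′-cancel : ∀ s w → move′ s (s ∷ w) ≡ w
  move′-cancel s w with s ≟ s
  ... | yes _ = refl
  ... | no ¬e = ⊥-elim (¬e refl)

  move′-push : ∀ s {w} → Reduced (s ∷ w) → length w < r → move′ s w ≡ s ∷ w
  move′-push s {[]} red lt = grow-< s [] lt
  move′-push s {x ∷ w} (s≢x ∷ _) lt with s ≟ x
  ... | yes e = ⊥-elim (s≢x e)
  ... | no _ = grow-< s (x ∷ w) lt

  move′-invol : ∀ s w → Reduced w → length w ≤ r → move′ s (move′ s w) ≡ w
  move′-invol s [] red le with 0 <? r in eq
  ... | yes _ = move′-cancel s []
  ... | no _ rewrite eq = refl
  move′-invol s (x ∷ w) red le with s ≟ x in eq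
  ... | yes refl = move′-push s red le
  ... | no s≢x with length (x ∷ w) <? r in eq′
  ... | yes _ = move′-cancel s (x ∷ w)
  ... | no _ rewrite eq | eq′ = refl

  move′-length : ∀ s w → length w ≤ r → length (move′ s w) ≤ r
  move′-length s [] le with 0 <? r
  ... | yes lt = lt
  ... | no _ = le
  move′-length s (x ∷ w) le with s ≟ x
  ... | yes _ = ℕ.<⇒≤ le
  ... | no _ with length (x ∷ w) <? r
  ... | yes lt = lt
  ... | no _ = le

  move-length : ∀ s w → length w ≤ r → length (move s w) ≤ r
  move-length s w le with reduced? w
  ... | yes _ = move′-length s w le
  ... | no _ = le

  move-invol : ∀ s w → length w ≤ r → move s (move s w) ≡ w
  move-invol s w le with reduced? w in eq
  ... | yes red = trans (move-reduced s (move′-reduced s red)) (move′-invol s w red le)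
  ... | no _ rewrite eq = refl

  -- The first letter applied differs from the head x and each later one from its predecessor, so
  -- every letter is pushed and none cancels.
  act-length : ∀ w x u → Reduced (x ∷ u) → Reduced (x ∷ w) → length w + length (x ∷ u) ≤ r →
               length (act move w (x ∷ u)) ≡ length w + length (x ∷ u)
  act-length [] x u ru rw le = refl
  act-length (s ∷ w) x u ru (x≢s ∷ rw) le
    rewrite move-reduced s ru
          | move′-push s ((x≢s ∘ sym) ∷ ru) (ℕ.≤-trans (s≤s (ℕ.m≤n+m _ (length w))) le)
    = trans (act-length w s (x ∷ u) ((x≢s ∘ sym) ∷ ru) rw
              (subst (_≤ r) (sym (ℕ.+-suc (length w) _)) le))
            (ℕ.+-suc (length w) _)

  act-moves-root : ∀ w → Reduced w → 1 ≤ length w → length w ≤ r → act move w [] ≢ []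
  act-moves-root (s ∷ w) red one le e
    rewrite move-reduced s {[]} [] | grow-< s [] (ℕ.≤-trans one le)
    with trans (sym (act-length w s [] [-] red (subst (_≤ r) (sym (ℕ.+-comm (length w) 1)) le))) (cong length e)
  ... | e′ rewrite ℕ.+-comm (length w) 1 with e′
  ... | ()

  size : ℕ → ℕ
  size zero = 1
  size (suc k) = suc (3 * size k)

  dec : ∀ k → Fin (size k) → Word
  dec zero _ = []
  dec (suc k) zero = []
  dec (suc k) (suc i) = proj₁ (remQuot {3} (size k) i) ∷ dec k (proj₂ (remQuot {3} (size k) i))

  code : ∀ k → Word → Fin (size k)
  code zero _ = zero
  code (suc k) [] = zero
  code (suc k) (s ∷ w) = suc (combine s (code k w))

  code-dec : ∀ k i → code k (dec k i) ≡ i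
  code-dec zero zero = refl
  code-dec (suc k) zero = refl
  code-dec (suc k) (suc i) = cong suc
    (trans (cong (combine (proj₁ (remQuot {3} (size k) i))) (code-dec k (proj₂ (remQuot {3} (size k) i))))
           (Fin.combine-remQuot {3} (size k) i))

  dec-code : ∀ k w → length w ≤ k → dec k (code k w) ≡ w
  dec-code zero [] le = refl
  dec-code (suc k) [] le = refl
  dec-code (suc k) (s ∷ w) (s≤s le) = trans
    (cong (λ x → proj₁ x ∷ dec k (proj₂ x)) (Fin.remQuot-combine {3} {size k} s (code k w)))
    (cong (s ∷_) (dec-code k w le))

  dec-length : ∀ k i → length (dec k i) ≤ k
  dec-length zero i = z≤n
  dec-length (suc k) zero = z≤n
  dec-length (suc k) (suc i) = s≤s (dec-length k _)

  t : ℕ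
  t = size r

  π : Letter → Fin t → Fin t
  π s i = code r (move s (dec r i))

  π-invol : ∀ s i → π s (π s i) ≡ i
  π-invol s i
    rewrite dec-code r (move s (dec r i)) (move-length s (dec r i) (dec-length r i))
          | move-invol s (dec r i) (dec-length r i) = code-dec r i

  root : Fin t
  root = code r []

  π-act : ∀ w u → length u ≤ r → act π w (code r u) ≡ code r (act move w u)
  π-act [] u le = refl
  π-act (s ∷ w) u le rewrite dec-code r u le = π-act w (move s u) (move-length s u le)

  act-length≤ : ∀ w u → length u ≤ r → length (act move w u) ≤ r
  act-length≤ [] u le = le
  act-length≤ (s ∷ w) u le = act-length≤ w (move s u) (move-length s u le)

  π-moves-root : ∀ w → Reduced w → 1 ≤ length w → length w ≤ r → act π w root ≢ root
  π-moves-root w red one le e = act-moves-root w red one le (begin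
    act move w []                      ≡⟨ dec-code r (act move w []) (act-length≤ w [] z≤n) ⟨
    dec r (code r (act move w []))     ≡⟨ cong (dec r) (π-act w [] z≤n) ⟨
    dec r (act π w root)               ≡⟨ cong (dec r) e ⟩
    dec r root                         ≡⟨ dec-code r [] z≤n ⟩
    []                                 ∎)
    where open ≡-Reasoning

funToFin-cong : ∀ {m n} {f g : Fin m → Fin n} → f ≗ g → funToFin f ≡ funToFin g
funToFin-cong {zero} h = refl
funToFin-cong {suc m} h = cong₂ combine (h zero) (funToFin-cong (h ∘ suc))

-- The group generated by the involutions of the ball is the component of the
-- identity in the set of all self-maps of the ball, encoded in Fin (t ^ t).
module CayleyGraph (r : ℕ) where

  open Ball r

  N : ℕ
  N = t ^ t

  fun : Fin N → Fin t → Fin t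
  fun = finToFun

  fin : (Fin t → Fin t) → Fin N
  fin = funToFin

  fin-fun : ∀ v → fin (fun v) ≡ v
  fin-fun = Fin.funToFin-finToFin {t} {t}

  fun-fin : ∀ f → fun (fin f) ≗ f
  fun-fin = Fin.finToFun-funToFin {t} {t}

  ϕ : Letter → Fin N → Fin N
  ϕ s v = fin (π s ∘ fun v)

  ϕ-invol : ∀ s v → ϕ s (ϕ s v) ≡ v
  ϕ-invol s v = trans
    (funToFin-cong λ i → trans (cong (π s) (fun-fin (π s ∘ fun v) i)) (π-invol s (fun v i)))
    (fin-fun v)

  fun-act : ∀ w v i → fun (act ϕ w v) i ≡ act π w (fun v i)
  fun-act [] v i = refl
  fun-act (s ∷ w) v i = trans (fun-act w (ϕ s v) i) (cong (act π w) (fun-fin (π s ∘ fun v) i))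

  one : Fin N
  one = fin id

  open Reachability {N} {3} (λ v s → ϕ s v) (λ _ _ → true)
  open Closure (closure one)

  reach-word : ∀ {v} → Reach one v → ∃ λ w → act ϕ w one ≡ v
  reach-word stop = [] , refl
  reach-word (p ▻ s) with reach-word p
  ... | w , e = w ∷ʳ s , trans (act-++ ϕ w (s ∷ []) one) (cong (ϕ s) e)

  fun-surjective : ∀ v → R v ≡ true → ∀ p → ∃ λ i → fun v i ≡ p
  fun-surjective v rv p with reach-word (sound v rv)
  ... | w , refl = act π (reverse w) p ,
    trans (fun-act w one _) (trans (cong (act π w) (fun-fin id _)) (back w))
    where
    back : ∀ w → act π w (act π (reverse w) p) ≡ p
    back w = trans (cong (λ x → act π x (act π (reverse w) p)) (sym (List.reverse-involutive w)))
                   (act-reverse π π-invol (reverse w) p)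

  -- Letters act by postcomposition and this is precomposition with h, so the two commute: these are
  -- the translations of the Cayley graph.
  times : Fin N → Fin N → Fin N
  times h v = fin (fun v ∘ fun h)

  times-R : ∀ h v → R h ≡ true → R v ≡ true → R (times h v) ≡ true
  times-R h v rh rv = go (sound v rv)
    where
    go : ∀ {v} → Reach one v → R (times h v) ≡ true
    go stop = subst (λ x → R x ≡ true)
      (sym (trans (funToFin-cong (λ i → fun-fin id (fun h i))) (fin-fun h))) rh
    go (_▻_ {v = v} p s) = subst (λ x → R x ≡ true)
      (funToFin-cong λ i → trans (cong (π s) (fun-fin (fun v ∘ fun h) i))
                                 (sym (fun-fin (π s ∘ fun v) (fun h i))))
      (closed (times h v) s (go p) refl)

  e : Fin (cnt R) → Fin N
  e = enum R

  down : ∀ v → R v ≡ true → Fin (cnt R)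
  down = index R

  e-down : ∀ v p → e (down v p) ≡ v
  e-down = enum-index R

  e-inj : ∀ {i j} → e i ≡ e j → i ≡ j
  e-inj = enum-injective R

  σ : Letter → Fin (cnt R) → Fin (cnt R)
  σ s i = down (ϕ s (e i)) (closed (e i) s (enum-sat R i) refl)

  e-σ : ∀ s i → e (σ s i) ≡ ϕ s (e i)
  e-σ s i = e-down _ _

  e-act : ∀ w i → e (act σ w i) ≡ act ϕ w (e i)
  e-act [] i = refl
  e-act (s ∷ w) i = trans (e-act w (σ s i)) (cong (act ϕ w) (e-σ s i))

  shift : Fin (cnt R) → Fin (cnt R) → Fin (cnt R)
  shift h i = down (times (e h) (e i)) (times-R _ _ (enum-sat R h) (enum-sat R i))

  times-inj : ∀ h u v → R h ≡ true → times h u ≡ times h v → u ≡ v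
  times-inj h u v rh eq = trans (sym (fin-fun u)) (trans (funToFin-cong pt) (fin-fun v))
    where
    pt : ∀ p → fun u p ≡ fun v p
    pt p with fun-surjective h rh p
    ... | i , refl = trans (sym (fun-fin (fun u ∘ fun h) i))
                     (trans (cong (λ x → fun x i) eq) (fun-fin (fun v ∘ fun h) i))

  tower : Tower r
  tower = record
    { n = cnt R
    ; σ = σ
    ; σ-invol = λ s v → e-inj (trans (e-σ s _) (trans (cong (ϕ s) (e-σ s v)) (ϕ-invol s _)))
    ; base = down one start
    ; word = λ v → let w , eq = reach-word (sound (e v) (enum-sat R v)) in
        w , e-inj (trans (e-act w _) (trans (cong (act ϕ w) (e-down one start)) eq))
    ; shift = shift
    ; shift-base = λ v → e-inj (trans (e-down _ _) (trans (cong (times (e v)) (e-down one start))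
        (trans (funToFin-cong (λ i → fun-fin id (fun (e v) i))) (fin-fun (e v)))))
    ; shift-σ = λ v s u → e-inj (trans (e-down _ _) (trans (cong (times (e v)) (e-σ s u)) (trans
        (funToFin-cong (λ i → trans (fun-fin (π s ∘ fun (e u)) (fun (e v) i))
                                    (sym (cong (π s) (fun-fin (fun (e u) ∘ fun (e v)) i)))))
        (sym (trans (e-σ s _) (cong (ϕ s) (e-down _ _)))))))
    ; shift-inj = λ v {x} {y} eq → e-inj (times-inj (e v) (e x) (e y) (enum-sat R v)
        (trans (sym (e-down _ _)) (trans (cong e eq) (e-down _ _))))
    -- A word that fixes the group element v acts trivially on every point in the image of v; since
    -- v is surjective, the root is one of them.
    ; girth = λ w v red o le eq → let p , pe = fun-surjective (e v) (enum-sat R v) root in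
        π-moves-root w red o le (trans (cong (act π w) (sym pe)) (trans
          (sym (fun-act w (e v) p)) (trans (cong (λ x → fun x p) (trans (sym (e-act w v)) (cong e eq))) pe)))
    }

-- Edge cuts in transitive cubic graphs of large girth

∧-split : ∀ {a b} → a ∧ b ≡ true → a ≡ true × b ≡ true
∧-split {true} {true} e = refl , refl

prefix : (ℕ → Letter) → ℕ → Word
prefix ℓ zero = []
prefix ℓ (suc k) = ℓ 0 ∷ prefix (ℓ ∘ suc) k

prefix-length : ∀ ℓ k → length (prefix ℓ k) ≡ k
prefix-length ℓ zero = refl
prefix-length ℓ (suc k) = cong suc (prefix-length (ℓ ∘ suc) k)

prefix-reduced : ∀ ℓ k → (∀ j → suc j < k → ℓ j ≢ ℓ (suc j)) → Reduced (prefix ℓ k)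
prefix-reduced ℓ zero h = []
prefix-reduced ℓ (suc zero) h = [-]
prefix-reduced ℓ (suc (suc k)) h =
  h 0 (s≤s (s≤s z≤n)) ∷ prefix-reduced (ℓ ∘ suc) (suc k) (λ j lt → h (suc j) (s≤s lt))

act-prefix : ∀ {A : Set} (σ : Letter → A → A) ℓ (v : ℕ → A) k →
             (∀ j → j < k → v (suc j) ≡ σ (ℓ j) (v j)) → act σ (prefix ℓ k) (v 0) ≡ v k
act-prefix σ ℓ v zero h = refl
act-prefix σ ℓ v (suc k) h = trans (cong (act σ (prefix (ℓ ∘ suc) k)) (sym (h 0 (s≤s z≤n))))
  (act-prefix σ (ℓ ∘ suc) (v ∘ suc) k (λ j lt → h (suc j) (s≤s lt)))

module Cuts {r} (T : Tower r) where

  open Tower T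

  path-distinct : ∀ (ℓ : ℕ → Letter) (v : ℕ → Fin n) k → 1 ≤ k → k ≤ r →
    (∀ j → j < k → v (suc j) ≡ σ (ℓ j) (v j)) → (∀ j → suc j < k → ℓ j ≢ ℓ (suc j)) → v 0 ≢ v k
  path-distinct ℓ v k one le step red e = girth (prefix ℓ k) (v 0) (prefix-reduced ℓ k red)
    (subst (1 ≤_) (sym (prefix-length ℓ k)) one) (subst (_≤ r) (sym (prefix-length ℓ k)) le)
    (trans (act-prefix σ ℓ v k step) (sym e))

  leaves : (Fin n → Bool) → Fin n → Letter → Bool
  leaves W v s = W v ∧ not (W (σ s v))

  out : (Fin n → Bool) → Fin n → ℕ
  out W v = sum {3} λ s → ⟦ leaves W v s ⟧

  -- The size of the edge cut around W: each of its edges is counted once, from the end in W.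
  δ : (Fin n → Bool) → ℕ
  δ W = sum λ v → out W v

  σ-perm : Letter → Permutation n n
  σ-perm s = permutation (σ s) (σ s) (σ-invol s) (σ-invol s)

  shift-perm : Fin n → Permutation n n
  shift-perm u = injective⇒permutation (shift u) (shift-inj u)

  δ-not : ∀ W → δ (not ∘ W) ≡ δ W
  δ-not W = begin
    δ (not ∘ W)                                                     ≡⟨ ∑-comm (λ v s → ⟦ leaves (not ∘ W) v s ⟧) ⟩
    sum (λ s → sum (λ v → ⟦ leaves (not ∘ W) v s ⟧))                ≡⟨ sum-cong-≗ {3} (λ s → sum-permute (λ v → ⟦ leaves (not ∘ W) v s ⟧) (σ-perm s)) ⟩
    sum (λ s → sum (λ v → ⟦ leaves (not ∘ W) (σ s v) s ⟧))          ≡⟨ sum-cong-≗ {3} (λ s → sum-cong-≗ (λ v → lem s v)) ⟩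
    sum (λ s → sum (λ v → ⟦ leaves W v s ⟧))                        ≡⟨ ∑-comm (λ v s → ⟦ leaves W v s ⟧) ⟨
    δ W                                                             ∎
    where
    open ≡-Reasoning
    flip : ∀ a b → not a ∧ not (not b) ≡ b ∧ not a
    flip true true = refl
    flip true false = refl
    flip false true = refl
    flip false false = refl
    lem : ∀ s v → ⟦ leaves (not ∘ W) (σ s v) s ⟧ ≡ ⟦ leaves W v s ⟧
    lem s v rewrite σ-invol s v = cong ⟦_⟧ (flip (W (σ s v)) (W v))

  -- The inequality already holds for each dart separately, by the sixteen possible positions of its
  -- two ends.
  submodular : ∀ A B → δ (λ v → A v ∧ B v) + δ (λ v → A v ∨ B v) ≤ δ A + δ B
  submodular A B = subst₂ _≤_ (merge (λ v → A v ∧ B v) (λ v → A v ∨ B v)) (merge A B)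
    (sum-mono λ v → sum-mono {3} λ s → pt (A v) (B v) (A (σ s v)) (B (σ s v)))
    where
    merge : ∀ X Y → sum (λ v → sum {3} (λ s → ⟦ leaves X v s ⟧ + ⟦ leaves Y v s ⟧)) ≡ δ X + δ Y
    merge X Y = trans (sum-cong-≗ λ v → ∑-distrib-+ {3} (λ s → ⟦ leaves X v s ⟧) (λ s → ⟦ leaves Y v s ⟧))
                      (∑-distrib-+ (out X) (out Y))
    pt : ∀ a b a′ b′ → ⟦ (a ∧ b) ∧ not (a′ ∧ b′) ⟧ + ⟦ (a ∨ b) ∧ not (a′ ∨ b′) ⟧
                     ≤ ⟦ a ∧ not a′ ⟧ + ⟦ b ∧ not b′ ⟧
    pt true true true true = z≤n
    pt true true true false = s≤s z≤n
    pt true true false true = s≤s z≤n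
    pt true true false false = s≤s (s≤s z≤n)
    pt true false true true = z≤n
    pt true false true false = z≤n
    pt true false false true = z≤n
    pt true false false false = s≤s z≤n
    pt false true true true = z≤n
    pt false true true false = z≤n
    pt false true false true = z≤n
    pt false true false false = s≤s z≤n
    pt false false true true = z≤n
    pt false false true false = z≤n
    pt false false false true = z≤n
    pt false false false false = z≤n

  cnt-cong : ∀ {A B : Fin n → Bool} → A ≗ B → cnt A ≡ cnt B
  cnt-cong h = sum-cong-≗ λ v → cong ⟦_⟧ (h v)

  cnt-∧∨ : ∀ (A B : Fin n → Bool) → cnt (λ v → A v ∧ B v) + cnt (λ v → A v ∨ B v) ≡ cnt A + cnt B
  cnt-∧∨ A B = trans (sym (∑-distrib-+ (λ v → ⟦ A v ∧ B v ⟧) (λ v → ⟦ A v ∨ B v ⟧)))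
    (trans (sum-cong-≗ λ v → pt (A v) (B v)) (∑-distrib-+ (λ v → ⟦ A v ⟧) (λ v → ⟦ B v ⟧)))
    where
    pt : ∀ a b → ⟦ a ∧ b ⟧ + ⟦ a ∨ b ⟧ ≡ ⟦ a ⟧ + ⟦ b ⟧
    pt true true = refl
    pt true false = refl
    pt false true = refl
    pt false false = refl

  cnt-∖ : ∀ (A B : Fin n → Bool) → cnt (λ v → A v ∧ B v) + cnt (λ v → A v ∧ not (B v)) ≡ cnt A
  cnt-∖ A B = trans (sym (∑-distrib-+ (λ v → ⟦ A v ∧ B v ⟧) (λ v → ⟦ A v ∧ not (B v) ⟧)))
    (sum-cong-≗ λ v → pt (A v) (B v))
    where
    pt : ∀ a b → ⟦ a ∧ b ⟧ + ⟦ a ∧ not b ⟧ ≡ ⟦ a ⟧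
    pt true true = refl
    pt true false = refl
    pt false true = refl
    pt false false = refl

  cnt-shift : ∀ W u → cnt (W ∘ shift u) ≡ cnt W
  cnt-shift W u = sym (sum-permute (λ v → ⟦ W v ⟧) (shift-perm u))

  out-shift : ∀ W u v → out (W ∘ shift u) v ≡ out W (shift u v)
  out-shift W u v = sum-cong-≗ {3} λ s → cong (λ x → ⟦ W (shift u v) ∧ not (W x) ⟧) (shift-σ u s v)

  δ-shift : ∀ W u → δ (W ∘ shift u) ≡ δ W
  δ-shift W u = trans (sum-cong-≗ (out-shift W u)) (sym (sum-permute (out W) (shift-perm u)))

  -- A set of at most r vertices induces a forest.
  leaf : ∀ W u → W u ≡ true → cnt W ≤ r → ∃ λ v → W v ≡ true × 2 ≤ out W v
  leaf W u₀ in₀ le with Fin.any? (λ v → (W v Bool.≟ true) ×-dec (2 ≤? out W v))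
  ... | yes p = p
  ... | no ¬p = ⊥-elim (clash (Fin.pigeonhole (ℕ.n<1+n _) (λ i → index W (vert (toℕ i)) (inside (toℕ i)))))
    where
    stays : ∀ v (x : Letter) → W v ≡ true → ∃ λ s → s ≢ x × W (σ s v) ≡ true
    stays v x iv = go x (out≤1 iv)
      where
      out≤1 : W v ≡ true → ⟦ not (W (σ zero v)) ⟧ + (⟦ not (W (σ (suc zero) v)) ⟧ + (⟦ not (W (σ (suc (suc zero)) v)) ⟧ + 0)) ≤ 1
      out≤1 e = ℕ.≤-pred (ℕ.≰⇒> (λ two → ¬p (v , e , subst (2 ≤_) (sym (out≡ e)) two)))
        where
        out≡ : W v ≡ true → out W v ≡ ⟦ not (W (σ zero v)) ⟧ + (⟦ not (W (σ (suc zero) v)) ⟧ + (⟦ not (W (σ (suc (suc zero)) v)) ⟧ + 0))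
        out≡ e rewrite e = refl
      go : ∀ x → ⟦ not (W (σ zero v)) ⟧ + (⟦ not (W (σ (suc zero) v)) ⟧ + (⟦ not (W (σ (suc (suc zero)) v)) ⟧ + 0)) ≤ 1 →
           ∃ λ s → s ≢ x × W (σ s v) ≡ true
      go zero le with W (σ (suc zero) v) in e₁ | W (σ (suc (suc zero)) v) in e₂
      ... | true | _ = suc zero , (λ ()) , e₁
      ... | false | true = suc (suc zero) , (λ ()) , e₂
      ... | false | false = ⊥-elim (ℕ.<⇒≱ (s≤s (s≤s z≤n)) (ℕ.≤-trans (ℕ.m≤n+m _ ⟦ not (W (σ zero v)) ⟧) le))
      go (suc zero) le with W (σ zero v) in e₀ | W (σ (suc (suc zero)) v) in e₂
      ... | true | _ = zero , (λ ()) , e₀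
      ... | false | true = suc (suc zero) , (λ ()) , e₂
      ... | false | false = ⊥-elim (ℕ.<⇒≱ (s≤s (s≤s z≤n)) (ℕ.≤-trans (s≤s (ℕ.m≤n+m _ ⟦ not (W (σ (suc zero) v)) ⟧)) le))
      go (suc (suc zero)) le with W (σ zero v) in e₀ | W (σ (suc zero) v) in e₁
      ... | true | _ = zero , (λ ()) , e₀
      ... | false | true = suc zero , (λ ()) , e₁
      ... | false | false = ⊥-elim (ℕ.<⇒≱ (s≤s (s≤s z≤n)) (ℕ.≤-trans (s≤s (s≤s z≤n)) le))
    -- The letter in a state is the one just used. `stays` picks a different one, so the walk inside
    -- W never backtracks, and by pigeonhole it closes up within r steps.
    State : Set
    State = Σ (Fin n) λ v → W v ≡ true × Letter
    next : State → State
    next (v , i , x) = let s , _ , i′ = stays v x i in σ s v , i′ , s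
    state : ℕ → State
    state zero = u₀ , in₀ , zero
    state (suc j) = next (state j)
    vert : ℕ → Fin n
    vert j = proj₁ (state j)
    inside : ∀ j → W (vert j) ≡ true
    inside j = proj₁ (proj₂ (state j))
    letter : ℕ → Letter
    letter j = proj₂ (proj₂ (state (suc j)))
    clash : ¬ ∃ λ (i : Fin (suc (cnt W))) → ∃ λ j → toℕ i < toℕ j × index W (vert (toℕ i)) (inside (toℕ i)) ≡ index W (vert (toℕ j)) (inside (toℕ j))
    clash (i , j , lt , e) = path-distinct (λ k → letter (k + toℕ i)) (λ k → vert (k + toℕ i)) (toℕ j ∸ toℕ i)
      (ℕ.m<n⇒0<n∸m lt) (ℕ.≤-trans (ℕ.m∸n≤m (toℕ j) (toℕ i)) (ℕ.≤-trans (ℕ.≤-pred (Fin.toℕ<n j)) le))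
      (λ _ _ → refl)
      (λ k _ eq → let x , y , z = state (suc k + toℕ i) in proj₁ (proj₂ (stays x z y)) (sym eq))
      (trans (trans (sym (enum-index W _ _)) (trans (cong (enum W) e) (enum-index W _ _)))
        (cong vert (sym (ℕ.m∸n+n≡m (ℕ.<⇒≤ lt)))))

  remove : (Fin n → Bool) → Fin n → Fin n → Bool
  remove W v u = W u ∧ not (does (v ≟ u))

  out+in : ∀ W v → W v ≡ true → out W v + sum {3} (λ s → ⟦ W (σ s v) ⟧) ≡ 3
  out+in W v e = trans (sym (∑-distrib-+ {3} (λ s → ⟦ leaves W v s ⟧) (λ s → ⟦ W (σ s v) ⟧)))
    (sum-cong-≗ {3} {y = λ _ → 1} λ s → pt (W (σ s v)))
    where
    pt : ∀ b → ⟦ W v ∧ not b ⟧ + ⟦ b ⟧ ≡ 1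
    pt true rewrite e = refl
    pt false rewrite e = refl

  -- Edges leaving W at v drop out of the cut, and only those joining v to W can enter it;
  -- `into s u` marks the latter at their end u.
  δ-remove : ∀ W v → W v ≡ true → δ (remove W v) + out W v ≤ δ W + sum {3} (λ s → ⟦ W (σ s v) ⟧)
  δ-remove W v e = begin
    δ (remove W v) + out W v
      ≡⟨ cong (δ (remove W v) +_) (sum-select (out W) v) ⟨
    δ (remove W v) + sum (λ u → if does (v ≟ u) then out W u else 0)
      ≡⟨ ∑-distrib-+ (out (remove W v)) (λ u → if does (v ≟ u) then out W u else 0) ⟨
    sum (λ u → out (remove W v) u + (if does (v ≟ u) then out W u else 0))
      ≤⟨ sum-mono (λ u → pt u) ⟩
    sum (λ u → out W u + sum {3} (λ s → into s u))
      ≡⟨ ∑-distrib-+ (out W) (λ u → sum {3} (λ s → into s u)) ⟩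
    δ W + sum (λ u → sum {3} (λ s → into s u))
      ≡⟨ cong (δ W +_) (∑-comm (λ u s → into s u)) ⟩
    δ W + sum {3} (λ s → sum (into s))
      ≡⟨ cong (δ W +_) (sum-cong-≗ {3} λ s → trans (sum-permute (into s) (σ-perm s))
           (trans (sum-cong-≗ λ u → cong (λ x → if does (v ≟ x) then ⟦ W (σ s u) ⟧ else 0) (σ-invol s u))
             (sum-select (λ u → ⟦ W (σ s u) ⟧) v))) ⟩
    δ W + sum {3} (λ s → ⟦ W (σ s v) ⟧)                            ∎
    where
    open ℕ.≤-Reasoning
    into : Letter → Fin n → ℕ
    into s u = if does (v ≟ σ s u) then ⟦ W u ⟧ else 0
    pt₀ : ∀ a b c → ⟦ (a ∧ not false) ∧ not (b ∧ not c) ⟧ ≤ ⟦ a ∧ not b ⟧ + (if c then ⟦ a ⟧ else 0)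
    pt₀ true true true = s≤s z≤n
    pt₀ true true false = z≤n
    pt₀ true false true = s≤s z≤n
    pt₀ true false false = s≤s z≤n
    pt₀ false _ _ = z≤n
    pt : ∀ u → out (remove W v) u + (if does (v ≟ u) then out W u else 0) ≤ out W u + sum {3} (λ s → into s u)
    pt u with v ≟ u
    ... | yes refl rewrite e = ℕ.m≤m+n (sum {3} (λ s → ⟦ not (W (σ s v)) ⟧)) _
    ... | no _ = subst₂ _≤_ (sym (ℕ.+-identityʳ _)) (∑-distrib-+ {3} (λ s → ⟦ leaves W u s ⟧) (λ s → into s u))
      (sum-mono {3} λ s → pt₀ (W u) (W (σ s u)) (does (v ≟ σ s u)))

  -- Such a set can be dismantled one vertex at a time. The vertex found by `leaf` has at least two
  -- edges leaving W, hence at most one inside, and removing it lowers the boundary by at least one.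
  small-boundary : ∀ k W → cnt W ≡ k → k ≤ r → k ≤ δ W
  small-boundary zero W c le = z≤n
  small-boundary (suc k) W c le
    with leaf W _ (proj₁ (proj₂ (pick 1 W (subst (1 ≤_) (sym c) (s≤s z≤n)))) zero) (subst (_≤ r) (sym c) le)
  ... | v , iv , two = ℕ.+-cancelʳ-≤ 1 (suc k) (δ W) (begin
    suc k + 1                          ≡⟨ ℕ.+-comm (suc k) 1 ⟩
    2 + k                              ≡⟨ ℕ.+-comm 2 k ⟩
    k + 2                              ≤⟨ ℕ.+-mono-≤ (small-boundary k (remove W v) size (ℕ.<⇒≤ le)) two ⟩
    δ (remove W v) + out W v           ≤⟨ δ-remove W v iv ⟩
    δ W + sum {3} (λ s → ⟦ W (σ s v) ⟧) ≤⟨ ℕ.+-monoʳ-≤ (δ W) few ⟩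
    δ W + 1                            ∎)
    where
    open ℕ.≤-Reasoning
    few : sum {3} (λ s → ⟦ W (σ s v) ⟧) ≤ 1
    few = ℕ.+-cancelˡ-≤ 2 _ _ (ℕ.≤-trans (ℕ.+-monoˡ-≤ _ two) (ℕ.≤-reflexive (out+in W v iv)))
    single : cnt (λ u → W u ∧ does (v ≟ u)) ≡ 1
    single = trans (sum-cong-≗ λ u → pt u) (sum-indicator v)
      where
      pt : ∀ u → ⟦ W u ∧ does (v ≟ u) ⟧ ≡ ⟦ does (v ≟ u) ⟧
      pt u with v ≟ u
      ... | yes refl rewrite iv = refl
      ... | no _ = cong ⟦_⟧ (Bool.∧-zeroʳ (W u))
    size : cnt (remove W v) ≡ k
    size = ℕ.suc-injective (trans (cong (_+ cnt (remove W v)) (sym single)) (trans (cnt-∖ W (λ u → does (v ≟ u))) c))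

  -- Two translates of a minimal thick set that share a vertex coincide, since otherwise
  -- uncrossing them gives a smaller thick set. Hence all vertices of W have the same number
  -- of neighbours outside W, and δ W ≥ cnt W unless W is a union of components.
  module NoCut (k m : ℕ) (k<m : k < m) (2m≤r : m + m ≤ r) where

    Thick : (Fin n → Bool) → Set
    Thick W = m ≤ cnt W × m ≤ cnt (not ∘ W) × δ W ≤ k

    -- The lexicographic order on the pair (`δ W`, `cnt W`): sizes never exceed n, so a smaller
    -- boundary outweighs any change of size.
    μ : (Fin n → Bool) → ℕ
    μ W = δ W * suc n + cnt W

    cnt≤n : ∀ (W : Fin n → Bool) → cnt W ≤ n
    cnt≤n W = subst (cnt W ≤_) (cnt-not W) (ℕ.m≤m+n _ _)

    μ-δ : ∀ A W → δ A < δ W → μ A < μ W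
    μ-δ A W lt = begin-strict
      δ A * suc n + cnt A    <⟨ ℕ.+-monoʳ-< (δ A * suc n) (s≤s (cnt≤n A)) ⟩
      δ A * suc n + suc n    ≡⟨ ℕ.+-comm (δ A * suc n) (suc n) ⟩
      suc (δ A) * suc n      ≤⟨ ℕ.*-monoˡ-≤ (suc n) lt ⟩
      δ W * suc n            ≤⟨ ℕ.m≤m+n _ _ ⟩
      μ W                    ∎
      where open ℕ.≤-Reasoning

    μ-cnt : ∀ A W → δ A ≤ δ W → cnt A < cnt W → μ A < μ W
    μ-cnt A W le lt = ℕ.+-mono-≤-< (ℕ.*-monoˡ-≤ (suc n) le) lt

    cnt-not-mono : ∀ {A B : Fin n → Bool} → (∀ v → A v ≡ true → B v ≡ true) → cnt (not ∘ B) ≤ cnt (not ∘ A)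
    cnt-not-mono {A} {B} h = cnt-mono λ v → lem (A v) (B v) (h v)
      where
      lem : ∀ a b → (a ≡ true → b ≡ true) → not b ≡ true → not a ≡ true
      lem false b f e = refl
      lem true false f e = f refl

    balance : ∀ a b c → a + b ≤ c + c → ¬ (a ≤ c) → b < c
    balance a b c le a≰c = ℕ.+-cancelˡ-< c b c (ℕ.<-≤-trans (ℕ.+-monoˡ-< b (ℕ.≰⇒> a≰c)) le)

    module Step (W : Fin n → Bool) (ih : ∀ A → μ A < μ W → ¬ Thick A) (thick : Thick W) where

      big : m ≤ cnt W
      big = proj₁ thick

      thin : δ W ≤ k
      thin = proj₂ (proj₂ thick)

      -- Otherwise `small-boundary` bounds `cnt W` by `δ W`, which is at most k and thus below m.
      large : r < cnt W
      large = ℕ.≰⇒> λ le → ℕ.<-irrefl refl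
        (ℕ.≤-<-trans (ℕ.≤-trans (small-boundary (cnt W) W refl le) thin) (ℕ.<-≤-trans k<m big))

      -- The complement is thick with the same boundary, so minimality has selected the side with at
      -- most half of the vertices.
      smaller-side : cnt W ≤ cnt (not ∘ W)
      smaller-side = ℕ.≮⇒≥ λ lt → ih (not ∘ W) (μ-cnt (not ∘ W) W (ℕ.≤-reflexive (δ-not W)) lt)
        (proj₁ (proj₂ thick) , subst (m ≤_) (cnt-cong λ v → sym (Bool.not-involutive (W v))) big ,
         subst (_≤ k) (sym (δ-not W)) thin)

      module Cross (A B : Fin n → Bool) (cA : cnt A ≡ cnt W) (cB : cnt B ≡ cnt W) (dA : δ A ≡ δ W) (dB : δ B ≡ δ W)
                   (o : Fin n) (oA : A o ≡ true) (oB : B o ≡ true) (v : Fin n) (vA : A v ≡ true) (vB : B v ≡ false) where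

        A∩B A∪B A∖B A∪B′ : Fin n → Bool
        A∩B u = A u ∧ B u
        A∪B u = A u ∨ B u
        A∖B u = A u ∧ not (B u)
        A∪B′ u = A u ∨ not (B u)

        notA : m ≤ cnt (not ∘ A)
        notA = ℕ.≤-trans (proj₁ (proj₂ thick)) (ℕ.≤-reflexive (ℕ.+-cancelˡ-≡ (cnt W) _ _
          (trans (cnt-not W) (trans (sym (cnt-not A)) (cong (_+ cnt (not ∘ A)) cA)))))

        ⊆A : ∀ (X : Fin n → Bool) u → A u ∧ X u ≡ true → A u ≡ true
        ⊆A X u e = proj₁ (∧-split {A u} e)

        A⊆ : ∀ (X : Fin n → Bool) u → A u ≡ true → A u ∨ X u ≡ true
        A⊆ X u e rewrite e = refl

        bigA : ∀ (X : Fin n → Bool) → m ≤ cnt (λ u → A u ∨ X u)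
        bigA X = ℕ.≤-trans big (subst (_≤ _) cA (cnt-mono (A⊆ X)))

        -- By submodularity the intersection or the union has boundary at most `δ W`. The
        -- intersection is smaller than A because it misses v. The union is used only when its
        -- boundary is strictly smaller; its complement has at least as many vertices as the
        -- intersection, because W is at most half of everything.
        meet : m ≤ cnt A∩B → ⊥
        meet le with δ A∩B ≤? δ W
        ... | yes d = ih A∩B (μ-cnt A∩B W d (subst (cnt A∩B <_) cA
                (cnt-strict (⊆A B) v (trans (cong (A v ∧_) vB) (Bool.∧-zeroʳ (A v))) vA)))
                (le , ℕ.≤-trans notA (cnt-not-mono (⊆A B)) , ℕ.≤-trans d thin)
        ... | no d = ih A∪B (μ-δ A∪B W lt) (bigA B , ℕ.≤-trans le rest , ℕ.≤-trans (ℕ.<⇒≤ lt) thin)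
          where
          lt : δ A∪B < δ W
          lt = balance _ _ _ (subst (δ A∩B + δ A∪B ≤_) (cong₂ _+_ dA dB) (submodular A B)) d
          rest : cnt A∩B ≤ cnt (not ∘ A∪B)
          rest = ℕ.+-cancelʳ-≤ (cnt A∪B) _ _ (begin
            cnt A∩B + cnt A∪B            ≡⟨ cnt-∧∨ A B ⟩
            cnt A + cnt B                ≡⟨ cong₂ _+_ cA cB ⟩
            cnt W + cnt W                ≤⟨ ℕ.+-monoʳ-≤ (cnt W) smaller-side ⟩
            cnt W + cnt (not ∘ W)        ≡⟨ cnt-not W ⟩
            n                            ≡⟨ cnt-not A∪B ⟨
            cnt A∪B + cnt (not ∘ A∪B)    ≡⟨ ℕ.+-comm (cnt A∪B) _ ⟩
            cnt (not ∘ A∪B) + cnt A∪B    ∎)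
            where open ℕ.≤-Reasoning

        -- A small intersection leaves at least m vertices in both differences, as 2m ≤ r < `cnt W`.
        -- Hence A is uncrossed with the complement of B, and the common vertex o makes A minus B
        -- strictly smaller than A.
        diff : cnt A∩B < m → ⊥
        diff lt with δ A∖B ≤? δ W
        ... | yes d = ih A∖B (μ-cnt A∖B W d (subst (cnt A∖B <_) cA
                (cnt-strict (⊆A (not ∘ B)) o (trans (cong (λ x → A o ∧ not x) oB) (Bool.∧-zeroʳ (A o))) oA)))
                (room A B cA lt , ℕ.≤-trans notA (cnt-not-mono (⊆A (not ∘ B))) , ℕ.≤-trans d thin)
          where
          room : ∀ (A B : Fin n → Bool) → cnt A ≡ cnt W → cnt (λ u → A u ∧ B u) < m → m ≤ cnt (λ u → A u ∧ not (B u))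
          room A B c lt = ℕ.<⇒≤ (ℕ.+-cancelˡ-< m _ _ (ℕ.≤-<-trans 2m≤r (ℕ.<-≤-trans large (ℕ.≤-trans
            (ℕ.≤-reflexive (trans (sym c) (sym (cnt-∖ A B)))) (ℕ.+-monoˡ-≤ _ (ℕ.<⇒≤ lt))))))
        ... | no d = ih A∪B′ (μ-δ A∪B′ W lt′) (bigA (not ∘ B) , room , ℕ.≤-trans (ℕ.<⇒≤ lt′) thin)
          where
          lt′ : δ A∪B′ < δ W
          lt′ = balance _ _ _ (subst (δ A∖B + δ A∪B′ ≤_) (cong₂ _+_ dA (trans (δ-not B) dB)) (submodular A (not ∘ B))) d
          pt : ∀ a b → b ∧ not a ≡ not (a ∨ not b)
          pt true true = refl
          pt true false = refl
          pt false true = refl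
          pt false false = refl
          room : m ≤ cnt (not ∘ A∪B′)
          room = subst (m ≤_) (cnt-cong λ u → pt (A u) (B u))
            (ℕ.<⇒≤ (ℕ.+-cancelˡ-< m _ _ (ℕ.≤-<-trans 2m≤r (ℕ.<-≤-trans large (ℕ.≤-trans
              (ℕ.≤-reflexive (trans (sym cB) (sym (cnt-∖ B A))))
              (ℕ.+-monoˡ-≤ _ (ℕ.<⇒≤ (subst (_< m) (cnt-cong λ u → Bool.∧-comm (A u) (B u)) lt))))))))

        absurd : ⊥
        absurd with m ≤? cnt A∩B
        ... | yes le = meet le
        ... | no nle = diff (ℕ.≰⇒> nle)

      -- Both preimages contain `base`, since `shift u` carries it to u; so they meet, and `Cross`
      -- applies.
      same : ∀ u u′ → W u ≡ true → W u′ ≡ true → W ∘ shift u ≗ W ∘ shift u′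
      same u u′ i i′ v with W (shift u v) in e | W (shift u′ v) in e′
      ... | true | true = refl
      ... | false | false = refl
      ... | true | false = ⊥-elim (Cross.absurd (W ∘ shift u) (W ∘ shift u′)
        (cnt-shift W u) (cnt-shift W u′) (δ-shift W u) (δ-shift W u′) base
        (trans (cong W (shift-base u)) i) (trans (cong W (shift-base u′)) i′) v e e′)
      ... | false | true = ⊥-elim (Cross.absurd (W ∘ shift u′) (W ∘ shift u)
        (cnt-shift W u′) (cnt-shift W u) (δ-shift W u′) (δ-shift W u) base
        (trans (cong W (shift-base u′)) i′) (trans (cong W (shift-base u)) i) v e′ e)

      out-const : ∀ u u′ → W u ≡ true → W u′ ≡ true → out W u ≡ out W u′
      out-const u u′ i i′ = begin
        out W u                         ≡⟨ cong (out W) (shift-base u) ⟨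
        out W (shift u base)            ≡⟨ out-shift W u base ⟨
        out (W ∘ shift u) base          ≡⟨ sum-cong-≗ {3} (λ s → cong₂ (λ x y → ⟦ x ∧ not y ⟧) (same u u′ i i′ base) (same u u′ i i′ (σ s base))) ⟩
        out (W ∘ shift u′) base         ≡⟨ out-shift W u′ base ⟩
        out W (shift u′ base)           ≡⟨ cong (out W) (shift-base u′) ⟩
        out W u′                        ∎
        where open ≡-Reasoning

      1≤m : 1 ≤ m
      1≤m = ℕ.≤-trans (s≤s z≤n) k<m

      inner : ∃ λ u → W u ≡ true
      inner with pick 1 W (ℕ.≤-trans 1≤m big)
      ... | f , h , _ = f zero , h zero

      outer : ∃ λ u → not (W u) ≡ true
      outer with pick 1 (not ∘ W) (ℕ.≤-trans 1≤m (proj₁ (proj₂ thick)))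
      ... | f , h , _ = f zero , h zero

      sum-zero : ∀ {j} {f : Fin j → ℕ} → sum f ≡ 0 → ∀ i → f i ≡ 0
      sum-zero {suc j} {f} e zero = ℕ.m+n≡0⇒m≡0 (f zero) e
      sum-zero {suc j} {f} e (suc i) = sum-zero (ℕ.m+n≡0⇒n≡0 (f zero) e) i

      contradiction : ⊥
      contradiction with out W (proj₁ inner) in eq
      ... | suc c = ℕ.<-irrefl refl (ℕ.<-≤-trans (ℕ.≤-<-trans thin k<m) (ℕ.≤-trans big (sum-mono pt)))
        where
        pt : ∀ v → ⟦ W v ⟧ ≤ out W v
        pt v with W v in e
        ... | false = z≤n
        ... | true = subst (1 ≤_) (trans (sym eq) (trans (out-const _ v (proj₂ inner) e) (cong (λ b → sum {3} (λ s → ⟦ b ∧ not (W (σ s v)) ⟧)) e))) (s≤s z≤n)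
      ... | zero = true≢false (trans (sym (closed-act (proj₁ (word (proj₁ outer))) base base∈)) (trans (cong W (proj₂ (word (proj₁ outer)))) (not-true (proj₂ outer))))
        where
        not-true : ∀ {b} → not b ≡ true → b ≡ false
        not-true {false} e = refl
        closed : ∀ v s → W v ≡ true → W (σ s v) ≡ true
        closed v s i = lem (W (σ s v)) (trans (cong (λ b → ⟦ b ∧ not (W (σ s v)) ⟧) (sym i))
          (sum-zero {3} {λ s → ⟦ leaves W v s ⟧} (trans (sym (out-const _ v (proj₂ inner) i)) eq) s))
          where
          lem : ∀ b → ⟦ not b ⟧ ≡ 0 → b ≡ true
          lem true e = refl
        closed-act : ∀ w v → W v ≡ true → W (act σ w v) ≡ true
        closed-act [] v i = i
        closed-act (s ∷ w) v i = closed-act w (σ s v) (closed v s i)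
        base∈ : W base ≡ true
        base∈ with word (proj₁ inner)
        ... | w , e = subst (λ x → W x ≡ true) (trans (cong (act σ (reverse w)) (sym e)) (act-reverse σ σ-invol w base))
          (closed-act (reverse w) (proj₁ inner) (proj₂ inner))

    no-thick : ∀ W → ¬ Thick W
    no-thick W = go W (<-wellFounded (μ W))
      where
      go : ∀ W → Acc _<_ (μ W) → ¬ Thick W
      go W (acc rs) thick = Step.contradiction W (λ A lt → go A (rs lt)) thick

-- Cubic graphs as involutions on darts

-- A loopless cubic graph as an involution τ of its darts: the three darts at a
-- vertex v are the pairs (v , i), and τ reverses darts.
record DartGraph : Set₁ where
  field
    V       : Set
    N       : ℕ
    enc     : V → Fin N
    dec     : Fin N → V
    dec-enc : ∀ v → dec (enc v) ≡ v
    enc-dec : ∀ i → enc (dec i) ≡ i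
    τ       : V × Fin 3 → V × Fin 3
    τ-invol : ∀ d → τ (τ d) ≡ d
    τ-loop  : ∀ d → proj₁ (τ d) ≢ proj₁ d

  Dart : Set
  Dart = V × Fin 3

  enc-inj : ∀ {u v} → enc u ≡ enc v → u ≡ v
  enc-inj {u} {v} e = trans (sym (dec-enc u)) (trans (cong dec e) (dec-enc v))

  src dst : Dart → V
  src = proj₁
  dst = proj₁ ∘ τ

  -- Infinite, so that circuits of every length unroll into walks of one type, which can be followed
  -- for as long as they take to settle.
  record NBWalk : Set where
    field
      ω    : ℕ → Dart
      step : ∀ j → src (ω (suc j)) ≡ dst (ω j)
      nb   : ∀ j → ω (suc j) ≢ τ (ω j)

  data Path (bad : Dart → Bool) : V → V → Set where
    []   : ∀ {u} → Path bad u u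
    cons : ∀ {v} d → bad d ≡ false → Path bad (dst d) v → Path bad (src d) v

  infixr 5 _++ₚ_
  _++ₚ_ : ∀ {bad u v w} → Path bad u v → Path bad v w → Path bad u w
  [] ++ₚ q = q
  cons d b p ++ₚ q = cons d b (p ++ₚ q)

  edge : ∀ {bad} d → bad d ≡ false → Path bad (src d) (dst d)
  edge d b = cons d b []

  reverseₚ : ∀ {bad} → (∀ d → bad (τ d) ≡ bad d) → ∀ {u v} → Path bad u v → Path bad v u
  reverseₚ sy [] = []
  reverseₚ sy (cons d b p) = reverseₚ sy p ++ₚ subst (Path _ _) (cong proj₁ (τ-invol d))
    (cons (τ d) (trans (sy d) b) [])

module ToGraph (D : DartGraph) where

  open DartGraph D public

  key : Dart → Fin (N * 3)
  key (v , i) = combine (enc v) i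

  unkey : Fin (N * 3) → Dart
  unkey k = dec (proj₁ (remQuot {N} 3 k)) , proj₂ (remQuot {N} 3 k)

  unkey-key : ∀ d → unkey (key d) ≡ d
  unkey-key (v , i) = trans (cong (λ x → dec (proj₁ x) , proj₂ x) (Fin.remQuot-combine (enc v) i))
                            (cong (_, i) (dec-enc v))

  key-unkey : ∀ k → key (unkey k) ≡ k
  key-unkey k = trans (cong (λ x → combine x (proj₂ (remQuot {N} 3 k))) (enc-dec _)) (Fin.combine-remQuot {N} 3 k)

  key-inj : ∀ {d e} → key d ≡ key e → d ≡ e
  key-inj {d} {e} q = trans (sym (unkey-key d)) (trans (cong unkey q) (unkey-key e))

  τk : Fin (N * 3) → Fin (N * 3)
  τk k = key (τ (unkey k))

  τk-invol : ∀ k → τk (τk k) ≡ k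
  τk-invol k = trans (cong (key ∘ τ) (unkey-key (τ (unkey k)))) (trans (cong key (τ-invol (unkey k))) (key-unkey k))

  τk-≢ : ∀ k → τk k ≢ k
  τk-≢ k e = τ-loop (unkey k) (cong proj₁ (key-inj (trans e (sym (key-unkey k)))))

  -- Each edge is represented by its dart with the smaller key.
  up : Fin (N * 3) → Bool
  up k = does (toℕ k <? toℕ (τk k))

  up-τ : ∀ k → up (τk k) ≡ not (up k)
  up-τ k = trans (cong (λ x → does (toℕ (τk k) <? toℕ x)) (τk-invol k))
                 (<-flip (toℕ k) (toℕ (τk k)) λ e → τk-≢ k (sym (Fin.toℕ-injective e)))

  M : ℕ
  M = cnt up

  dart : Fin M → Fin 2 → Dart
  dart e zero = unkey (enum up e)
  dart e (suc _) = τ (unkey (enum up e))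

  graph : Graph
  graph = record { n = N ; m = M ; ends = λ e → enc (src (dart e zero)) , enc (dst (dart e zero)) }

  end≡ : ∀ e i → end graph e i ≡ enc (src (dart e i))
  end≡ e zero = refl
  end≡ e (suc _) = refl

  half : ∀ d → ∃ λ e → ∃ λ i → dart e i ≡ d
  half d with up (key d) in eq
  ... | true = index up (key d) eq , zero , trans (cong unkey (enum-index up _ eq)) (unkey-key d)
  ... | false = index up (τk (key d)) eq′ , suc zero ,
      trans (cong (τ ∘ unkey) (enum-index up _ eq′))
        (trans (cong τ (unkey-key _)) (trans (τ-invol _) (unkey-key d)))
    where
    eq′ : up (τk (key d)) ≡ true
    eq′ = trans (up-τ (key d)) (cong not eq)

  dart-flip : ∀ e e′ → dart e zero ≢ dart e′ (suc zero)
  dart-flip e e′ q = true≢false (trans (sym (enum-sat up e)) (trans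
    (cong up (trans (sym (key-unkey _)) (cong key q))) (trans (up-τ _) (cong not (enum-sat up e′)))))

  dart-inj : ∀ e i e′ i′ → dart e i ≡ dart e′ i′ → (e , i) ≡ (e′ , i′)
  dart-inj e zero e′ zero q = cong (_, zero) (enum-injective up
    (trans (sym (key-unkey _)) (trans (cong key q) (key-unkey _))))
  dart-inj e zero e′ (suc zero) q = ⊥-elim (dart-flip e e′ q)
  dart-inj e (suc zero) e′ zero q = ⊥-elim (dart-flip e′ e (sym q))
  dart-inj e (suc zero) e′ (suc zero) q = cong (_, suc zero) (cong proj₁ (dart-inj e zero e′ zero
    (trans (sym (τ-invol _)) (trans (cong τ q) (τ-invol _)))))

  edgeOf : Dart → Fin M
  edgeOf d = proj₁ (half d)

  flip : Fin 2 → Fin 2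
  flip zero = suc zero
  flip (suc zero) = zero

  dart-τ : ∀ e i → dart e (flip i) ≡ τ (dart e i)
  dart-τ e zero = refl
  dart-τ e (suc zero) = sym (τ-invol _)

  edgeOf-dart : ∀ e i → edgeOf (dart e i) ≡ e
  edgeOf-dart e i with half (dart e i)
  ... | e′ , i′ , q = cong proj₁ (dart-inj e′ i′ e i q)

  edgeOf-τ : ∀ d → edgeOf (τ d) ≡ edgeOf d
  edgeOf-τ d with half d
  ... | e , i , refl = trans (cong edgeOf (sym (dart-τ e i))) (edgeOf-dart e (flip i))

  edgeOf-inj : ∀ d d′ → edgeOf d ≡ edgeOf d′ → d ≡ d′ ⊎ d ≡ τ d′
  edgeOf-inj d d′ q with half d | half d′
  edgeOf-inj d d′ refl | e , zero , refl | .e , zero , refl = inj₁ refl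
  edgeOf-inj d d′ refl | e , zero , refl | .e , suc zero , refl = inj₂ (sym (τ-invol _))
  edgeOf-inj d d′ refl | e , suc zero , refl | .e , zero , refl = inj₂ refl
  edgeOf-inj d d′ refl | e , suc zero , refl | .e , suc zero , refl = inj₁ refl

  sum-list : ∀ {k} {A : Set} (f : A → ℕ) (g : Fin k → A) →
             Data.Nat.ListAction.sum (List.map f (List.tabulate g)) ≡ sum (f ∘ g)
  sum-list {zero} f g = refl
  sum-list {suc k} f g = cong (f (g zero) +_) (sum-list f (g ∘ suc))

  -- Every edge contributes its two darts, and τ exchanges the darts that are `up` with the others.
  -- So the degree is a sum over all darts, three of which leave each vertex.
  cubic : Cubic graph
  cubic v = begin
    degree graph v
      ≡⟨ sum-list (λ e → F (dart e zero) + F (dart e (suc zero))) id ⟩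
    sum (λ e → F (unkey (enum up e)) + F (τ (unkey (enum up e))))
      ≡⟨ sum-enum up (λ k → F (unkey k) + F (τ (unkey k))) ⟩
    sum (λ k → if up k then F (unkey k) + F (τ (unkey k)) else 0)
      ≡⟨ sum-cong-≗ (λ k → split (up k)) ⟩
    sum (λ k → (if up k then F (unkey k) else 0) + (if up k then F (τ (unkey k)) else 0))
      ≡⟨ ∑-distrib-+ (λ k → if up k then F (unkey k) else 0) (λ k → if up k then F (τ (unkey k)) else 0) ⟩
    sum (λ k → if up k then F (unkey k) else 0) + sum (λ k → if up k then F (τ (unkey k)) else 0)
      ≡⟨ cong (sum (λ k → if up k then F (unkey k) else 0) +_) (trans
           (sum-permute (λ k → if up k then F (τ (unkey k)) else 0) (permutation τk τk τk-invol τk-invol))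
           (sum-cong-≗ λ k → cong₂ (λ b x → if b then F x else 0) (up-τ k)
             (trans (cong τ (unkey-key _)) (τ-invol _)))) ⟩
    sum (λ k → if up k then F (unkey k) else 0) + sum (λ k → if not (up k) then F (unkey k) else 0)
      ≡⟨ ∑-distrib-+ (λ k → if up k then F (unkey k) else 0) (λ k → if not (up k) then F (unkey k) else 0) ⟨
    sum (λ k → (if up k then F (unkey k) else 0) + (if not (up k) then F (unkey k) else 0))
      ≡⟨ sum-cong-≗ (λ k → join (up k)) ⟩
    sum (λ k → F (unkey k))
      ≡⟨ sum-* N 3 (λ k → F (unkey k)) ⟩
    sum (λ u → sum (λ i → F (unkey (combine {N} {3} u i))))
      ≡⟨ sum-cong-≗ (λ u → sum-cong-≗ {3} λ i → cong (λ x → if ⌊ x ≟ v ⌋ then 1 else 0)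
           (trans (enc-dec _) (cong proj₁ (Fin.remQuot-combine {N} u i)))) ⟩
    sum (λ u → sum {3} (λ i → if ⌊ u ≟ v ⌋ then 1 else 0))
      ≡⟨ ∑-comm (λ u (i : Fin 3) → if ⌊ u ≟ v ⌋ then 1 else 0) ⟩
    sum {3} (λ i → sum (λ u → if ⌊ u ≟ v ⌋ then 1 else 0))
      ≡⟨ sum-cong-≗ {3} (λ i → trans (sum-cong-≗ one) (sum-indicator v)) ⟩
    3 ∎
    where
    open ≡-Reasoning
    F : Dart → ℕ
    F d = if ⌊ enc (src d) ≟ v ⌋ then 1 else 0
    split : ∀ b {x y} → (if b then x + y else 0) ≡ (if b then x else 0) + (if b then y else 0)
    split true = refl
    split false = refl
    join : ∀ b {x} → (if b then x else 0) + (if not b then x else 0) ≡ x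
    join true = ℕ.+-identityʳ _
    join false = refl
    one : ∀ u → (if ⌊ u ≟ v ⌋ then 1 else 0) ≡ ⟦ does (v ≟ u) ⟧
    one u with u ≟ v | v ≟ u
    ... | yes _ | yes _ = refl
    ... | no _ | no _ = refl
    ... | yes p | no q = ⊥-elim (q (sym p))
    ... | no p | yes q = ⊥-elim (p (sym q))

  module Colouring (c : Fin M → Fin 3) (proper : Proper3EdgeColouring graph c) where

    κ : Dart → Fin 3
    κ d = c (edgeOf d)

    κ-τ : ∀ d → κ (τ d) ≡ κ d
    κ-τ d = cong c (edgeOf-τ d)

    κ-inj : ∀ v i j → κ (v , i) ≡ κ (v , j) → i ≡ j
    κ-inj v i j q with i ≟ j
    ... | yes p = p
    ... | no i≢j = ⊥-elim (go (half (v , i)) (half (v , j)) refl refl)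
      where
      go : (x : ∃ λ e → ∃ λ a → dart e a ≡ (v , i)) (y : ∃ λ e → ∃ λ a → dart e a ≡ (v , j)) →
           x ≡ half (v , i) → y ≡ half (v , j) → ⊥
      go (e , a , p) (e′ , a′ , p′) hx hy = proper e e′ a a′
        (λ s → i≢j (cong proj₂ (trans (sym p) (trans (cong (λ x → dart (proj₁ x) (proj₂ x)) s) p′))))
        (trans (end≡ e a) (trans (cong (enc ∘ src) (trans p refl)) (sym (trans (end≡ e′ a′) (cong (enc ∘ src) p′)))))
        (trans (cong (c ∘ proj₁) hx) (trans q (cong (c ∘ proj₁) (sym hy))))

  edgeOf-joins : ∀ d → Joins graph (edgeOf d) (enc (src d)) (enc (dst d))
  edgeOf-joins d with half d
  ... | e , zero , refl = inj₁ (refl , refl)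
  ... | e , suc zero , refl = inj₂ (cong (enc ∘ src) (sym (τ-invol _)) , refl)

  toWalk : ∀ (VOk : Fin N → Set) (EOk : Fin M → Set) (bad : Dart → Bool) →
           (∀ d → bad d ≡ false → EOk (edgeOf d) × VOk (enc (dst d))) →
           ∀ {u v} → VOk (enc u) → Path bad u v → Walk graph VOk EOk (enc u) (enc v)
  toWalk VOk EOk bad h ok [] = here ok
  toWalk VOk EOk bad h ok (cons d b p) = there (edgeOf d) ok (proj₁ (h d b)) (edgeOf-joins d)
    (toWalk VOk EOk bad h (proj₂ (h d b)) p)

  module FromCircuit (C : Circuit graph) where

    open Circuit C

    at : ∀ i → ∃ λ d → enc (src d) ≡ vs i × enc (dst d) ≡ vs (Defs.next graph i) × edgeOf d ≡ es i
    at i with joins i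
    ... | inj₁ (p , q) = dart (es i) zero , p , q , edgeOf-dart (es i) zero
    ... | inj₂ (p , q) = dart (es i) (suc zero) , q ,
      trans (cong (enc ∘ src) (τ-invol _)) p , edgeOf-dart (es i) (suc zero)

    idx : ℕ → Fin (suc l)
    idx zero = zero
    idx (suc j) = Defs.next graph (idx j)

    nbwalk : NBWalk
    nbwalk = record
      { ω = λ j → proj₁ (at (idx j))
      ; step = λ j → enc-inj (trans (proj₁ (proj₂ (at (idx (suc j))))) (sym (proj₁ (proj₂ (proj₂ (at (idx j)))))))
      -- Turning back would use one edge twice in a row; `es-inj` then makes the two indices equal
      -- and the edge a loop.
      ; nb = λ j q → let i = idx j; i′ = idx (suc j) in
          τ-loop (proj₁ (at i)) (enc-inj (trans (proj₁ (proj₂ (proj₂ (at i))))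
            (trans (cong vs (es-inj (trans (sym (proj₂ (proj₂ (proj₂ (at i′)))))
              (trans (cong edgeOf q) (trans (edgeOf-τ _) (proj₂ (proj₂ (proj₂ (at i)))))))))
              (sym (proj₁ (proj₂ (at i)))))))
      }

    open NBWalk nbwalk public

    ω-edge : ∀ j → edgeOf (ω j) ≡ es (idx j)
    ω-edge j = proj₂ (proj₂ (proj₂ (at (idx j))))

    ω-start : enc (src (ω 0)) ≡ vs zero
    ω-start = proj₁ (proj₂ (at zero))

    -- The starting time j is free because the distinctness to be contradicted holds only after the
    -- walk has settled.
    repeat : ∀ j → ∃ λ a → ∃ λ b → a < b × b ≤ suc l × ω (a + j) ≡ ω (b + j)
    repeat j with Fin.pigeonhole (ℕ.n<1+n (suc l)) (λ i → idx (toℕ i + j))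
    ... | a , b , lt , e = toℕ a , toℕ b , lt , ℕ.≤-pred (Fin.toℕ<n b) , cong (λ i → proj₁ (at i)) e

  mkCircuit : ∀ l (d : Fin (suc l) → Dart) → (∀ {i j} → src (d i) ≡ src (d j) → i ≡ j) →
              (∀ {i j} → edgeOf (d i) ≡ edgeOf (d j) → i ≡ j) →
              (∀ i → dst (d i) ≡ src (d (Defs.next graph i))) → Circuit graph
  mkCircuit l d vinj einj adj = record
    { l = l ; vs = enc ∘ src ∘ d ; es = edgeOf ∘ d
    ; vs-inj = λ q → vinj (enc-inj q) ; es-inj = einj
    ; joins = λ i → subst (Joins graph (edgeOf (d i)) (enc (src (d i)))) (cong enc (adj i)) (edgeOf-joins (d i)) }

-- Flows over the Klein four-group and blueprints

module Xor = Algebra.Properties.CommutativeMonoid.Sum (CommutativeRing.+-commutativeMonoid Bool.xor-∧-commutativeRing)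

K₄ : Set
K₄ = Bool × Bool

𝟘 : K₄
𝟘 = false , false

infixr 6 _⊕_
_⊕_ : K₄ → K₄ → K₄
(a , b) ⊕ (c , d) = (a xor c) , (b xor d)

-- Colours become the nonzero elements of the Klein four-group; the sum of all three is zero, so a
-- proper colouring is a nowhere-zero flow.
hue : Fin 3 → K₄
hue zero = true , false
hue (suc zero) = false , true
hue (suc (suc zero)) = true , true

-- A graph made of cubic nodes and hubs; the dart inj₁ (i , s) leaves node i at
-- its slot s, the dart inj₂ q leaves hub q at port q, and port q is also the
-- node slot at the other end of the edge. No edge joins two hubs.
module Wiring {nodes ports hubs : ℕ}
  (slot : Fin nodes → Fin 3 → (Fin nodes × Fin 3) ⊎ Fin ports)
  (port : Fin ports → Fin nodes × Fin 3)
  (hub : Fin ports → Fin hubs)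
  where

  QDart Place : Set
  QDart = (Fin nodes × Fin 3) ⊎ Fin ports
  Place = Fin nodes ⊎ Fin hubs

  partner : QDart → QDart
  partner (inj₁ (i , s)) = slot i s
  partner (inj₂ q) = inj₁ (port q)

  place : QDart → Place
  place (inj₁ (i , _)) = inj₁ i
  place (inj₂ q) = inj₂ (hub q)

  Joined : Place → List QDart → Place → Set
  Joined a [] b = a ≡ b
  Joined a (d ∷ ds) b = place d ≡ a × Joined (place (partner d)) ds b

  -- The nodes form a rooted forest: along its parent slot a node is joined to a
  -- higher node; its other slots lead to ports or to the parent slots of lower nodes.
  Rank : (Fin nodes → Fin 3 → Bool) → (Fin nodes → ℕ) → Fin nodes → Fin 3 → QDart → Set
  Rank isParent height i s (inj₁ (j , t)) =
    if isParent i s then isParent j t ≡ false × height i < height j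
                    else isParent j t ≡ true × height j < height i
  Rank isParent height i s (inj₂ q) = isParent i s ≡ false

  hubSum : (Fin ports → Bool) → Fin hubs → Bool
  hubSum f x = Xor.sum (λ q → if does (hub q ≟ x) then f q else false)

  -- Values are recorded at node ends only, which suffices because every edge has one. The hub
  -- equations are split by coordinates since `hubSum` adds Booleans.
  record Flow : Set where
    field
      F      : Fin nodes × Fin 3 → K₄
      F-nz   : ∀ d → F d ≢ 𝟘
      F-node : ∀ i → F (i , zero) ⊕ F (i , suc zero) ⊕ F (i , suc (suc zero)) ≡ 𝟘
      F-slot : ∀ i s d → slot i s ≡ inj₁ d → F (i , s) ≡ F d
      F-hub₁ : ∀ x → hubSum (λ q → proj₁ (F (port q))) x ≡ false
      F-hub₂ : ∀ x → hubSum (λ q → proj₂ (F (port q))) x ≡ false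

-- The finite data from which the snarks are built. The rooted forest expresses that the hubs meet
-- every circuit; the bound 3 on heights is what trees of depth two need. Five edge-disjoint trails
-- from each hub to an earlier one ensure that four deletions leave all hubs linked.
record Blueprint : Set where
  field
    nodes ports hubs : ℕ
    slot     : Fin nodes → Fin 3 → (Fin nodes × Fin 3) ⊎ Fin ports
    port     : Fin ports → Fin nodes × Fin 3
    hub      : Fin ports → Fin (suc hubs)
  open Wiring slot port hub public
  field
    slot-involutive : ∀ i s → partner (slot i s) ≡ inj₁ (i , s)
    port-involutive : ∀ q → partner (inj₁ (port q)) ≡ inj₂ q
    slot-loopless   : ∀ i s → place (slot i s) ≢ inj₁ i
    isParent        : Fin nodes → Fin 3 → Bool
    isParent-unique : ∀ i s t → isParent i s ≡ true → isParent i t ≡ true → s ≡ t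
    height          : Fin nodes → ℕ
    height<3        : ∀ i → height i < 3
    ranked          : ∀ i s → Rank isParent height i s (slot i s)
    target          : Fin hubs → Fin (suc hubs)
    earlier         : ∀ x → toℕ (target x) < suc (toℕ x)
    trail           : Fin hubs → Fin 5 → List QDart
    joined          : ∀ x i → Joined (inj₂ (suc x)) (trail x i) (inj₂ (target x))
    apart           : ∀ x i j → i ≢ j → ∀ {d e} → d ∈ trail x i → e ∈ trail x j → d ≢ e × d ≢ partner e
    no-flow         : ¬ Flow

-- Reduced words and the line that carries the gates

alt : ℕ → Letter
alt 0 = 0F
alt 1 = 1F
alt (suc (suc j)) = alt j

alt-≢ : ∀ j → alt j ≢ alt (suc j)
alt-≢ 0 = λ ()
alt-≢ 1 = λ ()
alt-≢ (suc (suc j)) = alt-≢ j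

alt-even : ∀ k → alt (k + k) ≡ 0F
alt-even zero = refl
alt-even (suc k) rewrite ℕ.+-suc k k = alt-even k

ʳ++-reduced : ∀ u y → Reduced u → Reduced y → (∀ {s s′ w w′} → u ≡ s ∷ w → y ≡ s′ ∷ w′ → s ≢ s′) → Reduced (u ʳ++ y)
ʳ++-reduced [] y ru ry h = ry
ʳ++-reduced (s ∷ w) y ru ry h = ʳ++-reduced w (s ∷ y) (Linked.tail ru) (push y ry h) (sep w ru)
  where
  push : ∀ y → Reduced y → (∀ {x s′ w₁ w′} → s ∷ w ≡ x ∷ w₁ → y ≡ s′ ∷ w′ → x ≢ s′) → Reduced (s ∷ y)
  push [] ry h = [-]
  push (x ∷ y) ry h = h refl refl ∷ ry
  sep : ∀ w → Reduced (s ∷ w) → ∀ {x s′ w₁ w′} → w ≡ x ∷ w₁ → s ∷ y ≡ s′ ∷ w′ → x ≢ s′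
  sep (x ∷ w) (s≢x ∷ _) refl refl e = s≢x (sym e)

act-ʳ++ : ∀ {A : Set} (σ : Letter → A → A) → (∀ s v → σ s (σ s v) ≡ v) →
          ∀ u y v → act σ (u ʳ++ y) (act σ u v) ≡ act σ y v
act-ʳ++ σ inv [] y v = refl
act-ʳ++ σ inv (s ∷ w) y v = trans (act-ʳ++ σ inv w (s ∷ y) (σ s v)) (cong (act σ y) (inv s v))

module Line {r} (T : Tower r) where

  open Tower T
  open Cuts T using (path-distinct)

  -- Where the two words first differ, the reverse of one followed by the other is a nonempty
  -- reduced closed word of length at most r.
  unique : ∀ u u′ v → Reduced u → Reduced u′ → length u + length u′ ≤ r → act σ u v ≡ act σ u′ v → u ≡ u′
  unique [] [] v ru ru′ le e = refl
  unique [] (s′ ∷ w′) v ru ru′ le e = ⊥-elim (girth (s′ ∷ w′) v ru′ (s≤s z≤n) le (sym e))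
  unique (s ∷ w) [] v ru ru′ le e =
    ⊥-elim (girth (s ∷ w) v ru (s≤s z≤n) (subst (_≤ r) (ℕ.+-identityʳ _) le) e)
  unique (s ∷ w) (s′ ∷ w′) v ru ru′ le e with s ≟ s′
  ... | yes refl = cong (s ∷_) (unique w w′ (σ s v) (Linked.tail ru) (Linked.tail ru′)
    (ℕ.≤-trans (ℕ.+-mono-≤ (ℕ.n≤1+n (length w)) (ℕ.n≤1+n (length w′))) le) e)
  ... | no s≢s′ = ⊥-elim (girth ((s ∷ w) ʳ++ (s′ ∷ w′)) (act σ (s ∷ w) v)
    (ʳ++-reduced (s ∷ w) (s′ ∷ w′) ru ru′ λ { refl refl → s≢s′ })
    (subst (1 ≤_) (sym (List.length-ʳ++ (s ∷ w))) (s≤s z≤n))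
    (subst (_≤ r) (sym (List.length-ʳ++ (s ∷ w))) le)
    (trans (act-ʳ++ σ σ-invol (s ∷ w) (s′ ∷ w′) v) (sym e)))

  -- The line on which the gates are placed. Its letters alternate, so each segment spells a reduced
  -- word and the line is a path up to index r.
  z : ℕ → Fin n
  z zero = base
  z (suc j) = σ (alt j) (z j)

  z-step : ∀ j → z j ≡ σ (alt j) (z (suc j))
  z-step j = sym (σ-invol (alt j) (z j))

  along : ℕ → ℕ → Word
  along i d = prefix (λ j → alt (j + i)) d

  along-reduced : ∀ i d → Reduced (along i d)
  along-reduced i d = prefix-reduced _ d (λ j _ → alt-≢ (j + i))

  along-length : ∀ i d → length (along i d) ≡ d
  along-length i d = prefix-length _ d

  along-act : ∀ i d → act σ (along i d) (z i) ≡ z (d + i)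
  along-act i d = act-prefix σ (λ j → alt (j + i)) (λ j → z (j + i)) d (λ _ _ → refl)

  -- By uniqueness the word is the segment of the line itself, forwards or reversed. This keeps a
  -- walk through a hub from reaching another gate early.
  follow : ∀ u i j → Reduced u → length u + ∣ i - j ∣ ≤ r → act σ u (z i) ≡ z j → length u ≡ ∣ i - j ∣
  follow u i j ru le e with ℕ.≤-total i j
  ... | inj₁ i≤j = trans (cong length (unique u (along i ∣ i - j ∣) (z i) ru (along-reduced i ∣ i - j ∣)
          (subst (λ x → length u + x ≤ r) (sym (along-length i ∣ i - j ∣)) le)
          (trans e (sym (trans (along-act i ∣ i - j ∣) (cong z (trans (cong (_+ i) (ℕ.m≤n⇒∣m-n∣≡n∸m i≤j)) (ℕ.m∸n+n≡m i≤j))))))))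
          (along-length i ∣ i - j ∣)
  ... | inj₂ j≤i = trans (sym (trans (List.length-ʳ++ u) (ℕ.+-identityʳ _))) (trans (cong length
          (unique (u ʳ++ []) (along j ∣ i - j ∣) (z j) (ʳ++-reduced u [] ru [] (λ _ ())) (along-reduced j ∣ i - j ∣)
          (subst₂ (λ x y → x + y ≤ r) (sym (trans (List.length-ʳ++ u) (ℕ.+-identityʳ _))) (sym (along-length j ∣ i - j ∣)) le)
          (trans (cong (act σ (u ʳ++ [])) (sym e)) (trans (act-ʳ++ σ σ-invol u [] (z i))
            (sym (trans (along-act j ∣ i - j ∣) (cong z (trans (cong (_+ j) (ℕ.m≤n⇒∣n-m∣≡n∸m j≤i)) (ℕ.m∸n+n≡m j≤i)))))))))
          (along-length j ∣ i - j ∣))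

  z-injective : ∀ i j → i ≤ r → j ≤ r → z i ≡ z j → i ≡ j
  z-injective i j i≤ j≤ e = ℕ.∣m-n∣≡0⇒m≡n (sym (follow [] i j []
    (ℕ.≤-trans (ℕ.∣m-n∣≤m⊔n i j) (ℕ.⊔-lub i≤ j≤)) e))

-- The graph built from a blueprint

module Construction (B : Blueprint) (l : ℕ) (4≤l : 4 ≤ l) {r : ℕ} (T : Tower r) where

  open Blueprint B
  open Tower T
  open Line T

  -- `M` is how long a walk must stay in a hub: at least `l` steps for the girth and at least 5 for
  -- connectivity. `D` separates consecutive gates: it is at least `M + 2`, so that their feet are
  -- more than `M` apart, and even, so that each gate cuts an edge with letter 0.
  g K M D : ℕ
  g = suc l
  K = ports + g
  M = l + 6
  D = (M + 2) + (M + 2)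

  -- The product leaves room on the line for all gates, `M` for a walk that `follow` compares with
  -- the line, and 10 is twice the threshold 5 that is used for cuts.
  module Large (big : (K + 2) * D + M + 10 ≤ r) where

    hubOf : Fin K → Fin (suc hubs)
    hubOf a = [ hub , const 0F ]′ (splitAt ports a)

    -- The position depends on the number of the gate among all gates, not on its hub. So gates of
    -- different hubs also sit at different places, and a foot determines its gate.
    pos : Fin K → Fin 2 → ℕ
    pos a b = toℕ b + toℕ a * D

    foot : Fin K → Fin 2 → Fin n
    foot a b = z (pos a b)

    M+2≤D : M + 2 ≤ D
    M+2≤D = ℕ.m≤m+n _ _

    pos≤ : ∀ a b → pos a b + 5 + M ≤ (K + 2) * D + M
    pos≤ a b = ℕ.+-monoˡ-≤ M (begin
      toℕ b + toℕ a * D + 5     ≡⟨ ℕ.+-assoc (toℕ b) _ 5 ⟩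
      toℕ b + (toℕ a * D + 5)   ≤⟨ ℕ.+-mono-≤ (Fin.toℕ≤n b) (ℕ.+-mono-≤ (ℕ.*-monoˡ-≤ D (Fin.toℕ≤n a)) ℕ.≤-refl) ⟩
      2 + (K * D + 5)           ≡⟨ ℕ.+-comm 2 _ ⟩
      K * D + 5 + 2             ≡⟨ ℕ.+-assoc (K * D) 5 2 ⟩
      K * D + 7                 ≤⟨ ℕ.+-monoʳ-≤ (K * D) (ℕ.≤-trans 7≤D (ℕ.m≤m+n D _)) ⟩
      K * D + 2 * D             ≡⟨ ℕ.*-distribʳ-+ D K 2 ⟨
      (K + 2) * D               ∎)
      where
      open ℕ.≤-Reasoning
      7≤D : 7 ≤ D
      7≤D = ℕ.≤-trans (ℕ.≤-trans (s≤s (s≤s (s≤s (s≤s (s≤s (s≤s (s≤s z≤n))))))) (ℕ.≤-trans (ℕ.m≤n+m 8 l) (ℕ.≤-reflexive (sym (ℕ.+-assoc l 6 2))))) M+2≤D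

    pos≤r : ∀ a b j → j ≤ 5 → j + pos a b ≤ r
    pos≤r a b j j≤5 = ℕ.≤-trans (subst (_≤ (K + 2) * D + M) (ℕ.+-comm (pos a b) j) (ℕ.≤-trans (ℕ.+-monoʳ-≤ (pos a b) j≤5)
      (ℕ.≤-trans (ℕ.m≤m+n _ M) (pos≤ a b)))) (ℕ.≤-trans (ℕ.m≤m+n _ 10) big)

    alt-pos : ∀ a → alt (pos a 0F) ≡ 0F
    alt-pos a = trans (cong alt (ℕ.*-distribˡ-+ (toℕ a) (M + 2) (M + 2))) (alt-even (toℕ a * (M + 2)))

    foot-σ : ∀ a → σ 0F (foot a 0F) ≡ foot a 1F
    foot-σ a = cong (λ s → σ s (foot a 0F)) (sym (alt-pos a))

    foot-σ′ : ∀ a → σ 0F (foot a 1F) ≡ foot a 0F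
    foot-σ′ a = trans (cong (σ 0F) (sym (foot-σ a))) (σ-invol 0F _)

    far : ∀ a b a′ b′ → toℕ a < toℕ a′ → suc M + pos a b ≤ pos a′ b′
    far a b a′ b′ lt = begin
      suc M + (toℕ b + toℕ a * D)    ≡⟨ ℕ.+-assoc (suc M) (toℕ b) _ ⟨
      suc M + toℕ b + toℕ a * D      ≤⟨ ℕ.+-monoˡ-≤ (toℕ a * D) (ℕ.≤-trans (ℕ.+-monoʳ-≤ (suc M) (ℕ.≤-pred (Fin.toℕ<n b))) (ℕ.≤-trans (ℕ.≤-reflexive (sym (ℕ.+-suc M 1))) M+2≤D)) ⟩
      D + toℕ a * D                  ≤⟨ ℕ.*-monoˡ-≤ D lt ⟩
      toℕ a′ * D                     ≤⟨ ℕ.m≤n+m _ (toℕ b′) ⟩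
      toℕ b′ + toℕ a′ * D            ∎
      where open ℕ.≤-Reasoning

    gate-≡ : ∀ (a a′ : Fin K) → ¬ (toℕ a < toℕ a′) → ¬ (toℕ a′ < toℕ a) → a ≡ a′
    gate-≡ a a′ p q = Fin.toℕ-injective (ℕ.≤-antisym (ℕ.≮⇒≥ q) (ℕ.≮⇒≥ p))

    -- Each gate owns the stretch of the line just after its feet, since the next gate is more than
    -- `M` away and `M` is at least 6. These stretches are the private reserves used when edges are
    -- deleted.
    tentacle : ∀ a b j a′ b′ j′ → j ≤ 5 → j′ ≤ 5 → z (j + pos a b) ≡ z (j′ + pos a′ b′) → a ≡ a′
    tentacle a b j a′ b′ j′ le le′ e = gate-≡ a a′ (sep a b j a′ b′ j′ le eq) (sep a′ b′ j′ a b j le′ (sym eq))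
      where
      eq : j + pos a b ≡ j′ + pos a′ b′
      eq = z-injective _ _ (pos≤r a b j le) (pos≤r a′ b′ j′ le′) e
      sep : ∀ a b j a′ b′ j′ → j ≤ 5 → j + pos a b ≡ j′ + pos a′ b′ → ¬ (toℕ a < toℕ a′)
      sep a b j a′ b′ j′ le eq lt = ℕ.<-irrefl eq (begin-strict
        j + pos a b         ≤⟨ ℕ.+-monoˡ-≤ (pos a b) (ℕ.≤-trans le (ℕ.≤-trans (ℕ.n≤1+n 5) (ℕ.m≤n+m 6 l))) ⟩
        M + pos a b         <⟨ far a b a′ b′ lt ⟩
        pos a′ b′           ≤⟨ ℕ.m≤n+m _ j′ ⟩
        j′ + pos a′ b′      ∎)
        where open ℕ.≤-Reasoning

    foot-inj : ∀ a b a′ b′ → foot a b ≡ foot a′ b′ → a ≡ a′ × b ≡ b′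
    foot-inj a b a′ b′ e with tentacle a b 0 a′ b′ 0 z≤n z≤n e
    ... | refl = refl , Fin.toℕ-injective (ℕ.+-cancelʳ-≡ (toℕ a * D) _ _
      (z-injective _ _ (pos≤r a b 0 z≤n) (pos≤r a b′ 0 z≤n) e))

    -- In every hub, a copy of the tower, the edge between the two feet of each gate is
    -- subdivided by the gate; g further gates lead from hub 0 to the ring of length g.
    data V : Set where
      node : Fin nodes → V
      gate : Fin K → V
      ring : Fin g → V
      cell : Fin (suc hubs) → Fin n → V

    -- `nx` repeats the formula for the cyclic successor in the definition of a circuit, so that the
    -- ring is a circuit by computation.
    nx pv : Fin g → Fin g
    nx i = fromℕ< (m%n<n (suc (toℕ i)) g)
    pv 0F = fromℕ l
    pv (suc i) = inject₁ i

    nx-< : ∀ i → suc (toℕ i) < g → toℕ (nx i) ≡ suc (toℕ i)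
    nx-< i lt = trans (Fin.toℕ-fromℕ< _) (m<n⇒m%n≡m lt)

    nx-pv : ∀ i → nx (pv i) ≡ i
    nx-pv 0F = Fin.toℕ-injective (trans (Fin.toℕ-fromℕ< _) (trans (cong (λ x → suc x % g) (Fin.toℕ-fromℕ l)) (n%n≡0 g)))
    nx-pv (suc i) = Fin.toℕ-injective (trans (nx-< (inject₁ i) (s≤s (subst (_< l) (sym (Fin.toℕ-inject₁ i)) (Fin.toℕ<n i))))
      (cong suc (Fin.toℕ-inject₁ i)))

    pv-inj : ∀ i j → pv i ≡ pv j → i ≡ j
    pv-inj i j e = trans (sym (nx-pv i)) (trans (cong nx e) (nx-pv j))

    pv-nx : ∀ i → pv (nx i) ≡ i
    pv-nx i with injective⇒surjective pv (λ {a} {b} → pv-inj a b) i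
    ... | j , refl = cong pv (nx-pv j)

    nx-≢ : ∀ i → nx i ≢ i
    nx-≢ i e with suc (toℕ i) <? g
    ... | yes lt = ℕ.<-irrefl (trans (cong toℕ (sym e)) (nx-< i lt)) (ℕ.n<1+n _)
    ... | no ge = ℕ.<-irrefl (trans (sym zero!) (trans (cong toℕ e) top)) (ℕ.≤-trans (s≤s z≤n) 4≤l)
      where
      top : toℕ i ≡ l
      top = ℕ.≤-antisym (ℕ.≤-pred (Fin.toℕ<n i)) (ℕ.≤-pred (ℕ.≮⇒≥ ge))
      zero! : toℕ (nx i) ≡ 0
      zero! = trans (Fin.toℕ-fromℕ< _) (trans (cong (λ x → suc x % g) top) (n%n≡0 g))

    Foot : Fin (suc hubs) → Fin n → Set
    Foot x v = ∃ λ a → ∃ λ b → hubOf a ≡ x × v ≡ foot a b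

    foot? : ∀ x v → Dec (Foot x v)
    foot? x v = Fin.any? λ a → Fin.any? λ b → (hubOf a ≟ x) ×-dec (v ≟ foot a b)

    half : Fin 2 → Fin 3
    half 0F = 0F
    half 1F = 1F

    nodeSlot : QDart → V × Fin 3
    nodeSlot (inj₁ (j , t)) = node j , t
    nodeSlot (inj₂ q) = gate (q ↑ˡ g) , 2F

    gateSlot : Fin ports ⊎ Fin g → V × Fin 3
    gateSlot (inj₁ q) = node (proj₁ (port q)) , proj₂ (port q)
    gateSlot (inj₂ i) = ring i , 2F

    cellSlot : ∀ x v → Dec (Foot x v) → V × Fin 3
    cellSlot x v (yes (a , b , _)) = gate a , half b
    cellSlot x v (no _) = cell x (σ 0F v) , 0F

    τ : V × Fin 3 → V × Fin 3
    τ (node i , s) = nodeSlot (slot i s)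
    τ (gate a , 0F) = cell (hubOf a) (foot a 0F) , 0F
    τ (gate a , 1F) = cell (hubOf a) (foot a 1F) , 0F
    τ (gate a , 2F) = gateSlot (splitAt ports a)
    τ (ring i , 0F) = ring (nx i) , 1F
    τ (ring i , 1F) = ring (pv i) , 0F
    τ (ring i , 2F) = gate (ports ↑ʳ i) , 2F
    τ (cell x v , 0F) = cellSlot x v (foot? x v)
    τ (cell x v , suc s) = cell x (σ (suc s) v) , suc s

    τ-foot : ∀ a b → τ (cell (hubOf a) (foot a b) , 0F) ≡ (gate a , half b)
    τ-foot a b with foot? (hubOf a) (foot a b)
    ... | no ¬p = ⊥-elim (¬p (a , b , refl , refl))
    ... | yes (a′ , b′ , _ , e) with foot-inj a b a′ b′ e
    ... | refl , refl = refl

    τ-plain : ∀ x v → ¬ Foot x v → τ (cell x v , 0F) ≡ (cell x (σ 0F v) , 0F)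
    τ-plain x v ¬p with foot? x v
    ... | yes p = ⊥-elim (¬p p)
    ... | no _ = refl

    Foot-σ : ∀ x v → Foot x (σ 0F v) → Foot x v
    Foot-σ x v (a , 0F , h , e) = a , 1F , h , trans (sym (σ-invol 0F v)) (trans (cong (σ 0F) e) (foot-σ a))
    Foot-σ x v (a , 1F , h , e) = a , 0F , h , trans (sym (σ-invol 0F v)) (trans (cong (σ 0F) e) (foot-σ′ a))

    τ-invol : ∀ d → τ (τ d) ≡ d
    τ-invol (node i , s) with slot i s in eq
    ... | inj₁ (j , t) = cong nodeSlot (trans (cong partner (sym eq)) (slot-involutive i s))
    ... | inj₂ q rewrite Fin.splitAt-↑ˡ ports q g = pair (trans (cong partner (sym eq)) (slot-involutive i s))
      where
      pair : inj₁ (port q) ≡ inj₁ (i , s) → gateSlot (inj₁ q) ≡ (node i , s)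
      pair refl = refl
    τ-invol (gate a , 0F) = τ-foot a 0F
    τ-invol (gate a , 1F) = τ-foot a 1F
    τ-invol (gate a , 2F) with splitAt ports a in eq
    ... | inj₁ q = trans (cong nodeSlot (port-involutive q)) (cong (λ x → gate x , 2F) (Fin.splitAt⁻¹-↑ˡ eq))
    ... | inj₂ i = cong (λ x → gate x , 2F) (Fin.splitAt⁻¹-↑ʳ eq)
    τ-invol (ring i , 0F) = cong (λ x → ring x , 0F) (pv-nx i)
    τ-invol (ring i , 1F) = cong (λ x → ring x , 1F) (nx-pv i)
    τ-invol (ring i , 2F) rewrite Fin.splitAt-↑ʳ ports g i = refl
    τ-invol (cell x v , 0F) with foot? x v
    ... | yes (a , 0F , refl , refl) = refl
    ... | yes (a , 1F , refl , refl) = refl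
    ... | no ¬p = trans (τ-plain x (σ 0F v) (¬p ∘ Foot-σ x v)) (cong (λ u → cell x u , 0F) (σ-invol 0F v))
    τ-invol (cell x v , suc s) = cong (λ u → cell x u , suc s) (σ-invol (suc s) v)

    1≤r : 1 ≤ r
    1≤r = ℕ.≤-trans (ℕ.≤-trans (s≤s z≤n) (ℕ.m≤n+m 10 _)) big

    cell-inj : ∀ {x v y u} → cell x v ≡ cell y u → x ≡ y × v ≡ u
    cell-inj refl = refl , refl

    node-inj : ∀ {i j} → node i ≡ node j → i ≡ j
    node-inj refl = refl

    ring-inj : ∀ {i j} → ring i ≡ ring j → i ≡ j
    ring-inj refl = refl

    gate-inj : ∀ {i j} → gate i ≡ gate j → i ≡ j
    gate-inj refl = refl

    τ-loop : ∀ d → proj₁ (τ d) ≢ proj₁ d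
    τ-loop (node i , s) e with slot i s | slot-loopless i s
    ... | inj₁ (j , t) | h = h (cong inj₁ (node-inj e))
    τ-loop (gate a , 2F) e with splitAt ports a
    τ-loop (gate a , 2F) () | inj₁ q
    τ-loop (gate a , 2F) () | inj₂ i
    τ-loop (ring i , 0F) e = nx-≢ i (ring-inj e)
    τ-loop (ring i , 1F) e = nx-≢ i (trans (cong nx (sym (ring-inj e))) (nx-pv i))
    τ-loop (ring i , 2F) ()
    τ-loop (cell x v , 0F) e with foot? x v
    τ-loop (cell x v , 0F) () | yes (a , b , _)
    ... | no _ = girth (0F ∷ []) v [-] (s≤s z≤n) 1≤r (proj₂ (cell-inj e))
    τ-loop (cell x v , suc s) e = girth (suc s ∷ []) v [-] (s≤s z≤n) 1≤r (proj₂ (cell-inj e))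

    N : ℕ
    N = nodes + (K + (g + suc hubs * n))

    enc : V → Fin N
    enc (node i) = i ↑ˡ _
    enc (gate a) = nodes ↑ʳ (a ↑ˡ _)
    enc (ring i) = nodes ↑ʳ (K ↑ʳ (i ↑ˡ _))
    enc (cell x v) = nodes ↑ʳ (K ↑ʳ (g ↑ʳ combine x v))

    dec₃ : Fin (suc hubs * n) → V
    dec₃ k = cell (proj₁ (remQuot {suc hubs} n k)) (proj₂ (remQuot {suc hubs} n k))

    dec₂ : Fin (g + suc hubs * n) → V
    dec₂ k = [ ring , dec₃ ]′ (splitAt g k)

    dec₁ : Fin (K + (g + suc hubs * n)) → V
    dec₁ k = [ gate , dec₂ ]′ (splitAt K k)

    dec : Fin N → V
    dec k = [ node , dec₁ ]′ (splitAt nodes k)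

    dec-enc : ∀ v → dec (enc v) ≡ v
    dec-enc (node i) = cong [ node , dec₁ ]′ (Fin.splitAt-↑ˡ nodes i _)
    dec-enc (gate a) = trans (cong [ node , dec₁ ]′ (Fin.splitAt-↑ʳ nodes _ (a ↑ˡ _)))
      (cong [ gate , dec₂ ]′ (Fin.splitAt-↑ˡ K a _))
    dec-enc (ring i) = trans (cong [ node , dec₁ ]′ (Fin.splitAt-↑ʳ nodes _ (K ↑ʳ (i ↑ˡ _))))
      (trans (cong [ gate , dec₂ ]′ (Fin.splitAt-↑ʳ K _ (i ↑ˡ _)))
        (cong [ ring , dec₃ ]′ (Fin.splitAt-↑ˡ g i _)))
    dec-enc (cell x v) = trans (cong [ node , dec₁ ]′ (Fin.splitAt-↑ʳ nodes _ (K ↑ʳ (g ↑ʳ combine x v))))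
      (trans (cong [ gate , dec₂ ]′ (Fin.splitAt-↑ʳ K _ (g ↑ʳ combine x v)))
        (trans (cong [ ring , dec₃ ]′ (Fin.splitAt-↑ʳ g _ (combine x v)))
          (cong (λ p → cell (proj₁ p) (proj₂ p)) (Fin.remQuot-combine {suc hubs} x v))))

    enc₂ : ∀ k → enc (dec₂ k) ≡ nodes ↑ʳ (K ↑ʳ k)
    enc₂ k with splitAt g k in eq
    ... | inj₁ i = cong (λ x → nodes ↑ʳ (K ↑ʳ x)) (Fin.splitAt⁻¹-↑ˡ eq)
    ... | inj₂ i = cong (λ x → nodes ↑ʳ (K ↑ʳ x)) (trans (cong (g ↑ʳ_) (Fin.combine-remQuot {suc hubs} n i)) (Fin.splitAt⁻¹-↑ʳ eq))

    enc₁ : ∀ k → enc (dec₁ k) ≡ nodes ↑ʳ k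
    enc₁ k with splitAt K k in eq
    ... | inj₁ i = cong (nodes ↑ʳ_) (Fin.splitAt⁻¹-↑ˡ eq)
    ... | inj₂ i = trans (enc₂ i) (cong (nodes ↑ʳ_) (Fin.splitAt⁻¹-↑ʳ eq))

    enc-dec : ∀ k → enc (dec k) ≡ k
    enc-dec k with splitAt nodes k in eq
    ... | inj₁ i = Fin.splitAt⁻¹-↑ˡ eq
    ... | inj₂ i = trans (enc₁ i) (Fin.splitAt⁻¹-↑ʳ eq)

    dartGraph : DartGraph
    dartGraph = record { V = V ; N = N ; enc = enc ; dec = dec ; dec-enc = dec-enc ; enc-dec = enc-dec
                   ; τ = τ ; τ-invol = τ-invol ; τ-loop = τ-loop }

-- Non-backtracking walks settle in a hub or on the ring

module Roaming (B : Blueprint) (l : ℕ) (4≤l : 4 ≤ l) {r : ℕ} (T : Tower r)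
  (big : (Construction.K B l 4≤l T + 2) * Construction.D B l 4≤l T + Construction.M B l 4≤l T + 10 ≤ r) where

  open Blueprint B
  open Tower T
  open Line T
  open Construction B l 4≤l T
  open Large big
  open DartGraph dartGraph using (Dart; NBWalk)
  open NBWalk

  shiftW : ℕ → NBWalk → NBWalk
  shiftW k W = record { ω = λ j → ω W (j + k) ; step = λ j → step W (j + k) ; nb = λ j → nb W (j + k) }

  vertOf : V → Fin n
  vertOf (cell x v) = v
  vertOf _ = base

  vert : NBWalk → ℕ → Fin n
  vert W i = vertOf (proj₁ (ω W i))

  InHub : Fin (suc hubs) → NBWalk → Set
  InHub x W = ∀ i → i ≤ M → proj₁ (ω W i) ≡ cell x (vert W i)

  iter : ∀ {A : Set} → (A → A) → ℕ → A → A
  iter f zero x = x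
  iter f (suc k) x = f (iter f k x)

  AroundRing : NBWalk → Set
  AroundRing W = ∃ λ c → (∀ i → i ≤ g → ω W i ≡ (ring (iter nx i c) , 0F)) ⊎ (∀ i → i ≤ g → ω W i ≡ (ring (iter pv i c) , 1F))

  -- Both outcomes exclude an early repetition, and both lead to a part of the graph that stays
  -- connected to hub 0 after deletions; so the notion serves the girth as well as connectivity.
  Settled : NBWalk → Set
  Settled W = ∃ λ j → (∃ λ x → InHub x (shiftW j W)) ⊎ AroundRing (shiftW j W)

  Entering : NBWalk → Set
  Entering W = ∃ λ j → ∃ λ a → ∃ λ b → ω W j ≡ (gate a , half b)

  later : ∀ W k → Entering (shiftW k W) → Entering W
  later W k (j , p) = j + k , p

  settled-later : ∀ W k → Settled (shiftW k W) → Settled W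
  settled-later W k (j , p) = j + k , go p
    where
    assoc : ∀ i → ω W ((i + j) + k) ≡ ω W (i + (j + k))
    assoc i = cong (ω W) (ℕ.+-assoc i j k)
    go : (∃ λ x → InHub x (shiftW j (shiftW k W))) ⊎ AroundRing (shiftW j (shiftW k W)) →
         (∃ λ x → InHub x (shiftW (j + k) W)) ⊎ AroundRing (shiftW (j + k) W)
    go (inj₁ (x , h)) = inj₁ (x , λ i le → subst (λ d → proj₁ d ≡ cell x (vertOf (proj₁ d))) (assoc i) (h i le))
    go (inj₂ (c , inj₁ h)) = inj₂ (c , inj₁ λ i le → trans (sym (assoc i)) (h i le))
    go (inj₂ (c , inj₂ h)) = inj₂ (c , inj₂ λ i le → trans (sym (assoc i)) (h i le))

  next : ∀ W j {v s} → τ (ω W j) ≡ (v , s) → ∃ λ t → t ≢ s × ω W (suc j) ≡ (v , t)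
  next W j {v} {s} e with ω W (suc j) in eq
  ... | v′ , t = t , (λ { refl → nb W j (trans eq (trans (cong (_, t) v≡) (sym e))) }) , cong (_, t) v≡
    where
    v≡ : v′ ≡ v
    v≡ = trans (sym (cong proj₁ eq)) (trans (step W j) (cong proj₁ e))

  half≢2 : ∀ t → t ≢ 2F → ∃ λ b → t ≡ half b
  half≢2 0F h = 0F , refl
  half≢2 1F h = 1F , refl
  half≢2 2F h = ⊥-elim (h refl)

  through : ∀ W a j → τ (ω W j) ≡ (gate a , 2F) → Entering W
  through W a j e with next W j e
  ... | t , t≢ , eq with half≢2 t t≢
  ... | b , refl = suc j , a , b , eq

  -- A node below is entered through its parent slot and cannot be left by it at once, so the walk
  -- keeps descending until it meets a port.
  descend : ∀ k W i s → ω W 0 ≡ (node i , s) → isParent i s ≡ false → height i ≤ k → Entering W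
  descend k W i s e p le with slot i s in eq | ranked i s
  ... | inj₂ q | _ = through W (q ↑ˡ g) 0 (trans (cong τ e) (cong nodeSlot eq))
  descend k W i s e p le | inj₁ (j , t) | rk rewrite p with k | next W 0 (trans (cong τ e) (cong nodeSlot eq))
  ... | zero | _ = ⊥-elim (ℕ.<⇒≱ (proj₂ rk) (ℕ.≤-trans le z≤n))
  ... | suc k′ | t′ , t′≢t , e′ = later W 1 (descend k′ (shiftW 1 W) j t′ e′ (leaves t′ t′≢t) (ℕ.≤-pred (ℕ.≤-trans (proj₂ rk) le)))
    where
    leaves : ∀ t′ → t′ ≢ t → isParent j t′ ≡ false
    leaves t′ ne with isParent j t′ in q
    ... | false = refl
    ... | true = ⊥-elim (ne (isParent-unique j t′ t q (proj₁ rk)))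

  -- Heights increase as long as parent slots are used, so `k` bounds the climbs that are left; the
  -- first other slot starts a descent.
  ascend : ∀ k W i s → ω W 0 ≡ (node i , s) → 3 ≤ height i + k → Entering W
  ascend k W i s e le with isParent i s in p
  ... | false = descend (height i) W i s e p ℕ.≤-refl
  ... | true with slot i s in eq | ranked i s
  ... | inj₂ q | rk = ⊥-elim (true≢false (trans (sym p) rk))
  ... | inj₁ (j , t) | rk rewrite p with k | next W 0 (trans (cong τ e) (cong nodeSlot eq))
  ... | zero | _ = ⊥-elim (ℕ.<⇒≱ (height<3 i) (subst (3 ≤_) (ℕ.+-identityʳ _) le))
  ... | suc k′ | t′ , _ , e′ = later W 1 (ascend k′ (shiftW 1 W) j t′ e′
    (ℕ.≤-trans (subst (3 ≤_) (ℕ.+-suc (height i) k′) le) (ℕ.+-monoˡ-≤ k′ (proj₂ rk))))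

  circle₀ : ∀ W c → ω W 0 ≡ (ring c , 0F) → ∀ k → (∀ i → i ≤ k → ω W i ≡ (ring (iter nx i c) , 0F)) ⊎ Entering W
  circle₀ W c e zero = inj₁ λ { zero le → e }
  circle₀ W c e (suc k) with circle₀ W c e k
  ... | inj₂ en = inj₂ en
  ... | inj₁ h with next W k (cong τ (h k ℕ.≤-refl))
  ... | 1F , ne , _ = ⊥-elim (ne refl)
  ... | 2F , _ , eq = inj₂ (through W _ (suc k) (cong τ eq))
  ... | 0F , _ , eq = inj₁ λ i le → extend i (ℕ.m≤n⇒m<n∨m≡n le)
    where
    extend : ∀ i → i < suc k ⊎ i ≡ suc k → ω W i ≡ (ring (iter nx i c) , 0F)
    extend i (inj₁ lt) = h i (ℕ.≤-pred lt)
    extend i (inj₂ refl) = eq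

  circle₁ : ∀ W c → ω W 0 ≡ (ring c , 1F) → ∀ k → (∀ i → i ≤ k → ω W i ≡ (ring (iter pv i c) , 1F)) ⊎ Entering W
  circle₁ W c e zero = inj₁ λ { zero le → e }
  circle₁ W c e (suc k) with circle₁ W c e k
  ... | inj₂ en = inj₂ en
  ... | inj₁ h with next W k (cong τ (h k ℕ.≤-refl))
  ... | 0F , ne , _ = ⊥-elim (ne refl)
  ... | 2F , _ , eq = inj₂ (through W _ (suc k) (cong τ eq))
  ... | 1F , _ , eq = inj₁ λ i le → extend i (ℕ.m≤n⇒m<n∨m≡n le)
    where
    extend : ∀ i → i < suc k ⊎ i ≡ suc k → ω W i ≡ (ring (iter pv i c) , 1F)
    extend i (inj₁ lt) = h i (ℕ.≤-pred lt)
    extend i (inj₂ refl) = eq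

  opposite : Fin 2 → Fin 2
  opposite 0F = 1F
  opposite 1F = 0F

  -- After entering a hub a walk stays inside for M steps: the word read off it, extended
  -- by the letter of the edge that was replaced by the gate, joins two feet on the line,
  -- so it would have to follow the line.
  module Enter (W : NBWalk) (a : Fin K) (b : Fin 2) (e₀ : ω W 0 ≡ (gate a , half b)) where

    x : Fin (suc hubs)
    x = hubOf a

    b̄ : Fin 2
    b̄ = opposite b

    foot-b̄ : σ 0F (foot a b) ≡ foot a b̄
    foot-b̄ = go b
      where
      go : ∀ b → σ 0F (foot a b) ≡ foot a (opposite b)
      go 0F = foot-σ a
      go 1F = foot-σ′ a

    τ₀ : τ (ω W 0) ≡ (cell x (foot a b) , 0F)
    τ₀ = trans (cong τ e₀) (go b)
      where
      go : ∀ b → τ (gate a , half b) ≡ (cell x (foot a b) , 0F)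
      go 0F = refl
      go 1F = refl

    -- `rev` spells the way back from v to the other foot of the gate. It ends with the letter 0 of
    -- the edge that the gate has cut, hence the length `suc i` after i steps inside the hub.
    Inv : ℕ → Set
    Inv i = ∃ λ v → ∃ λ s → ∃ λ rev → ω W (suc i) ≡ (cell x v , s) × length rev ≡ suc i × Reduced (s ∷ rev) × act σ rev v ≡ foot a b̄ × (i ≡ 0 → rev ≡ 0F ∷ [])

    near : ∀ a b b′ → ∣ pos a b - pos a b′ ∣ ≤ 1
    near a b b′ = ℕ.≤-trans (ℕ.≤-reflexive (trans (cong₂ ∣_-_∣ (ℕ.+-comm (toℕ b) _) (ℕ.+-comm (toℕ b′) _)) (ℕ.∣m+n-m+o∣≡∣n-o∣ (toℕ a * D) (toℕ b) (toℕ b′))))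
      (ℕ.≤-trans (ℕ.∣m-n∣≤m⊔n (toℕ b) (toℕ b′)) (ℕ.⊔-lub (ℕ.≤-pred (Fin.toℕ<n b)) (ℕ.≤-pred (Fin.toℕ<n b′))))

    distant : ∀ a b a′ b′ → a ≢ a′ → suc M ≤ ∣ pos a b - pos a′ b′ ∣
    distant a b a′ b′ a≢ with toℕ a <? toℕ a′ | toℕ a′ <? toℕ a
    ... | yes lt | _ = ℕ.+-cancelʳ-≤ (pos a b) _ _ (ℕ.≤-trans (far a b a′ b′ lt) (ℕ.≤-trans (ℕ.m≤n+∣n-m∣ (pos a′ b′) (pos a b)) (ℕ.≤-reflexive (ℕ.+-comm (pos a b) _))))
    ... | no _ | yes lt = ℕ.+-cancelʳ-≤ (pos a′ b′) _ _ (ℕ.≤-trans (far a′ b′ a b lt) (ℕ.≤-trans (ℕ.m≤n+∣m-n∣ (pos a b) (pos a′ b′)) (ℕ.≤-reflexive (ℕ.+-comm (pos a′ b′) _))))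
    ... | no p | no q = ⊥-elim (a≢ (gate-≡ a a′ p q))

    within : ∀ a b → pos a b ≤ (K + 2) * D
    within a b = ℕ.≤-trans (ℕ.m≤m+n _ 5) (ℕ.+-cancelʳ-≤ M _ _ (pos≤ a b))

    blocked : ∀ i v rev → i < M → length rev ≡ suc i → Reduced (0F ∷ rev) → act σ rev v ≡ foot a b̄ → (i ≡ 0 → rev ≡ 0F ∷ []) → ¬ Foot x v
    blocked i v rev lt len red ac first (a′ , b′ , _ , refl) = go (a ≟ a′)
      where
      le : length rev + ∣ pos a′ b′ - pos a b̄ ∣ ≤ r
      le = ℕ.≤-trans (ℕ.+-mono-≤ (ℕ.≤-trans (ℕ.≤-reflexive len) lt)
             (ℕ.≤-trans (ℕ.∣m-n∣≤m⊔n (pos a′ b′) (pos a b̄)) (ℕ.⊔-lub (within a′ b′) (within a b̄))))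
             (ℕ.≤-trans (ℕ.≤-reflexive (ℕ.+-comm M _)) (ℕ.≤-trans (ℕ.m≤m+n _ 10) big))
      len′ : length rev ≡ ∣ pos a′ b′ - pos a b̄ ∣
      len′ = follow rev (pos a′ b′) (pos a b̄) (Linked.tail red) le ac
      go : Dec (a ≡ a′) → ⊥
      -- A foot of another gate is more than `M` away along the line, but `rev` has at most `M`
      -- letters.
      go (no ne) = ℕ.<⇒≱ (s≤s lt) (ℕ.≤-trans (distant a′ b′ a b̄ (ne ∘ sym)) (ℕ.≤-reflexive (trans (sym len′) len)))
      -- Feet of one gate are at most one apart, which forces i = 0. Then `rev` is the single letter
      -- 0, and the walk would turn back into the gate it came from.
      go (yes refl) = not-reduced (subst (λ u → Reduced (0F ∷ u)) (first (ℕ.n≤0⇒n≡0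
        (ℕ.≤-pred (ℕ.≤-trans (ℕ.≤-reflexive (trans (sym len) len′)) (near a b′ b̄))))) red)
        where
        not-reduced : ¬ Reduced (0F ∷ 0F ∷ [])
        not-reduced (h ∷ _) = h refl

    inv : ∀ i → i ≤ M → Inv i
    inv zero le with next W 0 τ₀
    ... | t , t≢ , eq = foot a b , t , 0F ∷ [] , eq , refl , t≢ ∷ [-] , foot-b̄ , λ _ → refl
    inv (suc i) le with inv i (ℕ.<⇒≤ le)
    ... | v , s , rev , eq , len , red , ac , first with next W (suc i) (trans (cong τ eq) (plain s red))
      where
      plain : ∀ s → Reduced (s ∷ rev) → τ (cell x v , s) ≡ (cell x (σ s v) , s)
      plain 0F red = τ-plain x v (blocked i v rev le len red ac first)
      plain (suc s) red = refl
    ... | t , t≢ , eq′ = σ s v , t , s ∷ rev , eq′ , cong suc len , t≢ ∷ red ,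
      trans (cong (act σ rev) (σ-invol s v)) ac , λ ()

    settled : Settled W
    settled = 1 , inj₁ (x , λ i le → let v , s , _ , eq , _ = inv i le in
      trans (cong proj₁ (moved i eq)) (sym (cong (λ d → cell x (vertOf (proj₁ d))) (moved i eq))))
      where
      moved : ∀ i {d} → ω W (suc i) ≡ d → ω W (i + 1) ≡ d
      moved i e = trans (cong (ω W) (ℕ.+-comm i 1)) e

  enter : ∀ W → Entering W → Settled W
  enter W (j , a , b , e) = settled-later W j (Enter.settled (shiftW j W) a b e)

  from-ring₀ : ∀ W c → ω W 0 ≡ (ring c , 0F) → Settled W
  from-ring₀ W c e with circle₀ W c e g
  ... | inj₁ h = 0 , inj₂ (c , inj₁ λ i le → trans (cong (ω W) (ℕ.+-identityʳ i)) (h i le))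
  ... | inj₂ en = enter W en

  from-ring₁ : ∀ W c → ω W 0 ≡ (ring c , 1F) → Settled W
  from-ring₁ W c e with circle₁ W c e g
  ... | inj₁ h = 0 , inj₂ (c , inj₂ λ i le → trans (cong (ω W) (ℕ.+-identityʳ i)) (h i le))
  ... | inj₂ en = enter W en

  from-gate : ∀ W a t → ω W 0 ≡ (gate a , t) → Settled W
  from-gate W a 0F e = enter W (0 , a , 0F , e)
  from-gate W a 1F e = enter W (0 , a , 1F , e)
  from-gate W a 2F e with splitAt ports a in eq
  ... | inj₁ q with next W 0 (trans (cong τ e) (cong gateSlot eq))
  ... | t , _ , e′ = enter W (later W 1 (ascend 3 (shiftW 1 W) _ t e′ (ℕ.m≤n+m 3 _)))
  from-gate W a 2F e | inj₂ i with next W 0 (trans (cong τ e) (cong gateSlot eq))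
  ... | 0F , _ , e′ = settled-later W 1 (from-ring₀ (shiftW 1 W) i e′)
  ... | 1F , _ , e′ = settled-later W 1 (from-ring₁ (shiftW 1 W) i e′)
  ... | 2F , ne , _ = ⊥-elim (ne refl)

  -- A walk that begins inside a hub has no foot behind it to compare with the line. It may leave
  -- early, but only through a gate, where the other cases take over.
  from-cell : ∀ W x v s → ω W 0 ≡ (cell x v , s) → ∀ k →
              (∀ i → i ≤ k → proj₁ (ω W i) ≡ cell x (vert W i)) ⊎ ∃ λ j → ∃ λ a → ∃ λ t → ω W j ≡ (gate a , t)
  from-cell W x v s e zero = inj₁ λ { zero le → trans (cong proj₁ e) (cong (λ d → cell x (vertOf (proj₁ d))) (sym e)) }
  from-cell W x v s e (suc k) with from-cell W x v s e k
  ... | inj₂ p = inj₂ p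
  ... | inj₁ h = go (ω W k) refl
    where
    go : ∀ d → ω W k ≡ d → (∀ i → i ≤ suc k → proj₁ (ω W i) ≡ cell x (vert W i)) ⊎ ∃ λ j → ∃ λ a → ∃ λ t → ω W j ≡ (gate a , t)
    go (cell y u , t) ek with trans (sym (cong proj₁ ek)) (h k ℕ.≤-refl)
    go (cell x u , t) ek | refl = leave t ek
      where
      stay : ∀ {t u′} → τ (ω W k) ≡ (cell x u′ , t) → (∀ i → i ≤ suc k → proj₁ (ω W i) ≡ cell x (vert W i))
      stay {t} {u′} et i le with ℕ.m≤n⇒m<n∨m≡n le
      ... | inj₁ lt = h i (ℕ.≤-pred lt)
      ... | inj₂ refl = trans sv (cong (λ w → cell x (vertOf w)) (sym sv))
        where
        sv : proj₁ (ω W (suc k)) ≡ cell x u′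
        sv = trans (step W k) (cong proj₁ et)
      leave : ∀ t → ω W k ≡ (cell x u , t) → (∀ i → i ≤ suc k → proj₁ (ω W i) ≡ cell x (vert W i)) ⊎ ∃ λ j → ∃ λ a → ∃ λ t → ω W j ≡ (gate a , t)
      leave (suc t) ek = inj₁ (stay (cong τ ek))
      leave 0F ek with foot? x u in ft
      ... | no _ = inj₁ (stay (trans (cong τ ek) (cong (cellSlot x u) ft)))
      ... | yes (a , b , _) with next W k (trans (cong τ ek) (cong (cellSlot x u) ft))
      ... | t′ , _ , e′ = inj₂ (suc k , a , t′ , e′)
    go (node i , t) ek = ⊥-elim (absurd (trans (sym (cong proj₁ ek)) (h k ℕ.≤-refl)))
      where
      absurd : ∀ {i y u} → node i ≢ cell y u
      absurd ()
    go (gate i , t) ek = ⊥-elim (absurd (trans (sym (cong proj₁ ek)) (h k ℕ.≤-refl)))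
      where
      absurd : ∀ {i y u} → gate i ≢ cell y u
      absurd ()
    go (ring i , t) ek = ⊥-elim (absurd (trans (sym (cong proj₁ ek)) (h k ℕ.≤-refl)))
      where
      absurd : ∀ {i y u} → ring i ≢ cell y u
      absurd ()

  settle : ∀ W → Settled W
  settle W with ω W 0 in e
  ... | node i , s = enter W (ascend 3 W i s e (ℕ.m≤n+m 3 _))
  ... | gate a , t = from-gate W a t e
  ... | ring c , 0F = from-ring₀ W c e
  ... | ring c , 1F = from-ring₁ W c e
  ... | ring c , 2F = enter W (through W _ 0 (cong τ e))
  ... | cell x v , s with from-cell W x v s e M
  ... | inj₁ h = 0 , inj₁ (x , λ i le → subst (λ k → proj₁ (ω W k) ≡ cell x (vert W k)) (sym (ℕ.+-identityʳ i)) (h i le))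
  ... | inj₂ (j , a , t , e′) = settled-later W j (from-gate (shiftW j W) a t e′)

-- Connectivity after deleting fewer than five edges

decide-list : ∀ {A : Set} (p : A → Bool) xs → (∀ {x} → x ∈ xs → p x ≡ false) ⊎ ∃ λ x → x ∈ xs × p x ≡ true
decide-list p [] = inj₁ λ ()
decide-list p (x ∷ xs) with p x in eq | decide-list p xs
... | true | _ = inj₂ (x , here refl , eq)
... | false | inj₂ (y , m , e) = inj₂ (y , there m , e)
... | false | inj₁ h = inj₁ λ { (here refl) → eq ; (there m) → h m }

decide-fin : ∀ k {P Q : Fin k → Set} → (∀ i → P i ⊎ Q i) → (∃ P) ⊎ (∀ i → Q i)
decide-fin zero h = inj₂ λ ()
decide-fin (suc k) h with h zero | decide-fin k (h ∘ suc)
... | inj₁ p | _ = inj₁ (zero , p)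
... | inj₂ q | inj₁ (i , p) = inj₁ (suc i , p)
... | inj₂ q | inj₂ qs = inj₂ λ { zero → q ; (suc i) → qs i }

not-false : ∀ {b} → not b ≡ true → b ≡ false
not-false {false} _ = refl

module Connecting (B : Blueprint) (l : ℕ) (4≤l : 4 ≤ l) {r : ℕ} (T : Tower r)
  (big : (Construction.K B l 4≤l T + 2) * Construction.D B l 4≤l T + Construction.M B l 4≤l T + 10 ≤ r) where

  open Blueprint B
  open Tower T
  open Line T
  open Cuts T
  open Construction B l 4≤l T
  open Large big
  open DartGraph dartGraph using (Dart; NBWalk; src; dst; Path; []; cons; _++ₚ_; edge; reverseₚ)
  open Roaming B l 4≤l T big
  open NBWalk

  10≤r : 10 ≤ r
  10≤r = ℕ.≤-trans (ℕ.m≤n+m 10 _) big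

  M≤r : M ≤ r
  M≤r = ℕ.≤-trans (ℕ.≤-trans (ℕ.m≤n+m M ((K + 2) * D)) (ℕ.m≤m+n _ 10)) big

  -- An edge cut by a gate would take the walk to the gate, so a walk that remains in the hub uses
  -- uncut edges only.
  hub-step : ∀ x W → InHub x W → ∀ i → i < M → τ (ω W i) ≡ (cell x (σ (proj₂ (ω W i)) (vert W i)) , proj₂ (ω W i))
  hub-step x W h i lt = trans (cong (λ v → τ (v , proj₂ (ω W i))) (h i (ℕ.<⇒≤ lt))) (plain (proj₂ (ω W i)) refl)
    where
    plain : ∀ s → s ≡ proj₂ (ω W i) → τ (cell x (vert W i) , s) ≡ (cell x (σ s (vert W i)) , s)
    plain (suc s) _ = refl
    plain 0F e with foot? x (vert W i) in ft
    ... | no _ = refl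
    ... | yes (a , b , _) = ⊥-elim (gate≢cell (trans (sym (trans (step W i) (cong proj₁ (trans
        (cong τ (cong₂ _,_ (h i (ℕ.<⇒≤ lt)) (sym e))) (cong (cellSlot x (vert W i)) ft))))) (h (suc i) lt)))
      where
      gate≢cell : ∀ {a y u} → gate a ≢ cell y u
      gate≢cell ()

  vert-step : ∀ x W → InHub x W → ∀ i → i < M → vert W (suc i) ≡ σ (proj₂ (ω W i)) (vert W i)
  vert-step x W h i lt = proj₂ (cell-inj (trans (sym (h (suc i) lt)) (trans (step W i) (cong proj₁ (hub-step x W h i lt)))))

  letter-step : ∀ x W → InHub x W → ∀ i → suc i ≤ M → proj₂ (ω W i) ≢ proj₂ (ω W (suc i))
  letter-step x W h i lt e = nb W i (trans (cong₂ _,_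
    (trans (step W i) (cong proj₁ (hub-step x W h i lt))) (sym e)) (sym (hub-step x W h i lt)))

  vert-distinct : ∀ x W → InHub x W → ∀ i j → i < j → j ≤ M → vert W i ≢ vert W j
  vert-distinct x W h i j lt le e = path-distinct (λ k → proj₂ (ω W (k + i))) (λ k → vert W (k + i)) (j ∸ i)
    (ℕ.m<n⇒0<n∸m lt) (ℕ.≤-trans (ℕ.m∸n≤m j i) (ℕ.≤-trans le M≤r))
    (λ k kl → vert-step x W h (k + i) (bound k kl))
    (λ k kl → letter-step x W h (k + i) (bound k (ℕ.<⇒≤ kl)))
    (trans e (cong (vert W) (sym (ℕ.m∸n+n≡m (ℕ.<⇒≤ lt)))))
    where
    bound : ∀ k → k < j ∸ i → k + i < M
    bound k kl = ℕ.<-≤-trans (subst (k + i <_) (ℕ.m∸n+n≡m (ℕ.<⇒≤ lt)) (ℕ.+-monoˡ-< i kl)) le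

  iter-+ : ∀ {A : Set} (f : A → A) j k x → iter f (j + k) x ≡ iter f j (iter f k x)
  iter-+ f zero k x = refl
  iter-+ f (suc j) k x = cong f (iter-+ f j k x)

  nx-free : ∀ k c → 1 ≤ k → k ≤ l → iter nx k c ≢ c
  nx-free k c one le e = go (ℕ.≤-total (suc (toℕ c + k)) g)
    where
    -- Walk from c up to the top of Fin g, then from 0.
    climb : ∀ k c → toℕ c + k < g → toℕ (iter nx k c) ≡ toℕ c + k
    climb zero c _ = sym (ℕ.+-identityʳ _)
    climb (suc k) c lt = trans (nx-< (iter nx k c) (subst (λ x → suc x < g) (sym ih) (subst (_< g) (ℕ.+-suc (toℕ c) k) lt)))
      (trans (cong suc ih) (sym (ℕ.+-suc (toℕ c) k)))
      where
      ih : toℕ (iter nx k c) ≡ toℕ c + k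
      ih = climb k c (ℕ.<-trans (ℕ.+-monoʳ-< (toℕ c) (ℕ.n<1+n k)) lt)
    go : suc (toℕ c + k) ≤ g ⊎ g ≤ suc (toℕ c + k) → ⊥
    go (inj₁ lt) = ℕ.<-irrefl (trans (sym (cong toℕ e)) (climb k c lt))
      (ℕ.≤-trans (s≤s (ℕ.≤-reflexive (sym (ℕ.+-identityʳ _)))) (subst (_≤ toℕ c + k) (ℕ.+-suc (toℕ c) 0) (ℕ.+-monoʳ-≤ (toℕ c) one)))
    go (inj₂ ge) with g ≤? toℕ c + k
    ... | no nle = ℕ.<-irrefl (trans (sym (cong toℕ e)) (climb k c (ℕ.≰⇒> nle)))
      (ℕ.≤-trans (s≤s (ℕ.≤-reflexive (sym (ℕ.+-identityʳ _)))) (subst (_≤ toℕ c + k) (ℕ.+-suc (toℕ c) 0) (ℕ.+-monoʳ-≤ (toℕ c) one)))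
    ... | yes wrap = ℕ.<-irrefl (sym tc) small
      where
      t u : ℕ
      t = l ∸ toℕ c
      c≤l : toℕ c ≤ l
      c≤l = ℕ.≤-pred (Fin.toℕ<n c)
      t<k : suc t ≤ k
      t<k = ℕ.+-cancelˡ-≤ (toℕ c) _ _ (subst (_≤ toℕ c + k) (sym (trans (ℕ.+-suc (toℕ c) t) (cong suc (ℕ.m+[n∸m]≡n c≤l)))) wrap)
      u = k ∸ suc t
      top : toℕ (iter nx t c) ≡ l
      top = trans (climb t c (s≤s (ℕ.≤-reflexive (ℕ.m+[n∸m]≡n c≤l)))) (ℕ.m+[n∸m]≡n c≤l)
      zero! : iter nx (suc t) c ≡ zero
      zero! = trans (cong nx (Fin.toℕ-injective (trans top (sym (Fin.toℕ-fromℕ l))))) (nx-pv zero)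
      split : iter nx k c ≡ iter nx u zero
      split = trans (cong (λ x → iter nx x c) (sym (ℕ.m∸n+n≡m t<k))) (trans (iter-+ nx u (suc t) c) (cong (iter nx u) zero!))
      u<g : u < g
      u<g = s≤s (ℕ.≤-trans (ℕ.m∸n≤m k (suc t)) le)
      tc : toℕ c ≡ u
      tc = trans (sym (cong toℕ e)) (trans (cong toℕ split) (climb u zero u<g))
      small : u < toℕ c
      small = ℕ.+-cancelʳ-< (suc t) u (toℕ c) (ℕ.≤-<-trans (ℕ.≤-reflexive (ℕ.m∸n+n≡m t<k))
        (ℕ.≤-<-trans le (ℕ.≤-reflexive (sym (trans (ℕ.+-suc (toℕ c) t) (cong suc (ℕ.m+[n∸m]≡n c≤l)))))))

  nx-distinct : ∀ i j c → i < j → j ≤ l → iter nx i c ≢ iter nx j c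
  nx-distinct i j c lt le e = nx-free (j ∸ i) (iter nx i c) (ℕ.m<n⇒0<n∸m lt) (ℕ.≤-trans (ℕ.m∸n≤m j i) le)
    (trans (sym (iter-+ nx (j ∸ i) i c)) (trans (cong (λ x → iter nx x c) (ℕ.m∸n+n≡m (ℕ.<⇒≤ lt))) (sym e)))

  iter-suc : ∀ {A : Set} (f : A → A) k x → iter f (suc k) x ≡ iter f k (f x)
  iter-suc f zero x = refl
  iter-suc f (suc k) x = cong f (iter-suc f k x)

  nx-pv-iter : ∀ k y → iter nx k (iter pv k y) ≡ y
  nx-pv-iter zero y = refl
  nx-pv-iter (suc k) y = trans (iter-suc nx k _) (trans (cong (iter nx k) (nx-pv _)) (nx-pv-iter k y))

  pv-distinct : ∀ i j c → i < j → j ≤ l → iter pv i c ≢ iter pv j c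
  pv-distinct i j c lt le e = nx-free k y (ℕ.m<n⇒0<n∸m lt) (ℕ.≤-trans (ℕ.m∸n≤m j i) le)
    (trans (cong (iter nx k) (sym stuck)) (nx-pv-iter k y))
    where
    k : ℕ
    k = j ∸ i
    y : Fin g
    y = iter pv i c
    stuck : iter pv k y ≡ y
    stuck = trans (sym (iter-+ pv k i c)) (trans (cong (λ x → iter pv x c) (ℕ.m∸n+n≡m (ℕ.<⇒≤ lt))) (sym e))

  ring-covered : ∀ (f : ℕ → Fin g) → (∀ i j → i < j → j ≤ l → f i ≢ f j) → ∀ c → ∃ λ i → i ≤ l × f i ≡ c
  ring-covered f distinct c with injective⇒surjective (λ i → f (toℕ i)) (λ {i} {j} → inj i j) c
    where
    inj : ∀ i j → f (toℕ i) ≡ f (toℕ j) → i ≡ j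
    inj i j e with toℕ i <? toℕ j | toℕ j <? toℕ i
    ... | yes lt | _ = ⊥-elim (distinct _ _ lt (ℕ.≤-pred (Fin.toℕ<n j)) e)
    ... | no _ | yes lt = ⊥-elim (distinct _ _ lt (ℕ.≤-pred (Fin.toℕ<n i)) (sym e))
    ... | no p | no q = Fin.toℕ-injective (ℕ.≤-antisym (ℕ.≮⇒≥ q) (ℕ.≮⇒≥ p))
  ... | i , e = toℕ i , ℕ.≤-pred (Fin.toℕ<n i) , e

  -- `few` says that no five distinct edges are deleted. In this form the argument covers edge cuts,
  -- the three edges at a vertex, and no deletion at all.
  module Deleting (bad : Dart → Bool) (bad-τ : ∀ d → bad (τ d) ≡ bad d)
    (few : ∀ (f : Fin 5 → Dart) → (∀ i → bad (f i) ≡ true) → ¬ (∀ i j → i ≢ j → f i ≢ f j × f i ≢ τ (f j))) where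

    _~_ : V → V → Set
    u ~ v = Path bad u v

    ~-sym : ∀ {u v} → u ~ v → v ~ u
    ~-sym = reverseₚ bad-τ

    along-dart : ∀ {d v s} → τ d ≡ (v , s) → bad d ≡ false → proj₁ d ~ v
    along-dart {d} e b = subst (proj₁ d ~_) (cong proj₁ e) (edge d b)

    module InsideHub (x : Fin (suc hubs)) where

      -- An edge cut by a gate has become two edges and both must survive; for an uncut edge the two
      -- tests concern the two darts of that edge.
      ok : Fin n → Letter → Bool
      ok v s = not (bad (cell x v , s)) ∧ not (bad (cell x (σ s v) , s))

      open Reachability (λ v s → σ s v) ok

      ok-sym : ∀ v s → ok (σ s v) s ≡ ok v s
      ok-sym v s rewrite σ-invol s v = Bool.∧-comm (not (bad (cell x (σ s v) , s))) _

      ok-path : ∀ v s → ok v s ≡ true → cell x v ~ cell x (σ s v)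
      ok-path v s o = go s (not-false (proj₁ parts)) (not-false (proj₂ parts))
        where
        parts : not (bad (cell x v , s)) ≡ true × not (bad (cell x (σ s v) , s)) ≡ true
        parts = ∧-split o
        go : ∀ s → bad (cell x v , s) ≡ false → bad (cell x (σ s v) , s) ≡ false → cell x v ~ cell x (σ s v)
        go (suc s) p _ = along-dart refl p
        go 0F p q with foot? x v in ft
        ... | no _ = along-dart (cong (cellSlot x v) ft) p
        ... | yes (a , b , refl , refl) = along-dart (τ-foot a b) p ++ₚ
          ~-sym (subst (λ u → cell x u ~ gate a) (sym (other b)) (along-dart (τ-foot a (opposite b))
            (subst (λ u → bad (cell x u , 0F) ≡ false) (other b) q)))
          where
          other : ∀ b → σ 0F (foot a b) ≡ foot a (opposite b)
          other 0F = foot-σ a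
          other 1F = foot-σ′ a

      reach-path : ∀ {u v} → Reach u v → cell x u ~ cell x v
      reach-path stop = []
      reach-path (_▻_ {v = v} p s {o}) = reach-path p ++ₚ ok-path v s o

      reach-trans : ∀ {u v w} → Reach u v → Reach v w → Reach u w
      reach-trans p stop = p
      reach-trans p (_▻_ q s {o}) = _▻_ (reach-trans p q) s {o}

      reach-sym : ∀ {u v} → Reach u v → Reach v u
      reach-sym stop = stop
      reach-sym (_▻_ {v = v} p s {o}) = reach-trans
        (subst (Reach (σ s v)) (σ-invol s v) (_▻_ stop s {trans (ok-sym v s) o})) (reach-sym p)

      -- Five is the number of vertices from which a side of a cut counts in `NoCut` with k = 4.
      Alive : Fin n → Set
      Alive u = ∃ λ (f : Fin 5 → Fin n) → (∀ {i j} → f i ≡ f j → i ≡ j) × (∀ i → Reach u (f i))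

      -- Otherwise the component of u and its complement both have five vertices, so at least five
      -- tower edges leave it. Each of them involves a deleted dart, and these darts lie on five
      -- different edges of the graph.
      alive-joined : ∀ u v → Alive u → Alive v → cell x u ~ cell x v
      alive-joined u v (f , finj , fr) (h , hinj , hr) = go (closure u)
        where
        go : Closure u → cell x u ~ cell x v
        go C with Closure.R C v in rv
        ... | true = reach-path (Closure.sound C v rv)
        ... | false = ⊥-elim (NoCut.no-thick 4 5 ℕ.≤-refl 10≤r R (inside , outside , ℕ.≤-pred (ℕ.≰⇒> thin)))
          where
          open Closure C
          follow-R : ∀ {a b} → Reach a b → R a ≡ true → R b ≡ true
          follow-R stop ra = ra
          follow-R (_▻_ {v = b} p s {o}) ra = closed b s (follow-R p ra) o
          inside : 5 ≤ cnt R
          inside = ≤-cnt R f (λ i → follow-R (fr i) start) finj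
          outside : 5 ≤ cnt (not ∘ R)
          outside = ≤-cnt (not ∘ R) h (λ i → cong not (escapes i)) hinj
            where
            escapes : ∀ i → R (h i) ≡ false
            escapes i with R (h i) in e
            ... | false = refl
            ... | true = ⊥-elim (true≢false (trans (sym (follow-R (reach-sym (hr i)) e)) rv))
          leaving : Fin (n * 3) → Bool
          leaving k = leaves R (proj₁ (remQuot {n} 3 k)) (proj₂ (remQuot {n} 3 k))
          δ-leaving : δ R ≡ cnt leaving
          δ-leaving = sym (trans (sum-* n 3 (λ k → ⟦ leaving k ⟧)) (sum-cong-≗ λ v → sum-cong-≗ {3} λ s →
            cong (λ p → ⟦ leaves R (proj₁ p) (proj₂ p) ⟧) (Fin.remQuot-combine {n} v s)))
          thin : ¬ (5 ≤ δ R)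
          thin le with pick 5 leaving (subst (5 ≤_) δ-leaving le)
          ... | k , lv , kinj = few (λ i → proj₁ (found i)) (λ i → proj₁ (proj₂ (found i))) separate
            where
            w : Fin 5 → Fin n
            w i = proj₁ (remQuot {n} 3 (k i))
            s : Fin 5 → Letter
            s i = proj₂ (remQuot {n} 3 (k i))
            R-in : ∀ i → R (w i) ≡ true
            R-in i = proj₁ (∧-split (lv i))
            R-out : ∀ i → R (σ (s i) (w i)) ≡ false
            R-out i = not-false (proj₂ (∧-split {R (w i)} (lv i)))
            End : Fin 5 → Fin n → Set
            End i y = y ≡ w i ⊎ y ≡ σ (s i) (w i)
            found : ∀ i → ∃ λ d → bad d ≡ true × ∃ λ y → End i y × d ≡ (cell x y , s i)
            found i with bad (cell x (w i) , s i) in p | bad (cell x (σ (s i) (w i)) , s i) in q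
            ... | true | _ = _ , p , w i , inj₁ refl , refl
            ... | false | true = _ , q , σ (s i) (w i) , inj₂ refl , refl
            ... | false | false = ⊥-elim (true≢false (trans (sym (closed (w i) (s i) (R-in i)
              (cong₂ (λ a b → not a ∧ not b) p q))) (R-out i)))
            same : ∀ i j → s i ≡ s j → w i ≡ w j → i ≡ j
            same i j es ew = kinj (trans (sym (Fin.combine-remQuot {n} 3 (k i))) (trans (cong₂ combine ew es) (Fin.combine-remQuot {n} 3 (k j))))
            meet : ∀ i j y → s i ≡ s j → End i y → End j y → i ≡ j
            meet i j y es (inj₁ p) (inj₁ q) = same i j es (trans (sym p) q)
            meet i j y es (inj₁ p) (inj₂ q) = ⊥-elim (true≢false (trans (sym (R-in i)) (trans (cong R (trans (sym p) q)) (R-out j))))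
            meet i j y es (inj₂ p) (inj₁ q) = ⊥-elim (true≢false (trans (sym (R-in j)) (trans (cong R (trans (sym q) p)) (R-out i))))
            meet i j y es (inj₂ p) (inj₂ q) = same i j es (trans (sym (σ-invol (s i) (w i))) (trans (cong (σ (s i)) (trans (sym p) q))
              (trans (cong (λ t → σ t (σ (s j) (w j))) es) (σ-invol (s j) (w j)))))
            End-σ : ∀ j y → End j y → End j (σ (s j) y)
            End-σ j y (inj₁ p) = inj₂ (cong (σ (s j)) p)
            End-σ j y (inj₂ p) = inj₁ (trans (cong (σ (s j)) p) (σ-invol (s j) (w j)))
            τ-cell : ∀ y t {u t′} → τ (cell x y , t) ≡ (cell x u , t′) → u ≡ σ t y × t′ ≡ t
            τ-cell y 0F e with foot? x y
            τ-cell y 0F () | yes (a , b , _)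
            τ-cell y 0F refl | no _ = refl , refl
            τ-cell y (suc t) refl = refl , refl
            separate : ∀ i j → i ≢ j → proj₁ (found i) ≢ proj₁ (found j) × proj₁ (found i) ≢ τ (proj₁ (found j))
            separate i j i≢j with found i | found j
            ... | ._ , _ , y , ey , refl | ._ , _ , y′ , ey′ , refl =
              (λ e → i≢j (meet i j y (cong proj₂ e) ey (subst (End j) (sym (proj₂ (cell-inj (cong proj₁ e)))) ey′))) ,
              (λ e → let p , q = τ-cell y′ (s j) (sym e) in
                 i≢j (meet i j y q ey (subst (End j) (sym p) (End-σ j y′ ey′))))

    open InsideHub using (Alive; alive-joined)

    -- Each gate is backed by five consecutive vertices of the line in its hub.
    fore aft : Fin K → ℕ → Dart
    fore a k = cell (hubOf a) (z (k + pos a 1F)) , alt (k + pos a 1F)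
    aft a k = cell (hubOf a) (z (suc k + pos a 1F)) , alt (k + pos a 1F)

    legs : Fin K → List Dart
    legs a = (gate a , 1F) ∷ fore a 0 ∷ fore a 1 ∷ fore a 2 ∷ fore a 3 ∷ aft a 0 ∷ aft a 1 ∷ aft a 2 ∷ aft a 3 ∷ []

    data Leg (a : Fin K) : Dart → Set where
      trunk : Leg a (gate a , 1F)
      fore′ : ∀ k → k ≤ 3 → Leg a (fore a k)
      aft′  : ∀ k → k ≤ 3 → Leg a (aft a k)

    leg-sound : ∀ {a e} → e ∈ legs a → Leg a e
    leg-sound (here refl) = trunk
    leg-sound (there (here refl)) = fore′ 0 z≤n
    leg-sound (there (there (here refl))) = fore′ 1 (s≤s z≤n)
    leg-sound (there (there (there (here refl)))) = fore′ 2 (s≤s (s≤s z≤n))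
    leg-sound (there (there (there (there (here refl))))) = fore′ 3 (s≤s (s≤s (s≤s z≤n)))
    leg-sound (there (there (there (there (there (here refl)))))) = aft′ 0 z≤n
    leg-sound (there (there (there (there (there (there (here refl))))))) = aft′ 1 (s≤s z≤n)
    leg-sound (there (there (there (there (there (there (there (here refl)))))))) = aft′ 2 (s≤s (s≤s z≤n))
    leg-sound (there (there (there (there (there (there (there (there (here refl))))))))) = aft′ 3 (s≤s (s≤s (s≤s z≤n)))

    fore-∈ : ∀ a k → k ≤ 3 → fore a k ∈ legs a
    fore-∈ a 0 _ = there (here refl)
    fore-∈ a 1 _ = there (there (here refl))
    fore-∈ a 2 _ = there (there (there (here refl)))
    fore-∈ a 3 _ = there (there (there (there (here refl))))
    fore-∈ a (suc (suc (suc (suc k)))) (s≤s (s≤s (s≤s ())))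

    aft-∈ : ∀ a k → k ≤ 3 → aft a k ∈ legs a
    aft-∈ a 0 _ = there (there (there (there (there (here refl)))))
    aft-∈ a 1 _ = there (there (there (there (there (there (here refl))))))
    aft-∈ a 2 _ = there (there (there (there (there (there (there (here refl)))))))
    aft-∈ a 3 _ = there (there (there (there (there (there (there (there (here refl))))))))
    aft-∈ a (suc (suc (suc (suc k)))) (s≤s (s≤s (s≤s ())))

    Near : Fin K → V → Set
    Near a v = ∃ λ k → k ≤ 4 × v ≡ cell (hubOf a) (z (k + pos a 1F))

    near-unique : ∀ {a a′ v} → Near a v → Near a′ v → a ≡ a′
    near-unique {a} {a′} (k , le , e) (k′ , le′ , e′) = tentacle a 1F k a′ 1F k′ (ℕ.m≤n⇒m≤1+n le) (ℕ.m≤n⇒m≤1+n le′)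
      (proj₂ (cell-inj (trans (sym e) e′)))

    leg-src : ∀ {a e} → Leg a e → e ≡ (gate a , 1F) ⊎ Near a (proj₁ e)
    leg-src trunk = inj₁ refl
    leg-src (fore′ k le) = inj₂ (k , ℕ.m≤n⇒m≤1+n le , refl)
    leg-src (aft′ k le) = inj₂ (suc k , s≤s le , refl)

    leg-dst : ∀ {a e} → Leg a e → Near a (proj₁ (τ e)) ⊎ ∃ λ b → τ e ≡ (gate a , half b)
    leg-dst {a} trunk = inj₁ (0 , z≤n , refl)
    leg-dst {a} (fore′ k le) = go (alt (k + pos a 1F)) refl
      where
      go : ∀ s → s ≡ alt (k + pos a 1F) → Near a (proj₁ (τ (cell (hubOf a) (z (k + pos a 1F)) , s))) ⊎ ∃ λ b → τ (cell (hubOf a) (z (k + pos a 1F)) , s) ≡ (gate a , half b)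
      go 0F e with foot? (hubOf a) (z (k + pos a 1F))
      ... | no _ = inj₁ (suc k , s≤s le , cong (λ s → cell (hubOf a) (σ s (z (k + pos a 1F)))) e)
      ... | yes (a′ , b′ , _ , eq) with tentacle a 1F k a′ b′ 0 (ℕ.≤-trans le (ℕ.m≤m+n 3 2)) z≤n eq
      ... | refl = inj₂ (b′ , refl)
      go (suc s) e = inj₁ (suc k , s≤s le , cong (λ s → cell (hubOf a) (σ s (z (k + pos a 1F)))) e)
    leg-dst {a} (aft′ k le) = go (alt (k + pos a 1F)) refl
      where
      go : ∀ s → s ≡ alt (k + pos a 1F) → Near a (proj₁ (τ (cell (hubOf a) (z (suc k + pos a 1F)) , s))) ⊎ ∃ λ b → τ (cell (hubOf a) (z (suc k + pos a 1F)) , s) ≡ (gate a , half b)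
      go 0F e with foot? (hubOf a) (z (suc k + pos a 1F))
      ... | no _ = inj₁ (k , ℕ.m≤n⇒m≤1+n le , trans (cong (λ s → cell (hubOf a) (σ s (z (suc k + pos a 1F)))) e) (cong (cell (hubOf a)) (sym (z-step (k + pos a 1F)))))
      ... | yes (a′ , b′ , _ , eq) with tentacle a 1F (suc k) a′ b′ 0 (s≤s (ℕ.≤-trans le (ℕ.n≤1+n 3))) z≤n eq
      ... | refl = inj₂ (b′ , refl)
      go (suc s) e = inj₁ (k , ℕ.m≤n⇒m≤1+n le , trans (cong (λ s → cell (hubOf a) (σ s (z (suc k + pos a 1F)))) e) (cong (cell (hubOf a)) (sym (z-step (k + pos a 1F)))))

    gate≢near : ∀ {a a′} → ¬ Near a (gate a′)
    gate≢near (_ , _ , ())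

    leg-unique : ∀ {a a′ e e′} → Leg a e → Leg a′ e′ → e ≡ e′ ⊎ e ≡ τ e′ → a ≡ a′
    leg-unique {a} {a′} p q (inj₁ refl) with leg-src p | leg-src q
    ... | inj₁ refl | inj₁ refl = refl
    ... | inj₁ refl | inj₂ h = ⊥-elim (gate≢near h)
    ... | inj₂ h | inj₁ refl = ⊥-elim (gate≢near h)
    ... | inj₂ h | inj₂ h′ = near-unique h h′
    leg-unique {a} {a′} {e} {e′} p q (inj₂ eq) with leg-src p | leg-dst q
    ... | inj₁ refl | inj₁ h = ⊥-elim (gate≢near (subst (Near a′) (cong proj₁ (sym eq)) h))
    ... | inj₁ refl | inj₂ (b , h) = gate-inj (cong proj₁ (trans eq h))
    ... | inj₂ h | inj₁ h′ = near-unique h (subst (Near a′) (cong proj₁ (sym eq)) h′)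
    ... | inj₂ h | inj₂ (b , h′) = ⊥-elim (gate≢near (subst (Near a) (cong proj₁ (trans eq h′)) h))

    Good : List Dart → Set
    Good ds = ∀ {e} → e ∈ ds → bad e ≡ false

    leg-alive : ∀ a → Good (legs a) → Alive (hubOf a) (foot a 1F)
    leg-alive a good = (λ i → z (toℕ i + pos a 1F)) ,
      (λ {i} {j} e → Fin.toℕ-injective (ℕ.+-cancelʳ-≡ (pos a 1F) _ _ (z-injective _ _
        (pos≤r a 1F (toℕ i) (Fin.toℕ≤n i)) (pos≤r a 1F (toℕ j) (Fin.toℕ≤n j)) e))) ,
      (λ i → reach (toℕ i) (ℕ.≤-pred (Fin.toℕ<n i)))
      where
      open InsideHub (hubOf a)
      open Reachability (λ v s → σ s v) ok
      reach : ∀ k → k ≤ 4 → Reach (foot a 1F) (z (k + pos a 1F))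
      reach zero le = stop
      reach (suc k) (s≤s le) = _▻_ (reach k (ℕ.m≤n⇒m≤1+n le)) (alt (k + pos a 1F))
        {cong₂ (λ p q → not p ∧ not q) (good (fore-∈ a k le)) (good (aft-∈ a k le))}

    headDart : QDart → Dart
    headDart = nodeSlot

    τ-head : ∀ d → τ (headDart d) ≡ headDart (partner d)
    τ-head (inj₁ (i , s)) = refl
    τ-head (inj₂ q) = cong gateSlot (Fin.splitAt-↑ˡ ports q g)

    head-inj : ∀ d d′ → headDart d ≡ headDart d′ → d ≡ d′
    head-inj (inj₁ (i , s)) (inj₁ (j , t)) refl = refl
    head-inj (inj₂ q) (inj₂ q′) e = cong inj₂ (Fin.↑ˡ-injective g q q′ (gate-inj (cong proj₁ e)))

    legsAt : QDart → List Dart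
    legsAt (inj₁ _) = []
    legsAt (inj₂ q) = legs (q ↑ˡ g)

    -- If none of these darts is deleted then d can still be traversed.
    resources : QDart → List Dart
    resources d = headDart d ∷ (legsAt d List.++ legsAt (partner d))

    data Resource (d : QDart) : Dart → Set where
      head : Resource d (headDart d)
      leg  : ∀ q {e} → d ≡ inj₂ q ⊎ d ≡ partner (inj₂ q) → Leg (q ↑ˡ g) e → Resource d e

    partner-invol : ∀ d → partner (partner d) ≡ d
    partner-invol (inj₁ (i , s)) = slot-involutive i s
    partner-invol (inj₂ q) = port-involutive q

    resource-sound : ∀ {d e} → e ∈ resources d → Resource d e
    resource-sound (here refl) = head
    resource-sound {d} {e} (there m) with ∈-++⁻ (legsAt d) m
    ... | inj₁ m′ = at d refl m′
      where
      at : ∀ d′ → d ≡ d′ → e ∈ legsAt d′ → Resource d e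
      at (inj₂ q) eq m = leg q (inj₁ eq) (leg-sound m)
    ... | inj₂ m′ = at (partner d) refl m′
      where
      at : ∀ d′ → partner d ≡ d′ → e ∈ legsAt d′ → Resource d e
      at (inj₂ q) eq m = leg q (inj₂ (trans (sym (partner-invol d)) (cong partner eq))) (leg-sound m)

    head-not-leg : ∀ d {a e} → Leg a e → headDart d ≢ e × headDart d ≢ τ e
    head-not-leg d {a} {e} p = (λ q → src′ d (leg-src p) q) , (λ q → dst′ d (leg-dst p) q)
      where
      src′ : ∀ d → e ≡ (gate a , 1F) ⊎ Near a (proj₁ e) → headDart d ≢ e
      src′ (inj₁ _) (inj₁ refl) ()
      src′ (inj₂ _) (inj₁ refl) ()
      src′ (inj₁ _) (inj₂ (_ , _ , h)) refl with h
      ... | ()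
      src′ (inj₂ _) (inj₂ h) refl = gate≢near h
      dst′ : ∀ d → Near a (proj₁ (τ e)) ⊎ (∃ λ b → τ e ≡ (gate a , half b)) → headDart d ≢ τ e
      dst′ d (inj₂ (0F , h)) q with d | trans q h
      ... | inj₁ _ | ()
      ... | inj₂ _ | ()
      dst′ d (inj₂ (1F , h)) q with d | trans q h
      ... | inj₁ _ | ()
      ... | inj₂ _ | ()
      dst′ d (inj₁ (k , _ , h)) q with d | trans (cong proj₁ q) h
      ... | inj₁ _ | ()
      ... | inj₂ _ | ()

    -- Makes `few` applicable to the blueprint: trails without a common edge have disjoint
    -- resources, so each blocked trail accounts for a deleted edge of its own.
    resource-unique : ∀ {d d′ e e′} → Resource d e → Resource d′ e′ → e ≡ e′ ⊎ e ≡ τ e′ → d ≡ d′ ⊎ d ≡ partner d′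
    resource-unique {d} {d′} head head (inj₁ q) = inj₁ (head-inj d d′ q)
    resource-unique {d} {d′} head head (inj₂ q) = inj₂ (head-inj d (partner d′) (trans q (τ-head d′)))
    resource-unique {d} head (leg _ _ p) (inj₁ q) = ⊥-elim (proj₁ (head-not-leg d p) q)
    resource-unique {d} head (leg _ _ p) (inj₂ q) = ⊥-elim (proj₂ (head-not-leg d p) q)
    resource-unique {d′ = d′} (leg _ _ p) head (inj₁ q) = ⊥-elim (proj₁ (head-not-leg d′ p) (sym q))
    resource-unique {d′ = d′} (leg _ _ p) head (inj₂ q) = ⊥-elim (proj₁ (head-not-leg (partner d′) p) (trans (sym (τ-head d′)) (sym q)))
    resource-unique {d} {d′} (leg q h p) (leg q′ h′ p′) eq with Fin.↑ˡ-injective g q q′ (leg-unique p p′ eq)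
    ... | refl = pair h h′
      where
      pair : d ≡ inj₂ q ⊎ d ≡ partner (inj₂ q) → d′ ≡ inj₂ q ⊎ d′ ≡ partner (inj₂ q) → d ≡ d′ ⊎ d ≡ partner d′
      pair (inj₁ x) (inj₁ y) = inj₁ (trans x (sym y))
      pair (inj₁ x) (inj₂ y) = inj₂ (trans x (sym (trans (cong partner y) (partner-invol _))))
      pair (inj₂ x) (inj₁ y) = inj₂ (trans x (cong partner (sym y)))
      pair (inj₂ x) (inj₂ y) = inj₁ (trans x (sym y))

    -- At a hub any alive vertex will do. As all of these are joined, a trail can leave by a port
    -- other than that of its arrival.
    At : Place → V → Set
    At (inj₁ i) v = v ≡ node i
    At (inj₂ y) v = ∃ λ u → v ≡ cell y u × Alive y u

    hubOf-port : ∀ q → hubOf (q ↑ˡ g) ≡ hub q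
    hubOf-port q rewrite Fin.splitAt-↑ˡ ports q g = refl

    into-hub : ∀ a → Good (legs a) → gate a ~ cell (hubOf a) (foot a 1F)
    into-hub a good = along-dart refl (good (here refl))

    pass : ∀ d {v} → Good (resources d) → At (place d) v → ∃ λ v′ → At (place (partner d)) v′ × v ~ v′
    pass (inj₁ (i , s)) good refl with slot i s in eq
    ... | inj₁ (j , t) = node j , refl , along-dart (cong nodeSlot eq) (good (here refl))
    ... | inj₂ q = cell (hub q) (foot (q ↑ˡ g) 1F) , (_ , refl , subst (λ y → Alive y (foot (q ↑ˡ g) 1F)) (hubOf-port q) (leg-alive (q ↑ˡ g) lg)) ,
      along-dart (cong nodeSlot eq) (good (here refl)) ++ₚ subst (λ y → gate (q ↑ˡ g) ~ cell y (foot (q ↑ˡ g) 1F)) (hubOf-port q) (into-hub (q ↑ˡ g) lg)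
      where
      lg : Good (legs (q ↑ˡ g))
      lg m = good (there m)
    pass (inj₂ q) good (u , refl , al) = node (proj₁ (port q)) , refl ,
      alive-joined (hub q) u (foot a 1F) al (subst (λ y → Alive y (foot a 1F)) (hubOf-port q) (leg-alive a lg)) ++ₚ
      ~-sym (subst (λ y → gate a ~ cell y (foot a 1F)) (hubOf-port q) (into-hub a lg)) ++ₚ
      along-dart (cong gateSlot (Fin.splitAt-↑ˡ ports q g)) (good (here refl))
      where
      a : Fin K
      a = q ↑ˡ g
      lg : Good (legs a)
      lg m = good (there (∈-++⁺ˡ m))

    travel : ∀ ds {p p′ v} → (∀ {d} → d ∈ ds → Good (resources d)) → Joined p ds p′ → At p v → ∃ λ v′ → At p′ v′ × v ~ v′
    travel [] good refl at = _ , at , []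
    travel (d ∷ ds) good (refl , j) at with pass d (good (here refl)) at
    ... | v′ , at′ , path with travel ds (λ m → good (there m)) j at′
    ... | v″ , at″ , path′ = v″ , at″ , path ++ₚ path′

    any-bad : List Dart → Bool
    any-bad [] = false
    any-bad (e ∷ es) = bad e ∨ any-bad es

    any-bad-false : ∀ es → any-bad es ≡ false → Good es
    any-bad-false (e ∷ es) h (here refl) with bad e
    ... | false = refl
    any-bad-false (e ∷ es) h (there m) with bad e
    ... | false = any-bad-false es h m

    any-bad-true : ∀ es → any-bad es ≡ true → ∃ λ e → e ∈ es × bad e ≡ true
    any-bad-true (e ∷ es) h with bad e in eq
    ... | true = e , here refl , eq
    ... | false with any-bad-true es h
    ... | e′ , m , b = e′ , there m , b

    -- If all five trails were blocked, one deleted edge from the resources of each would give five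
    -- distinct deleted edges.
    good-trail : ∀ x → ∃ λ i → ∀ {d} → d ∈ trail x i → Good (resources d)
    good-trail x with decide-fin 5 {λ i → ∀ {d} → d ∈ trail x i → any-bad (resources d) ≡ false}
                                   {λ i → ∃ λ d → d ∈ trail x i × any-bad (resources d) ≡ true}
                                   (λ i → decide-list (any-bad ∘ resources) (trail x i))
    ... | inj₁ (i , h) = i , λ m → any-bad-false _ (h m)
    ... | inj₂ h = ⊥-elim (few (λ i → proj₁ (e i)) (λ i → proj₂ (proj₂ (e i))) separate)
      where
      e : ∀ i → ∃ λ e → e ∈ resources (proj₁ (h i)) × bad e ≡ true
      e i = any-bad-true _ (proj₂ (proj₂ (h i)))
      separate : ∀ i j → i ≢ j → proj₁ (e i) ≢ proj₁ (e j) × proj₁ (e i) ≢ τ (proj₁ (e j))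
      separate i j i≢j = (λ q → clash (inj₁ q)) , (λ q → clash (inj₂ q))
        where
        clash : proj₁ (e i) ≡ proj₁ (e j) ⊎ proj₁ (e i) ≡ τ (proj₁ (e j)) → ⊥
        clash q with resource-unique (resource-sound (proj₁ (proj₂ (e i)))) (resource-sound (proj₁ (proj₂ (e j)))) q
        ... | inj₁ p = proj₁ (apart x i j i≢j (proj₁ (proj₂ (h i))) (proj₁ (proj₂ (h j)))) p
        ... | inj₂ p = proj₂ (apart x i j i≢j (proj₁ (proj₂ (h i))) (proj₁ (proj₂ (h j)))) p

    to-first : ∀ y u → Alive y u → Acc _<_ (toℕ y) → ∃ λ u′ → Alive zero u′ × cell y u ~ cell zero u′
    to-first zero u al _ = u , al , []
    to-first (suc x) u al (acc rs) with good-trail x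
    ... | i , good with travel (trail x i) good (joined x i) (u , refl , al)
    ... | _ , (u′ , refl , al′) , path with to-first (target x) u′ al′ (rs (earlier x))
    ... | u″ , al″ , path′ = u″ , al″ , path ++ₚ path′

    spoke : Fin g → List Dart
    spoke c = (ring c , 2F) ∷ legs (ports ↑ʳ c)

    spoke-unique : ∀ c c′ {e e′} → e ∈ spoke c → e′ ∈ spoke c′ → e ≡ e′ ⊎ e ≡ τ e′ → c ≡ c′
    spoke-unique c c′ (here refl) (here refl) (inj₁ q) = ring-inj (cong proj₁ q)
    spoke-unique c c′ (here refl) (here refl) (inj₂ ())
    spoke-unique c c′ (here refl) (there m) (inj₁ refl) with leg-src (leg-sound m)
    ... | inj₂ (_ , _ , ())
    spoke-unique c c′ (here refl) (there m) (inj₂ q) with leg-dst (leg-sound m)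
    ... | inj₁ (_ , _ , h) = ⊥-elim (absurd (trans (cong proj₁ q) h))
      where
      absurd : ∀ {c y u} → ring c ≢ cell y u
      absurd ()
    ... | inj₂ (b , h) = ⊥-elim (absurd (cong proj₁ (trans q h)))
      where
      absurd : ∀ {c a} → ring c ≢ gate a
      absurd ()
    spoke-unique c c′ (there m) (here refl) (inj₁ refl) with leg-src (leg-sound m)
    ... | inj₂ (_ , _ , ())
    spoke-unique c c′ (there m) (here refl) (inj₂ refl) with leg-src (leg-sound m)
    ... | inj₂ h = ⊥-elim (gate≢near h)
    spoke-unique c c′ (there m) (there m′) q = Fin.↑ʳ-injective ports c c′ (leg-unique (leg-sound m) (leg-sound m′) q)

    5≤g : 5 ≤ g
    5≤g = s≤s 4≤l

    -- Here the girth being at least 5 enters connectivity: the ring has five spokes with disjoint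
    -- resources.
    good-spoke : ∃ λ c → Good (spoke c)
    good-spoke with decide-fin 5 {λ i → any-bad (spoke (inject≤ i 5≤g)) ≡ false} {λ i → any-bad (spoke (inject≤ i 5≤g)) ≡ true}
                                 (λ i → split (any-bad (spoke (inject≤ i 5≤g))))
      where
      split : ∀ b → b ≡ false ⊎ b ≡ true
      split false = inj₁ refl
      split true = inj₂ refl
    ... | inj₁ (i , h) = inject≤ i 5≤g , any-bad-false _ h
    ... | inj₂ h = ⊥-elim (few (λ i → proj₁ (e i)) (λ i → proj₂ (proj₂ (e i))) λ i j i≢j →
        (λ q → clash i j i≢j (inj₁ q)) , (λ q → clash i j i≢j (inj₂ q)))
      where
      e : ∀ i → ∃ λ e → e ∈ spoke (inject≤ i 5≤g) × bad e ≡ true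
      e i = any-bad-true _ (h i)
      clash : ∀ i j → i ≢ j → proj₁ (e i) ≡ proj₁ (e j) ⊎ proj₁ (e i) ≡ τ (proj₁ (e j)) → ⊥
      clash i j i≢j q = i≢j (Fin.inject≤-injective 5≤g 5≤g i j (spoke-unique _ _ (proj₁ (proj₂ (e i))) (proj₁ (proj₂ (e j))) q))

    ring-alive : ∃ λ c → ∃ λ u → Alive zero u × ring c ~ cell zero u
    ring-alive with good-spoke
    ... | c , good = c , foot a 1F , subst (λ y → Alive y (foot a 1F)) zero! (leg-alive a lg) ,
      along-dart refl (good (here refl)) ++ₚ subst (λ y → gate a ~ cell y (foot a 1F)) zero! (into-hub a lg)
      where
      a : Fin K
      a = ports ↑ʳ c
      lg : Good (legs a)
      lg m = good (there m)
      zero! : hubOf a ≡ zero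
      zero! rewrite Fin.splitAt-↑ʳ ports g c = refl

    walk-path : ∀ W → (∀ j → bad (ω W j) ≡ false) → ∀ j → src (ω W 0) ~ src (ω W j)
    walk-path W good zero = []
    walk-path W good (suc j) = walk-path W good j ++ₚ subst (src (ω W j) ~_) (sym (step W j)) (edge (ω W j) (good j))

    hub-alive : ∀ x W → (∀ j → bad (ω W j) ≡ false) → InHub x W → Alive x (vert W 0)
    hub-alive x W good h = (λ i → vert W (toℕ i)) , (λ {i} {j} → inj i j) , (λ i → reach (toℕ i) (ℕ.<⇒≤ (ℕ.<-≤-trans (Fin.toℕ<n i) 5≤M)))
      where
      open InsideHub x
      open Reachability (λ v s → σ s v) ok
      5≤M : 5 ≤ M
      5≤M = ℕ.≤-trans (ℕ.n≤1+n 5) (ℕ.m≤n+m 6 l)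
      inj : ∀ i j → vert W (toℕ i) ≡ vert W (toℕ j) → i ≡ j
      inj i j e with toℕ i <? toℕ j | toℕ j <? toℕ i
      ... | yes lt | _ = ⊥-elim (vert-distinct x W h _ _ lt (ℕ.<⇒≤ (ℕ.<-≤-trans (Fin.toℕ<n j) 5≤M)) e)
      ... | no _ | yes lt = ⊥-elim (vert-distinct x W h _ _ lt (ℕ.<⇒≤ (ℕ.<-≤-trans (Fin.toℕ<n i) 5≤M)) (sym e))
      ... | no p | no q = Fin.toℕ-injective (ℕ.≤-antisym (ℕ.≮⇒≥ q) (ℕ.≮⇒≥ p))
      reach : ∀ k → k ≤ M → Reach (vert W 0) (vert W k)
      reach zero _ = stop
      reach (suc k) lt = subst (Reach (vert W 0)) (sym (vert-step x W h k lt)) (_▻_ (reach k (ℕ.<⇒≤ lt)) (proj₂ (ω W k))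
        {cong₂ (λ p q → not p ∧ not q)
          (trans (cong (λ v → bad (v , proj₂ (ω W k))) (sym (h k (ℕ.<⇒≤ lt)))) (good k))
          (trans (cong bad (sym (hub-step x W h k lt))) (trans (bad-τ (ω W k)) (good k)))})

    -- The walk passes every vertex of the ring, in particular the one whose spoke is intact.
    around : ∀ W → (∀ j → bad (ω W j) ≡ false) → ∀ f s → (∀ i → i ≤ g → ω W i ≡ (ring (f i) , s)) →
             (∀ i j → i < j → j ≤ l → f i ≢ f j) → ∃ λ u → Alive zero u × src (ω W 0) ~ cell zero u
    around W good f s h distinct = go ring-alive
      where
      go : (∃ λ c → ∃ λ u → Alive zero u × ring c ~ cell zero u) → ∃ λ u → Alive zero u × src (ω W 0) ~ cell zero u
      go (c , u , al , path) = let i , le , e = ring-covered f distinct c in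
        u , al , walk-path W good i ++ₚ subst (_~ cell zero u)
          (trans (cong ring (sym e)) (sym (cong proj₁ (h i (ℕ.m≤n⇒m≤1+n le))))) path

    reaches : ∀ W → (∀ j → bad (ω W j) ≡ false) → ∃ λ u → Alive zero u × src (ω W 0) ~ cell zero u
    reaches W good = go (settle W)
      where
      go : Settled W → ∃ λ u → Alive zero u × src (ω W 0) ~ cell zero u
      go (j , inj₁ (x , h)) =
        let u , al , path = to-first x _ (hub-alive x (shiftW j W) (λ i → good (i + j)) h) (<-wellFounded _)
        in u , al , walk-path W good j ++ₚ subst (_~ cell zero u) (sym (h 0 z≤n)) path
      go (j , inj₂ (c , inj₁ h)) =
        let u , al , path = around (shiftW j W) (λ i → good (i + j)) (λ i → iter nx i c) 0F h (λ i j → nx-distinct i j c)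
        in u , al , walk-path W good j ++ₚ path
      go (j , inj₂ (c , inj₂ h)) =
        let u , al , path = around (shiftW j W) (λ i → good (i + j)) (λ i → iter pv i c) 1F h (λ i j → pv-distinct i j c)
        in u , al , walk-path W good j ++ₚ path

    connected : ∀ W W′ → (∀ j → bad (ω W j) ≡ false) → (∀ j → bad (ω W′ j) ≡ false) → src (ω W 0) ~ src (ω W′ 0)
    connected W W′ good good′ =
      let u , al , p = reaches W good
          u′ , al′ , p′ = reaches W′ good′
      in p ++ₚ alive-joined zero u u′ al al′ ++ₚ ~-sym p′

-- Parity lemma and uncolourability

xor-move : ∀ a b → a xor b ≡ false → a ≡ b
xor-move true true _ = refl
xor-move false false _ = refl

xsum-zero : ∀ {k} {f : Fin k → Bool} → (∀ i → f i ≡ false) → Xor.sum f ≡ false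
xsum-zero {zero} h = refl
xsum-zero {suc k} {f} h rewrite h zero = xsum-zero {k} {f ∘ suc} (h ∘ suc)

xsum-single : ∀ {k} (f : Fin k → Bool) i → (∀ j → j ≢ i → f j ≡ false) → Xor.sum f ≡ f i
xsum-single {suc k} f zero h = trans (cong (f zero xor_) (xsum-zero {k} {f ∘ suc} λ j → h (suc j) λ ())) (Bool.xor-identityʳ (f zero))
xsum-single {suc k} f (suc i) h rewrite h zero (λ ()) = xsum-single (f ∘ suc) i λ j ne → h (suc j) (ne ∘ Fin.suc-injective)

xsum-++ : ∀ a {b} (f : Fin (a + b) → Bool) → Xor.sum f ≡ Xor.sum (λ i → f (i ↑ˡ b)) xor Xor.sum (λ i → f (a ↑ʳ i))
xsum-++ zero f = refl
xsum-++ (suc a) f = trans (cong (f zero xor_) (xsum-++ a (f ∘ suc))) (sym (Bool.xor-assoc (f zero) _ _))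

xsum-involution : ∀ {k} (π : Fin k → Fin k) → (∀ i → π (π i) ≡ i) → (∀ i → π i ≢ i) →
                  (f : Fin k → Bool) → (∀ i → f (π i) ≡ f i) → Xor.sum f ≡ false
xsum-involution {k} π inv free f same = begin
  Xor.sum f                              ≡⟨ Xor.sum-cong-≗ split ⟩
  Xor.sum (λ i → A i xor A (π i))        ≡⟨ Xor.∑-distrib-+ A (A ∘ π) ⟩
  Xor.sum A xor Xor.sum (A ∘ π)          ≡⟨ cong (Xor.sum A xor_) (sym (Xor.sum-permute A (permutation π π inv inv))) ⟩
  Xor.sum A xor Xor.sum A                ≡⟨ Bool.xor-same (Xor.sum A) ⟩
  false                                  ∎
  where
  open ≡-Reasoning
  A : Fin k → Bool
  A i = if does (toℕ i <? toℕ (π i)) then f i else false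
  split : ∀ i → f i ≡ A i xor A (π i)
  split i rewrite inv i | same i | <-flip (toℕ i) (toℕ (π i)) (λ e → free i (sym (Fin.toℕ-injective e))) =
    lem (does (toℕ i <? toℕ (π i))) (f i)
    where
    lem : ∀ b x → x ≡ (if b then x else false) xor (if not b then x else false)
    lem true x = sym (Bool.xor-identityʳ x)
    lem false x = refl

distinct-hues : ∀ a b c → a ≢ b → a ≢ c → b ≢ c → hue a ⊕ hue b ⊕ hue c ≡ 𝟘
distinct-hues = toWitness {a? = Fin.all? λ a → Fin.all? λ b → Fin.all? λ c →
  ¬? (a ≟ b) →-dec ¬? (a ≟ c) →-dec ¬? (b ≟ c) →-dec ≡-dec Bool._≟_ Bool._≟_ (hue a ⊕ hue b ⊕ hue c) 𝟘} tt

hue-nz : ∀ c → hue c ≢ 𝟘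
hue-nz zero ()
hue-nz (suc zero) ()
hue-nz (suc (suc zero)) ()

module Uncolourable (B : Blueprint) (l : ℕ) (4≤l : 4 ≤ l) {r : ℕ} (T : Tower r)
  (big : (Construction.K B l 4≤l T + 2) * Construction.D B l 4≤l T + Construction.M B l 4≤l T + 10 ≤ r) where

  open Blueprint B
  open Tower T
  open Line T
  open Construction B l 4≤l T
  open Large big

  -- H stands for one coordinate of the colours. Over the field with two elements orientations are
  -- immaterial, so `H-vertex` is conservation at a vertex.
  module Parity (H : V × Fin 3 → Bool) (H-τ : ∀ d → H (τ d) ≡ H d)
    (H-vertex : ∀ v → H (v , 0F) xor (H (v , 1F) xor H (v , 2F)) ≡ false) where

    H-along : ∀ {d e} → τ d ≡ e → H d ≡ H e
    H-along {d} refl = sym (H-τ d)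

    module AtHub (x : Fin (suc hubs)) where

      f : Letter → Fin n → Bool
      f s v = H (cell x v , s)

      σ-free : ∀ s v → σ s v ≢ v
      σ-free s v e = girth (s ∷ []) v [-] (s≤s z≤n) 1≤r e

      sum-plain : ∀ s → Xor.sum (f (suc s)) ≡ false
      sum-plain s = xsum-involution (σ (suc s)) (σ-invol (suc s)) (σ-free (suc s)) (f (suc s)) (λ v → sym (H-along refl))

      -- Where a gate cuts an edge, the values at its two feet differ by the value on the third edge
      -- of the gate. Charging that value to foot 0 makes the sum of `f 0F` and `h` invariant under
      -- the involution of letter 0.
      term : Fin n → Fin K → Bool
      term v a = if does (hubOf a ≟ x) then (if does (foot a 0F ≟ v) then H (gate a , 2F) else false) else false

      h : Fin n → Bool
      h v = Xor.sum (term v)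

      term-off : ∀ v a → ¬ (hubOf a ≡ x × foot a 0F ≡ v) → term v a ≡ false
      term-off v a ne with hubOf a ≟ x | foot a 0F ≟ v
      ... | yes p | yes q = ⊥-elim (ne (p , q))
      ... | yes p | no q = refl
      ... | no p | _ = refl

      h-foot : ∀ a → hubOf a ≡ x → h (foot a 0F) ≡ H (gate a , 2F)
      h-foot a e = trans (xsum-single (term (foot a 0F)) a λ a′ ne → term-off _ a′ λ (_ , q) → ne (proj₁ (foot-inj a′ 0F a 0F q)))
        (trans (cong (λ b → if b then (if does (foot a 0F ≟ foot a 0F) then H (gate a , 2F) else false) else false) (dec-true (hubOf a ≟ x) e))
               (cong (λ b → if b then H (gate a , 2F) else false) (dec-true (foot a 0F ≟ foot a 0F) refl)))

      h-off : ∀ v → (∀ a → hubOf a ≡ x → foot a 0F ≢ v) → h v ≡ false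
      h-off v ne = xsum-zero {K} {term v} λ a → term-off v a λ (p , q) → ne a p q

      h-foot₁ : ∀ a → h (foot a 1F) ≡ false
      h-foot₁ a = h-off _ λ a′ _ q → absurd (proj₂ (foot-inj a′ 0F a 1F q))
        where
        absurd : _≢_ {A = Fin 2} 0F 1F
        absurd ()

      swap : ∀ p q s → p xor (q xor s) ≡ false → q xor false ≡ p xor s
      swap true true false _ = refl
      swap true false true _ = refl
      swap false true true _ = refl
      swap false false false _ = refl

      value₀ : ∀ a → hubOf a ≡ x → f 0F (foot a 0F) xor h (foot a 0F) ≡ H (gate a , 0F) xor H (gate a , 2F)
      value₀ a refl = cong₂ _xor_ (H-along (τ-foot a 0F)) (h-foot a refl)

      value₁ : ∀ a → hubOf a ≡ x → f 0F (foot a 1F) xor h (foot a 1F) ≡ H (gate a , 0F) xor H (gate a , 2F)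
      value₁ a refl = trans (cong₂ _xor_ (H-along (τ-foot a 1F)) (h-foot₁ a))
        (swap (H (gate a , 0F)) (H (gate a , 1F)) (H (gate a , 2F)) (H-vertex (gate a)))

      total₀ : ∀ v → f 0F (σ 0F v) xor h (σ 0F v) ≡ f 0F v xor h v
      total₀ v with foot? x v
      ... | yes (a , 0F , e , refl) = trans (cong (λ u → f 0F u xor h u) (foot-σ a)) (trans (value₁ a e) (sym (value₀ a e)))
      ... | yes (a , 1F , e , refl) = trans (cong (λ u → f 0F u xor h u) (foot-σ′ a)) (trans (value₀ a e) (sym (value₁ a e)))
      ... | no ¬p = cong₂ _xor_ (sym (H-along (τ-plain x v ¬p)))
        (trans (h-off _ λ a p q → ¬p (Foot-σ x v (a , 0F , p , sym q))) (sym (h-off v λ a p q → ¬p (a , 0F , p , sym q))))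

      -- In the sum of all vertex equations letters 1 and 2 cancel in pairs, so `f 0F` adds up to
      -- zero. The corrected function does so too, by pairing, and `h` is the difference.
      sum-h : Xor.sum h ≡ false
      sum-h = begin
        Xor.sum h                                      ≡⟨ cong (_xor Xor.sum h) (sym sum-f₀) ⟩
        Xor.sum (f 0F) xor Xor.sum h                   ≡⟨ Xor.∑-distrib-+ (f 0F) h ⟨
        Xor.sum (λ v → f 0F v xor h v)                 ≡⟨ xsum-involution (σ 0F) (σ-invol 0F) (σ-free 0F) (λ v → f 0F v xor h v) total₀ ⟩
        false                                          ∎
        where
        open ≡-Reasoning
        sum-f₀ : Xor.sum (f 0F) ≡ false
        sum-f₀ = begin
          Xor.sum (f 0F)                                                     ≡⟨ Bool.xor-identityʳ _ ⟨
          Xor.sum (f 0F) xor false                                           ≡⟨ cong (Xor.sum (f 0F) xor_) (cong₂ _xor_ (sym (sum-plain 0F)) (sym (sum-plain 1F))) ⟩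
          Xor.sum (f 0F) xor (Xor.sum (f 1F) xor Xor.sum (f 2F))             ≡⟨ cong (Xor.sum (f 0F) xor_) (Xor.∑-distrib-+ (f 1F) (f 2F)) ⟨
          Xor.sum (f 0F) xor Xor.sum (λ v → f 1F v xor f 2F v)               ≡⟨ Xor.∑-distrib-+ (f 0F) (λ v → f 1F v xor f 2F v) ⟨
          Xor.sum (λ v → f 0F v xor (f 1F v xor f 2F v))                     ≡⟨ xsum-zero {n} (λ v → H-vertex (cell x v)) ⟩
          false                                                              ∎

      gates-zero : Xor.sum (λ a → if does (hubOf a ≟ x) then H (gate a , 2F) else false) ≡ false
      gates-zero = trans (sym (trans (Xor.∑-comm term) (Xor.sum-cong-≗ column))) sum-h
        where
        column : ∀ a → Xor.sum (λ v → term v a) ≡ (if does (hubOf a ≟ x) then H (gate a , 2F) else false)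
        column a with does (hubOf a ≟ x)
        ... | false = xsum-zero {n} λ _ → refl
        ... | true = trans (xsum-single (λ v → if does (foot a 0F ≟ v) then H (gate a , 2F) else false) (foot a 0F)
                             λ v ne → cong (λ b → if b then H (gate a , 2F) else false) (dec-false (foot a 0F ≟ v) (ne ∘ sym)))
                           (cong (λ b → if b then H (gate a , 2F) else false) (dec-true (foot a 0F ≟ foot a 0F) refl))

    -- The spokes together contribute nothing to the equation of hub 0, so attaching the ring does
    -- not affect the flow on the blueprint.
    ring-zero : Xor.sum (λ i → H (ring i , 2F)) ≡ false
    ring-zero = begin
      Xor.sum (λ i → H (ring i , 2F))                                          ≡⟨ Xor.sum-cong-≗ spokes ⟩
      Xor.sum (λ i → H (ring i , 0F) xor H (ring i , 1F))                      ≡⟨ Xor.∑-distrib-+ (λ i → H (ring i , 0F)) (λ i → H (ring i , 1F)) ⟩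
      Xor.sum (λ i → H (ring i , 0F)) xor Xor.sum (λ i → H (ring i , 1F))      ≡⟨ cong₂ _xor_ (Xor.sum-cong-≗ turn) (Xor.sum-permute (λ i → H (ring i , 1F)) (permutation nx pv nx-pv pv-nx)) ⟩
      Xor.sum (λ i → H (ring (nx i) , 1F)) xor Xor.sum (λ i → H (ring (nx i) , 1F)) ≡⟨ Bool.xor-same (Xor.sum (λ i → H (ring (nx i) , 1F))) ⟩
      false                                                                    ∎
      where
      open ≡-Reasoning
      spokes : ∀ i → H (ring i , 2F) ≡ H (ring i , 0F) xor H (ring i , 1F)
      spokes i = sym (xor-move _ _ (trans (Bool.xor-assoc (H (ring i , 0F)) (H (ring i , 1F)) (H (ring i , 2F))) (H-vertex (ring i))))
      turn : ∀ i → H (ring i , 0F) ≡ H (ring (nx i) , 1F)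
      turn i = H-along {ring i , 0F} refl

    hub-zero : ∀ x → hubSum (λ q → H (node (proj₁ (port q)) , proj₂ (port q))) x ≡ false
    hub-zero x = trans (sym (Bool.xor-identityʳ _)) (trans (cong₂ _xor_ (Xor.sum-cong-≗ left) (sym right))
      (trans (sym (xsum-++ ports (λ a → if does (hubOf a ≟ x) then H (gate a , 2F) else false))) (AtHub.gates-zero x)))
      where
      left : ∀ q → (if does (hub q ≟ x) then H (node (proj₁ (port q)) , proj₂ (port q)) else false) ≡
                   (if does (hubOf (q ↑ˡ g) ≟ x) then H (gate (q ↑ˡ g) , 2F) else false)
      left q = cong₂ (λ y b → if does (y ≟ x) then b else false) (cong [ hub , const 0F ]′ (sym (Fin.splitAt-↑ˡ ports q g)))
        (sym (H-along {gate (q ↑ˡ g) , 2F} (cong gateSlot (Fin.splitAt-↑ˡ ports q g))))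
      right : Xor.sum (λ i → if does (hubOf (ports ↑ʳ i) ≟ x) then H (gate (ports ↑ʳ i) , 2F) else false) ≡ false
      right = trans (Xor.sum-cong-≗ to-ring) (scale (does (0F ≟ x)))
        where
        to-ring : ∀ i → (if does (hubOf (ports ↑ʳ i) ≟ x) then H (gate (ports ↑ʳ i) , 2F) else false) ≡
                        (if does (0F ≟ x) then H (ring i , 2F) else false)
        to-ring i = cong₂ (λ y b → if does (y ≟ x) then b else false) (cong [ hub , const 0F ]′ (Fin.splitAt-↑ʳ ports g i))
          (H-along {gate (ports ↑ʳ i) , 2F} (cong gateSlot (Fin.splitAt-↑ʳ ports g i)))
        scale : ∀ b → Xor.sum (λ i → if b then H (ring i , 2F) else false) ≡ false
        scale true = ring-zero
        scale false = xsum-zero {g} λ _ → refl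

  uncolourable : (κ : V × Fin 3 → Fin 3) → (∀ d → κ (τ d) ≡ κ d) → (∀ v i j → κ (v , i) ≡ κ (v , j) → i ≡ j) → ⊥
  uncolourable κ κ-τ κ-inj = no-flow record
    { F = λ (i , s) → hue (κ (node i , s))
    ; F-nz = λ d → hue-nz _
    ; F-node = λ i → vertex (node i)
    ; F-slot = λ i s d e → cong hue (trans (sym (κ-τ (node i , s))) (cong (κ ∘ nodeSlot) e))
    ; F-hub₁ = Parity.hub-zero (proj₁ ∘ hue ∘ κ) (λ d → cong (proj₁ ∘ hue) (κ-τ d)) (λ v → cong proj₁ (vertex v))
    ; F-hub₂ = Parity.hub-zero (proj₂ ∘ hue ∘ κ) (λ d → cong (proj₂ ∘ hue) (κ-τ d)) (λ v → cong proj₂ (vertex v))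
    }
    where
    vertex : ∀ v → hue (κ (v , 0F)) ⊕ hue (κ (v , 1F)) ⊕ hue (κ (v , 2F)) ≡ 𝟘
    vertex v = distinct-hues _ _ _ (ne 0F 1F λ ()) (ne 0F 2F λ ()) (ne 1F 2F λ ())
      where
      ne : ∀ i j → i ≢ j → κ (v , i) ≢ κ (v , j)
      ne i j i≢j e = i≢j (κ-inj v i j e)

-- Girth, cyclic connectivity and the snark property

subset-size : ∀ {k} (S : Subset.Subset k) → cnt (lookup S) ≡ Subset.∣ S ∣
subset-size [] = refl
subset-size (true ∷ S) = cong suc (subset-size S)
subset-size (false ∷ S) = subset-size S

module Snark (B : Blueprint) (l : ℕ) (4≤l : 4 ≤ l) {r : ℕ} (T : Tower r)
  (big : (Construction.K B l 4≤l T + 2) * Construction.D B l 4≤l T + Construction.M B l 4≤l T + 10 ≤ r) where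

  open Blueprint B using (nodes; ports; hubs)
  open Tower T using (n)
  open Line T using (z; z-injective)
  open Construction B l 4≤l T using (g; K; M; D)
  open Construction.Large B l 4≤l T big using (dartGraph; node; gate; ring; cell; ring-inj; nx; pv; nx-pv)
  open ToGraph dartGraph hiding (M)
  open Roaming B l 4≤l T big
  open Connecting B l 4≤l T big
  open Uncolourable B l 4≤l T big using (uncolourable)
  open NBWalk

  settled-distinct : ∀ W → ∃ λ j → ∀ a b → a < b → b ≤ l → ω W (a + j) ≢ ω W (b + j)
  settled-distinct W with settle W
  ... | j , inj₁ (x , h) = j , λ a b lt le e → vert-distinct x (shiftW j W) h a b lt
    (ℕ.≤-trans le (ℕ.m≤m+n l 6)) (cong (vertOf ∘ proj₁) e)
  ... | j , inj₂ (c , inj₁ h) = j , λ a b lt le e → nx-distinct a b c lt le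
    (ring-inj (cong proj₁ (trans (sym (h a (ℕ.<⇒≤ (ℕ.<-≤-trans lt (ℕ.m≤n⇒m≤1+n le))))) (trans e (h b (ℕ.m≤n⇒m≤1+n le))))))
  ... | j , inj₂ (c , inj₂ h) = j , λ a b lt le e → pv-distinct a b c lt le
    (ring-inj (cong proj₁ (trans (sym (h a (ℕ.<⇒≤ (ℕ.<-≤-trans lt (ℕ.m≤n⇒m≤1+n le))))) (trans e (h b (ℕ.m≤n⇒m≤1+n le))))))

  -- A circuit of length at most `l` would repeat a dart within every `l` steps, also right after
  -- its walk has settled.
  long : ∀ (C : Circuit graph) → g ≤ Defs.length graph C
  long C with settled-distinct (FromCircuit.nbwalk C)
  ... | j , distinct with FromCircuit.repeat C j
  ... | a , b , lt , le , e = ℕ.≮⇒≥ λ short → distinct a b lt (ℕ.≤-trans le (ℕ.≤-pred short)) e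

  ring-circuit : Circuit graph
  ring-circuit = mkCircuit l (λ i → ring i , zero) ring-inj edges (λ i → refl)
    where
    edges : ∀ {i j} → edgeOf (ring i , zero) ≡ edgeOf (ring j , zero) → i ≡ j
    edges {i} {j} e with edgeOf-inj (ring i , zero) (ring j , zero) e
    ... | inj₁ p = ring-inj (cong proj₁ p)
    ... | inj₂ p = ⊥-elim (absurd (cong proj₂ p))
      where
      absurd : _≢_ {A = Fin 3} zero (suc zero)
      absurd ()

  has-girth : HasGirth graph g
  has-girth = (ring-circuit , refl) , long

  cyclic : CyclicallyEdgeConnected graph 5
  cyclic S small C C′ avoid avoid′ = subst₂ (Walk graph (λ _ → ⊤) (λ e → e Subset.∉ S)) (FromCircuit.ω-start C) (FromCircuit.ω-start C′)
    (toWalk (λ _ → ⊤) (λ e → e Subset.∉ S) bad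
      (λ d b → (λ m → true≢false (trans (sym ([]=⇒lookup m)) b)) , tt) tt
      (Deleting.connected bad (λ d → cong (lookup S) (edgeOf-τ d)) few
        (FromCircuit.nbwalk C) (FromCircuit.nbwalk C′) (good C avoid) (good C′ avoid′)))
    where
    bad : Dart → Bool
    bad d = lookup S (edgeOf d)
    few : ∀ (f : Fin 5 → Dart) → (∀ i → bad (f i) ≡ true) → ¬ (∀ i j → i ≢ j → f i ≢ f j × f i ≢ τ (f j))
    few f hit sep = ℕ.<⇒≱ small (subst (5 ≤_) (subset-size S) (≤-cnt (lookup S) (edgeOf ∘ f) hit (λ {i} {j} → inj i j)))
      where
      inj : ∀ i j → edgeOf (f i) ≡ edgeOf (f j) → i ≡ j
      inj i j e with i ≟ j
      ... | yes p = p
      ... | no ne with edgeOf-inj (f i) (f j) e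
      ... | inj₁ p = ⊥-elim (proj₁ (sep i j ne) p)
      ... | inj₂ p = ⊥-elim (proj₂ (sep i j ne) p)
    good : ∀ C → AvoidsS graph S C → ∀ j → bad (FromCircuit.ω C j) ≡ false
    good C av j with lookup S (edgeOf (FromCircuit.ω C j)) in eq
    ... | false = refl
    ... | true = ⊥-elim (av (FromCircuit.idx C j) (lookup⇒[]= _ S (trans (cong (lookup S) (sym (FromCircuit.ω-edge C j))) eq)))

  -- When each vertex can be left by an undeleted edge other than that of arrival, an endless walk
  -- starts anywhere. This lets `connected` speak about single vertices and not only about circuits.
  module _ (bad : Dart → Bool) (Ok : V → Set)
    (choose : ∀ y t → Ok y → ∃ λ s → s ≢ t × bad (y , s) ≡ false × Ok (dst (y , s))) where

    State : Set
    State = Σ Dart λ d → bad d ≡ false × Ok (dst d)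

    advance : State → State
    advance (d , _ , o) = let s , _ , b , o′ = choose (dst d) (proj₂ (τ d)) o in (dst d , s) , b , o′

    walkFrom : ∀ u → Ok u → ∃ λ W → src (ω W 0) ≡ u × ∀ j → bad (ω W j) ≡ false
    walkFrom u o = record
      { ω = λ j → proj₁ (state j)
      ; step = λ j → refl
      ; nb = λ j e → let d , _ , o′ = state j in proj₁ (proj₂ (choose (dst d) (proj₂ (τ d)) o′)) (cong proj₂ e) } ,
      refl , λ j → proj₁ (proj₂ (state j))
      where
      state : ℕ → State
      state zero = let s , _ , b , o′ = choose u zero o in (u , s) , b , o′
      state (suc j) = advance (state j)

  other : Fin 3 → Fin 3
  other zero = suc zero
  other (suc _) = zero

  other-≢ : ∀ t → other t ≢ t
  other-≢ zero ()
  other-≢ (suc _) ()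

  connected-graph : Connected graph
  connected-graph u v _ _ = subst₂ (Walk graph (λ _ → ⊤) (AllE graph)) (enc-dec u) (enc-dec v)
    (toWalk (λ _ → ⊤) (AllE graph) (λ _ → false) (λ _ _ → tt , tt) tt
      (subst₂ (Path (λ _ → false)) (proj₁ (proj₂ (from u))) (proj₁ (proj₂ (from v)))
        (Deleting.connected (λ _ → false) (λ _ → refl) (λ f hit _ → true≢false (sym (hit zero)))
          (proj₁ (from u)) (proj₁ (from v)) (λ _ → refl) (λ _ → refl))))
    where
    from : ∀ u → ∃ λ W → src (ω W 0) ≡ dec u × (∀ j → false ≡ false)
    from u = walkFrom (λ _ → false) (λ _ → ⊤) (λ y t _ → other t , other-≢ t , refl , tt) (dec u) tt

  -- Going forth along d and back along d′ would be a non-backtracking walk of period two, against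
  -- `settled-distinct`.
  no-parallel : ∀ d d′ → src d ≡ src d′ → dst d ≡ dst d′ → d ≡ d′
  no-parallel d d′ s t with key d ≟ key d′
  ... | yes e = key-inj e
  ... | no ne = let j , distinct = settled-distinct W in
    ⊥-elim (distinct 0 2 (s≤s z≤n) (ℕ.≤-trans (s≤s (s≤s z≤n)) 4≤l) refl)
    where
    alternate : ℕ → Dart
    alternate 0 = d
    alternate 1 = τ d′
    alternate (suc (suc j)) = alternate j
    step′ : ∀ j → src (alternate (suc j)) ≡ dst (alternate j)
    step′ 0 = sym t
    step′ 1 = trans s (sym (cong proj₁ (τ-invol d′)))
    step′ (suc (suc j)) = step′ j
    nb′ : ∀ j → alternate (suc j) ≢ τ (alternate j)
    nb′ 0 e = ne (cong key (trans (sym (τ-invol d)) (trans (cong τ (sym e)) (τ-invol d′))))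
    nb′ 1 e = ne (cong key (trans e (τ-invol d′)))
    nb′ (suc (suc j)) = nb′ j
    W : NBWalk
    W = record { ω = alternate ; step = step′ ; nb = nb′ }

  -- Removing v amounts to deleting the edges at v. There are only three of them, so the result on
  -- fewer than five deletions applies.
  module DeleteVertex (v : Fin N) where

    bad : Dart → Bool
    bad d = does (enc (src d) ≟ v) ∨ does (enc (dst d) ≟ v)

    bad-τ : ∀ d → bad (τ d) ≡ bad d
    bad-τ d = trans (cong (λ x → does (enc (dst d) ≟ v) ∨ does (enc (src x) ≟ v)) (τ-invol d)) (Bool.∨-comm (does (enc (dst d) ≟ v)) _)

    touches : ∀ d → bad d ≡ true → ∃ λ t → d ≡ (dec v , t) ⊎ d ≡ τ (dec v , t)
    touches d b with enc (src d) ≟ v | enc (dst d) ≟ v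
    ... | yes refl | _ = proj₂ d , inj₁ (cong (_, proj₂ d) (sym (dec-enc (src d))))
    ... | no _ | yes refl = proj₂ (τ d) , inj₂ (trans (sym (τ-invol d)) (cong (λ x → τ (x , proj₂ (τ d))) (sym (dec-enc (dst d)))))

    few : ∀ (f : Fin 5 → Dart) → (∀ i → bad (f i) ≡ true) → ¬ (∀ i j → i ≢ j → f i ≢ f j × f i ≢ τ (f j))
    few f hit sep with Fin.pigeonhole (s≤s (s≤s (s≤s (s≤s z≤n)))) (λ i → proj₁ (touches (f i) (hit i)))
    ... | i , j , lt , e with touches (f i) (hit i) | touches (f j) (hit j)
    ... | t , p | t′ , q with e
    ... | refl = clash p q
      where
      i≢j : i ≢ j
      i≢j refl = ℕ.<-irrefl refl lt
      clash : f i ≡ (dec v , t) ⊎ f i ≡ τ (dec v , t) → f j ≡ (dec v , t) ⊎ f j ≡ τ (dec v , t) → ⊥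
      clash (inj₁ p) (inj₁ q) = proj₁ (sep i j i≢j) (trans p (sym q))
      clash (inj₁ p) (inj₂ q) = proj₂ (sep i j i≢j) (trans p (sym (trans (cong τ q) (τ-invol _))))
      clash (inj₂ p) (inj₁ q) = proj₂ (sep i j i≢j) (trans p (cong τ (sym q)))
      clash (inj₂ p) (inj₂ q) = proj₁ (sep i j i≢j) (trans p (sym q))

    Ok : V → Set
    Ok u = enc u ≢ v

    good-ok : ∀ d → bad d ≡ false → Ok (dst d)
    good-ok d b e with enc (src d) ≟ v | enc (dst d) ≟ v
    ... | no _ | no ne = ne e

    bad-dst : ∀ d → Ok (src d) → bad d ≡ true → enc (dst d) ≡ v
    bad-dst d o b with enc (src d) ≟ v | enc (dst d) ≟ v
    ... | yes p | _ = ⊥-elim (o p)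
    ... | no _ | yes p = p

    -- There are no parallel edges, so at most one edge at a vertex other than v is deleted.
    choose : ∀ y t → Ok y → ∃ λ s → s ≢ t × bad (y , s) ≡ false × Ok (dst (y , s))
    choose y t o = pair (other t) (third t) (other-≢ t) (third-≢ t) (third-other t)
      where
      third : Fin 3 → Fin 3
      third zero = suc (suc zero)
      third (suc zero) = suc (suc zero)
      third (suc (suc zero)) = suc zero
      third-≢ : ∀ t → third t ≢ t
      third-≢ zero ()
      third-≢ (suc zero) ()
      third-≢ (suc (suc zero)) ()
      third-other : ∀ t → other t ≢ third t
      third-other zero ()
      third-other (suc zero) ()
      third-other (suc (suc zero)) ()
      pair : ∀ s s′ → s ≢ t → s′ ≢ t → s ≢ s′ → ∃ λ s → s ≢ t × bad (y , s) ≡ false × Ok (dst (y , s))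
      pair s s′ p p′ ne with bad (y , s) in e | bad (y , s′) in e′
      ... | false | _ = s , p , e , good-ok (y , s) e
      ... | true | false = s′ , p′ , e′ , good-ok (y , s′) e′
      ... | true | true = ⊥-elim (ne (cong proj₂ (no-parallel (y , s) (y , s′) refl
        (enc-inj (trans (bad-dst (y , s) o e) (sym (bad-dst (y , s′) o e′)))))))

    from : ∀ u → u ≢ v → ∃ λ W → src (ω W 0) ≡ dec u × (∀ j → bad (ω W j) ≡ false)
    from u ne = walkFrom bad Ok choose (dec u) (λ e → ne (trans (sym (enc-dec u)) e))

    connected-rest : ConnectedOn graph (λ u → ¬ (u ≡ v)) (AllE graph)
    connected-rest u w p q = subst₂ (Walk graph (λ u → ¬ (u ≡ v)) (AllE graph)) (enc-dec u) (enc-dec w)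
      (toWalk (λ u → ¬ (u ≡ v)) (AllE graph) bad (λ d b → tt , good-ok d b) (λ e → p (trans (sym (enc-dec u)) e))
        (subst₂ (Path bad) (proj₁ (proj₂ (from u p))) (proj₁ (proj₂ (from w q)))
          (Deleting.connected bad bad-τ few (proj₁ (from u p)) (proj₁ (from w q)) (proj₂ (proj₂ (from u p))) (proj₂ (proj₂ (from w q))))))

  large : r ≤ N
  large = ℕ.≤-trans (Fin.injective⇒≤ {f = λ i → z (toℕ i)} (λ {i} {j} e → Fin.toℕ-injective
      (z-injective _ _ (Fin.toℕ≤n i) (Fin.toℕ≤n j) e)))
    (ℕ.≤-trans (ℕ.m≤m+n n (hubs * n)) (ℕ.≤-trans (ℕ.m≤n+m _ g) (ℕ.≤-trans (ℕ.m≤n+m _ K) (ℕ.m≤n+m _ nodes))))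

  snark : IsSnark graph
  snark = (ℕ.≤-trans (ℕ.≤-trans (s≤s (s≤s (s≤s z≤n))) 10≤r) large , connected-graph , DeleteVertex.connected-rest) ,
    cubic , λ (c , proper) → uncolourable (Colouring.κ c proper) (Colouring.κ-τ c proper) (Colouring.κ-inj c proper)

snarks : Blueprint → ∀ (g : ℕ) → 5 ≤ g → ∀ (N : ℕ) →
  Σ Graph (λ G → N ≤ Graph.n G × IsSnark G × CyclicallyEdgeConnected G 5 × HasGirth G g)
snarks B (suc l) (s≤s 4≤l) N = graph′ , ℕ.≤-trans (ℕ.m≤n+m N r₀) S.large , S.snark , S.cyclic , S.has-girth
  where
  r₀ : ℕ
  -- The bound that `Large` asks for. The tower is taken with girth above `r₀ + N`, so that the line
  -- alone has N vertices; letting N grow gives infinitely many graphs.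
  r₀ = (Blueprint.ports B + suc l + 2) * ((l + 6 + 2) + (l + 6 + 2)) + (l + 6) + 10
  module S = Snark B l 4≤l (CayleyGraph.tower (r₀ + N)) (ℕ.m≤m+n r₀ N)
  graph′ : Graph
  graph′ = ToGraph.graph (Construction.Large.dartGraph B l 4≤l (CayleyGraph.tower (r₀ + N)) (ℕ.m≤m+n r₀ N))

-- The explicit blueprint

-- The wiring has 85 nodes, 111 ports and 21 hubs. It consists of 13
-- copies of the Petersen graph minus some vertices or edges: node 0-4 form the
-- outer copy; for k < 4 the nodes 5+20k .. 10+20k form the k-th middle copy, and
-- 11+20k .. 17+20k and 18+20k .. 24+20k the two inner copies nested in it. A code c
-- below 255 stands for slot c mod 3 of node c / 3, a code 255 + q for port q.
decode : ℕ → (Fin 85 × Fin 3) ⊎ Fin 111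
decode c = if c <ᵇ 255 then inj₁ ((c / 3) mod 85 , c mod 3) else inj₂ ((c ∸ 255) mod 111)

slotTable : Vec (Vec ℕ 3) 85
slotTable =
  (3 ∷ 6 ∷ 13 ∷ []) ∷ (0 ∷ 267 ∷ 11 ∷ []) ∷ (1 ∷ 281 ∷ 260 ∷ []) ∷ (255 ∷ 282 ∷ 5 ∷ []) ∷ (256 ∷ 2 ∷ 274 ∷ []) ∷
  (21 ∷ 25 ∷ 28 ∷ []) ∷ (22 ∷ 301 ∷ 291 ∷ []) ∷ (15 ∷ 18 ∷ 32 ∷ []) ∷ (296 ∷ 16 ∷ 292 ∷ []) ∷ (286 ∷ 17 ∷ 302 ∷ []) ∷
  (287 ∷ 297 ∷ 23 ∷ []) ∷ (37 ∷ 40 ∷ 43 ∷ []) ∷ (257 ∷ 33 ∷ 53 ∷ []) ∷ (293 ∷ 34 ∷ 50 ∷ []) ∷ (288 ∷ 35 ∷ 47 ∷ []) ∷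
  (294 ∷ 258 ∷ 44 ∷ []) ∷ (289 ∷ 259 ∷ 41 ∷ []) ∷ (290 ∷ 295 ∷ 38 ∷ []) ∷ (58 ∷ 61 ∷ 64 ∷ []) ∷ (261 ∷ 54 ∷ 74 ∷ []) ∷
  (303 ∷ 55 ∷ 71 ∷ []) ∷ (298 ∷ 56 ∷ 68 ∷ []) ∷ (304 ∷ 262 ∷ 65 ∷ []) ∷ (299 ∷ 263 ∷ 62 ∷ []) ∷ (300 ∷ 305 ∷ 59 ∷ []) ∷
  (81 ∷ 85 ∷ 88 ∷ []) ∷ (82 ∷ 321 ∷ 311 ∷ []) ∷ (75 ∷ 78 ∷ 92 ∷ []) ∷ (316 ∷ 76 ∷ 312 ∷ []) ∷ (306 ∷ 77 ∷ 322 ∷ []) ∷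
  (307 ∷ 317 ∷ 83 ∷ []) ∷ (97 ∷ 100 ∷ 103 ∷ []) ∷ (264 ∷ 93 ∷ 113 ∷ []) ∷ (313 ∷ 94 ∷ 110 ∷ []) ∷ (308 ∷ 95 ∷ 107 ∷ []) ∷
  (314 ∷ 265 ∷ 104 ∷ []) ∷ (309 ∷ 266 ∷ 101 ∷ []) ∷ (310 ∷ 315 ∷ 98 ∷ []) ∷ (118 ∷ 121 ∷ 124 ∷ []) ∷ (268 ∷ 114 ∷ 134 ∷ []) ∷
  (323 ∷ 115 ∷ 131 ∷ []) ∷ (318 ∷ 116 ∷ 128 ∷ []) ∷ (324 ∷ 269 ∷ 125 ∷ []) ∷ (319 ∷ 270 ∷ 122 ∷ []) ∷ (320 ∷ 325 ∷ 119 ∷ []) ∷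
  (141 ∷ 145 ∷ 148 ∷ []) ∷ (142 ∷ 341 ∷ 331 ∷ []) ∷ (135 ∷ 138 ∷ 152 ∷ []) ∷ (336 ∷ 136 ∷ 332 ∷ []) ∷ (326 ∷ 137 ∷ 342 ∷ []) ∷
  (327 ∷ 337 ∷ 143 ∷ []) ∷ (157 ∷ 160 ∷ 163 ∷ []) ∷ (271 ∷ 153 ∷ 173 ∷ []) ∷ (333 ∷ 154 ∷ 170 ∷ []) ∷ (328 ∷ 155 ∷ 167 ∷ []) ∷
  (334 ∷ 272 ∷ 164 ∷ []) ∷ (329 ∷ 273 ∷ 161 ∷ []) ∷ (330 ∷ 335 ∷ 158 ∷ []) ∷ (178 ∷ 181 ∷ 184 ∷ []) ∷ (275 ∷ 174 ∷ 194 ∷ []) ∷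
  (343 ∷ 175 ∷ 191 ∷ []) ∷ (338 ∷ 176 ∷ 188 ∷ []) ∷ (344 ∷ 276 ∷ 185 ∷ []) ∷ (339 ∷ 277 ∷ 182 ∷ []) ∷ (340 ∷ 345 ∷ 179 ∷ []) ∷
  (201 ∷ 205 ∷ 208 ∷ []) ∷ (202 ∷ 361 ∷ 351 ∷ []) ∷ (195 ∷ 198 ∷ 212 ∷ []) ∷ (356 ∷ 196 ∷ 352 ∷ []) ∷ (346 ∷ 197 ∷ 362 ∷ []) ∷
  (347 ∷ 357 ∷ 203 ∷ []) ∷ (217 ∷ 220 ∷ 223 ∷ []) ∷ (278 ∷ 213 ∷ 233 ∷ []) ∷ (353 ∷ 214 ∷ 230 ∷ []) ∷ (348 ∷ 215 ∷ 227 ∷ []) ∷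
  (354 ∷ 279 ∷ 224 ∷ []) ∷ (349 ∷ 280 ∷ 221 ∷ []) ∷ (350 ∷ 355 ∷ 218 ∷ []) ∷ (238 ∷ 241 ∷ 244 ∷ []) ∷ (283 ∷ 234 ∷ 254 ∷ []) ∷
  (363 ∷ 235 ∷ 251 ∷ []) ∷ (358 ∷ 236 ∷ 248 ∷ []) ∷ (364 ∷ 284 ∷ 245 ∷ []) ∷ (359 ∷ 285 ∷ 242 ∷ []) ∷ (360 ∷ 365 ∷ 239 ∷ []) ∷
  []

portTable : Vec ℕ 111
portTable =
  9 ∷ 12 ∷ 36 ∷ 46 ∷ 49 ∷ 8 ∷ 57 ∷ 67 ∷ 70 ∷ 96 ∷ 106 ∷ 109 ∷ 4 ∷ 117 ∷ 127 ∷ 130 ∷ 156 ∷ 166 ∷ 169 ∷ 14 ∷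
  177 ∷ 187 ∷ 190 ∷ 216 ∷ 226 ∷ 229 ∷ 7 ∷ 10 ∷ 237 ∷ 247 ∷ 250 ∷ 27 ∷ 30 ∷ 42 ∷ 48 ∷ 51 ∷ 20 ∷ 26 ∷ 39 ∷ 45 ∷
  52 ∷ 24 ∷ 31 ∷ 63 ∷ 69 ∷ 72 ∷ 19 ∷ 29 ∷ 60 ∷ 66 ∷ 73 ∷ 87 ∷ 90 ∷ 102 ∷ 108 ∷ 111 ∷ 80 ∷ 86 ∷ 99 ∷ 105 ∷
  112 ∷ 84 ∷ 91 ∷ 123 ∷ 129 ∷ 132 ∷ 79 ∷ 89 ∷ 120 ∷ 126 ∷ 133 ∷ 147 ∷ 150 ∷ 162 ∷ 168 ∷ 171 ∷ 140 ∷ 146 ∷ 159 ∷ 165 ∷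
  172 ∷ 144 ∷ 151 ∷ 183 ∷ 189 ∷ 192 ∷ 139 ∷ 149 ∷ 180 ∷ 186 ∷ 193 ∷ 207 ∷ 210 ∷ 222 ∷ 228 ∷ 231 ∷ 200 ∷ 206 ∷ 219 ∷ 225 ∷
  232 ∷ 204 ∷ 211 ∷ 243 ∷ 249 ∷ 252 ∷ 199 ∷ 209 ∷ 240 ∷ 246 ∷ 253 ∷
  []

hubTable : Vec ℕ 111
hubTable =
  0 ∷ 0 ∷ 0 ∷ 0 ∷ 0 ∷ 1 ∷ 1 ∷ 1 ∷ 1 ∷ 1 ∷ 1 ∷ 1 ∷ 2 ∷ 2 ∷ 2 ∷ 2 ∷ 2 ∷ 2 ∷ 2 ∷ 3 ∷ 3 ∷ 3 ∷ 3 ∷ 3 ∷ 3 ∷ 3 ∷ 4 ∷ 4 ∷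
  4 ∷ 4 ∷ 4 ∷ 5 ∷ 5 ∷ 5 ∷ 5 ∷ 5 ∷ 6 ∷ 6 ∷ 6 ∷ 6 ∷ 6 ∷ 7 ∷ 7 ∷ 7 ∷ 7 ∷ 7 ∷ 8 ∷ 8 ∷ 8 ∷ 8 ∷ 8 ∷ 9 ∷ 9 ∷ 9 ∷ 9 ∷ 9 ∷
  10 ∷ 10 ∷ 10 ∷ 10 ∷ 10 ∷ 11 ∷ 11 ∷ 11 ∷ 11 ∷ 11 ∷ 12 ∷ 12 ∷ 12 ∷ 12 ∷ 12 ∷ 13 ∷ 13 ∷ 13 ∷ 13 ∷ 13 ∷ 14 ∷ 14 ∷ 14 ∷ 14 ∷ 14 ∷ 15 ∷ 15 ∷ 15 ∷
  15 ∷ 15 ∷ 16 ∷ 16 ∷ 16 ∷ 16 ∷ 16 ∷ 17 ∷ 17 ∷ 17 ∷ 17 ∷ 17 ∷ 18 ∷ 18 ∷ 18 ∷ 18 ∷ 18 ∷ 19 ∷ 19 ∷ 19 ∷ 19 ∷ 19 ∷ 20 ∷ 20 ∷ 20 ∷ 20 ∷ 20 ∷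
  []

-- 3 stands for the absent parent slot of a root.
parentTable : Vec ℕ 85
parentTable =
  3 ∷ 0 ∷ 0 ∷ 2 ∷ 1 ∷ 3 ∷ 0 ∷ 0 ∷ 1 ∷ 1 ∷ 2 ∷ 3 ∷ 1 ∷ 1 ∷ 1 ∷ 2 ∷ 2 ∷ 2 ∷ 3 ∷ 1 ∷ 1 ∷ 1 ∷ 2 ∷ 2 ∷ 2 ∷ 3 ∷ 0 ∷ 0 ∷
  1 ∷ 1 ∷ 2 ∷ 3 ∷ 1 ∷ 1 ∷ 1 ∷ 2 ∷ 2 ∷ 2 ∷ 3 ∷ 1 ∷ 1 ∷ 1 ∷ 2 ∷ 2 ∷ 2 ∷ 3 ∷ 0 ∷ 0 ∷ 1 ∷ 1 ∷ 2 ∷ 3 ∷ 1 ∷ 1 ∷ 1 ∷ 2 ∷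
  2 ∷ 2 ∷ 3 ∷ 1 ∷ 1 ∷ 1 ∷ 2 ∷ 2 ∷ 2 ∷ 3 ∷ 0 ∷ 0 ∷ 1 ∷ 1 ∷ 2 ∷ 3 ∷ 1 ∷ 1 ∷ 1 ∷ 2 ∷ 2 ∷ 2 ∷ 3 ∷ 1 ∷ 1 ∷ 1 ∷ 2 ∷ 2 ∷
  2 ∷
  []

heightTable : Vec ℕ 85
heightTable =
  2 ∷ 1 ∷ 1 ∷ 0 ∷ 1 ∷ 2 ∷ 0 ∷ 1 ∷ 1 ∷ 1 ∷ 0 ∷ 2 ∷ 1 ∷ 1 ∷ 1 ∷ 0 ∷ 0 ∷ 0 ∷ 2 ∷ 1 ∷ 1 ∷ 1 ∷ 0 ∷ 0 ∷ 0 ∷ 2 ∷ 0 ∷ 1 ∷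
  1 ∷ 1 ∷ 0 ∷ 2 ∷ 1 ∷ 1 ∷ 1 ∷ 0 ∷ 0 ∷ 0 ∷ 2 ∷ 1 ∷ 1 ∷ 1 ∷ 0 ∷ 0 ∷ 0 ∷ 2 ∷ 0 ∷ 1 ∷ 1 ∷ 1 ∷ 0 ∷ 2 ∷ 1 ∷ 1 ∷ 1 ∷ 0 ∷
  0 ∷ 0 ∷ 2 ∷ 1 ∷ 1 ∷ 1 ∷ 0 ∷ 0 ∷ 0 ∷ 2 ∷ 0 ∷ 1 ∷ 1 ∷ 1 ∷ 0 ∷ 2 ∷ 1 ∷ 1 ∷ 1 ∷ 0 ∷ 0 ∷ 0 ∷ 2 ∷ 1 ∷ 1 ∷ 1 ∷ 0 ∷ 0 ∷
  0 ∷
  []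

-- Five edge-disjoint trails from hub x + 1 to an earlier hub.
trailTable : Vec (ℕ × Vec (List ℕ) 5) 20
trailTable =
  (0 , (265 ∷ 105 ∷ 311 ∷ 79 ∷ 324 ∷ 127 ∷ 267 ∷ 5 ∷ 9 ∷ []) ∷
    (261 ∷ 59 ∷ 72 ∷ 296 ∷ 26 ∷ 295 ∷ 53 ∷ 36 ∷ []) ∷
    (263 ∷ 69 ∷ 297 ∷ 30 ∷ 289 ∷ 49 ∷ []) ∷
    (262 ∷ 66 ∷ 301 ∷ 20 ∷ 294 ∷ 46 ∷ []) ∷
    (260 ∷ 6 ∷ 2 ∷ 12 ∷ []) ∷ []) ∷
  (1 , (272 ∷ 165 ∷ 331 ∷ 139 ∷ 344 ∷ 187 ∷ 274 ∷ 12 ∷ 258 ∷ 45 ∷ 291 ∷ 19 ∷ 304 ∷ 67 ∷ []) ∷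
    (268 ∷ 119 ∷ 132 ∷ 316 ∷ 86 ∷ 315 ∷ 113 ∷ 96 ∷ []) ∷
    (270 ∷ 129 ∷ 317 ∷ 90 ∷ 309 ∷ 109 ∷ []) ∷
    (269 ∷ 126 ∷ 321 ∷ 80 ∷ 314 ∷ 106 ∷ []) ∷
    (267 ∷ 3 ∷ 1 ∷ 8 ∷ []) ∷ []) ∷
  (2 , (279 ∷ 225 ∷ 351 ∷ 199 ∷ 364 ∷ 247 ∷ 281 ∷ 8 ∷ 265 ∷ 105 ∷ 311 ∷ 79 ∷ 324 ∷ 127 ∷ []) ∷
    (275 ∷ 179 ∷ 192 ∷ 336 ∷ 146 ∷ 335 ∷ 173 ∷ 156 ∷ []) ∷
    (277 ∷ 189 ∷ 337 ∷ 150 ∷ 329 ∷ 169 ∷ []) ∷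
    (276 ∷ 186 ∷ 341 ∷ 140 ∷ 334 ∷ 166 ∷ []) ∷
    (274 ∷ 13 ∷ 0 ∷ 4 ∷ []) ∷ []) ∷
  (3 , (282 ∷ 11 ∷ 4 ∷ 272 ∷ 165 ∷ 331 ∷ 139 ∷ 344 ∷ 187 ∷ []) ∷
    (283 ∷ 239 ∷ 252 ∷ 356 ∷ 206 ∷ 355 ∷ 233 ∷ 216 ∷ []) ∷
    (285 ∷ 249 ∷ 357 ∷ 210 ∷ 349 ∷ 229 ∷ []) ∷
    (284 ∷ 246 ∷ 361 ∷ 200 ∷ 354 ∷ 226 ∷ []) ∷
    (281 ∷ 6 ∷ 2 ∷ 14 ∷ []) ∷ []) ∷
  (0 , (287 ∷ 31 ∷ 299 ∷ 70 ∷ 265 ∷ 105 ∷ 311 ∷ 79 ∷ 324 ∷ 127 ∷ 267 ∷ 5 ∷ 9 ∷ []) ∷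
    (286 ∷ 29 ∷ 304 ∷ 67 ∷ 260 ∷ 6 ∷ 2 ∷ 12 ∷ []) ∷
    (290 ∷ 53 ∷ 36 ∷ []) ∷
    (288 ∷ 44 ∷ 46 ∷ []) ∷
    (289 ∷ 49 ∷ []) ∷ []) ∷
  (5 , (292 ∷ 24 ∷ 297 ∷ 30 ∷ []) ∷
    (291 ∷ 19 ∷ 302 ∷ 27 ∷ []) ∷
    (294 ∷ 47 ∷ 42 ∷ []) ∷
    (293 ∷ 41 ∷ 48 ∷ []) ∷
    (295 ∷ 51 ∷ []) ∷ []) ∷
  (5 , (299 ∷ 70 ∷ 260 ∷ 7 ∷ 282 ∷ 9 ∷ 259 ∷ 48 ∷ []) ∷
    (298 ∷ 65 ∷ 66 ∷ 301 ∷ 20 ∷ 294 ∷ 47 ∷ 42 ∷ []) ∷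
    (300 ∷ 73 ∷ 302 ∷ 27 ∷ []) ∷
    (296 ∷ 26 ∷ 295 ∷ 51 ∷ []) ∷
    (297 ∷ 30 ∷ []) ∷ []) ∷
  (7 , (302 ∷ 27 ∷ 287 ∷ 31 ∷ []) ∷
    (301 ∷ 20 ∷ 292 ∷ 24 ∷ []) ∷
    (304 ∷ 68 ∷ 63 ∷ []) ∷
    (303 ∷ 62 ∷ 69 ∷ []) ∷
    (305 ∷ 72 ∷ []) ∷ []) ∷
  (1 , (307 ∷ 91 ∷ 319 ∷ 130 ∷ 272 ∷ 165 ∷ 331 ∷ 139 ∷ 344 ∷ 187 ∷ 274 ∷ 12 ∷ 258 ∷ 45 ∷ 291 ∷ 19 ∷ 304 ∷ 67 ∷ []) ∷
    (306 ∷ 89 ∷ 324 ∷ 127 ∷ 267 ∷ 3 ∷ 1 ∷ 8 ∷ []) ∷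
    (310 ∷ 113 ∷ 96 ∷ []) ∷
    (308 ∷ 104 ∷ 106 ∷ []) ∷
    (309 ∷ 109 ∷ []) ∷ []) ∷
  (9 , (312 ∷ 84 ∷ 317 ∷ 90 ∷ []) ∷
    (311 ∷ 79 ∷ 322 ∷ 87 ∷ []) ∷
    (314 ∷ 107 ∷ 102 ∷ []) ∷
    (313 ∷ 101 ∷ 108 ∷ []) ∷
    (315 ∷ 111 ∷ []) ∷ []) ∷
  (9 , (319 ∷ 130 ∷ 267 ∷ 3 ∷ 1 ∷ 8 ∷ 266 ∷ 108 ∷ []) ∷
    (318 ∷ 125 ∷ 126 ∷ 321 ∷ 80 ∷ 314 ∷ 107 ∷ 102 ∷ []) ∷
    (320 ∷ 133 ∷ 322 ∷ 87 ∷ []) ∷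
    (316 ∷ 86 ∷ 315 ∷ 111 ∷ []) ∷
    (317 ∷ 90 ∷ []) ∷ []) ∷
  (11 , (322 ∷ 87 ∷ 307 ∷ 91 ∷ []) ∷
    (321 ∷ 80 ∷ 312 ∷ 84 ∷ []) ∷
    (324 ∷ 128 ∷ 123 ∷ []) ∷
    (323 ∷ 122 ∷ 129 ∷ []) ∷
    (325 ∷ 132 ∷ []) ∷ []) ∷
  (2 , (327 ∷ 151 ∷ 339 ∷ 190 ∷ 279 ∷ 225 ∷ 351 ∷ 199 ∷ 364 ∷ 247 ∷ 281 ∷ 8 ∷ 265 ∷ 105 ∷ 311 ∷ 79 ∷ 324 ∷ 127 ∷ []) ∷
    (326 ∷ 149 ∷ 344 ∷ 187 ∷ 274 ∷ 13 ∷ 0 ∷ 4 ∷ []) ∷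
    (330 ∷ 173 ∷ 156 ∷ []) ∷
    (328 ∷ 164 ∷ 166 ∷ []) ∷
    (329 ∷ 169 ∷ []) ∷ []) ∷
  (13 , (332 ∷ 144 ∷ 337 ∷ 150 ∷ []) ∷
    (331 ∷ 139 ∷ 342 ∷ 147 ∷ []) ∷
    (334 ∷ 167 ∷ 162 ∷ []) ∷
    (333 ∷ 161 ∷ 168 ∷ []) ∷
    (335 ∷ 171 ∷ []) ∷ []) ∷
  (13 , (339 ∷ 190 ∷ 274 ∷ 13 ∷ 0 ∷ 4 ∷ 273 ∷ 168 ∷ []) ∷
    (338 ∷ 185 ∷ 186 ∷ 341 ∷ 140 ∷ 334 ∷ 167 ∷ 162 ∷ []) ∷
    (340 ∷ 193 ∷ 342 ∷ 147 ∷ []) ∷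
    (336 ∷ 146 ∷ 335 ∷ 171 ∷ []) ∷
    (337 ∷ 150 ∷ []) ∷ []) ∷
  (15 , (342 ∷ 147 ∷ 327 ∷ 151 ∷ []) ∷
    (341 ∷ 140 ∷ 332 ∷ 144 ∷ []) ∷
    (344 ∷ 188 ∷ 183 ∷ []) ∷
    (343 ∷ 182 ∷ 189 ∷ []) ∷
    (345 ∷ 192 ∷ []) ∷ []) ∷
  (3 , (347 ∷ 211 ∷ 359 ∷ 250 ∷ 282 ∷ 11 ∷ 4 ∷ 272 ∷ 165 ∷ 331 ∷ 139 ∷ 344 ∷ 187 ∷ []) ∷
    (346 ∷ 209 ∷ 364 ∷ 247 ∷ 281 ∷ 6 ∷ 2 ∷ 14 ∷ []) ∷
    (350 ∷ 233 ∷ 216 ∷ []) ∷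
    (348 ∷ 224 ∷ 226 ∷ []) ∷
    (349 ∷ 229 ∷ []) ∷ []) ∷
  (17 , (352 ∷ 204 ∷ 357 ∷ 210 ∷ []) ∷
    (351 ∷ 199 ∷ 362 ∷ 207 ∷ []) ∷
    (354 ∷ 227 ∷ 222 ∷ []) ∷
    (353 ∷ 221 ∷ 228 ∷ []) ∷
    (355 ∷ 231 ∷ []) ∷ []) ∷
  (17 , (359 ∷ 250 ∷ 281 ∷ 6 ∷ 2 ∷ 14 ∷ 280 ∷ 228 ∷ []) ∷
    (358 ∷ 245 ∷ 246 ∷ 361 ∷ 200 ∷ 354 ∷ 227 ∷ 222 ∷ []) ∷
    (360 ∷ 253 ∷ 362 ∷ 207 ∷ []) ∷
    (356 ∷ 206 ∷ 355 ∷ 231 ∷ []) ∷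
    (357 ∷ 210 ∷ []) ∷ []) ∷
  (19 , (362 ∷ 207 ∷ 347 ∷ 211 ∷ []) ∷
    (361 ∷ 200 ∷ 352 ∷ 204 ∷ []) ∷
    (364 ∷ 248 ∷ 243 ∷ []) ∷
    (363 ∷ 242 ∷ 249 ∷ []) ∷
    (365 ∷ 252 ∷ []) ∷ []) ∷
  []
slot : Fin 85 → Fin 3 → (Fin 85 × Fin 3) ⊎ Fin 111
slot i s = decode (lookup (lookup slotTable i) s)

port : Fin 111 → Fin 85 × Fin 3
port q = (lookup portTable q / 3) mod 85 , lookup portTable q mod 3

hub : Fin 111 → Fin 21
hub q = lookup hubTable q mod 21

isParent : Fin 85 → Fin 3 → Bool
isParent i s = lookup parentTable i ≡ᵇ toℕ s

height : Fin 85 → ℕ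
height i = lookup heightTable i

open Wiring slot port hub

number : QDart → ℕ
number (inj₁ (i , s)) = toℕ i * 3 + toℕ s
number (inj₂ q) = 255 + toℕ q

_≟D_ : (d e : QDart) → Dec (d ≡ e)
_≟D_ = Sum.≡-dec (≡-dec _≟_ _≟_) _≟_

_≟P_ : (d e : Place) → Dec (d ≡ e)
_≟P_ = Sum.≡-dec _≟_ _≟_

slot-involutive : ∀ i s → partner (slot i s) ≡ inj₁ (i , s)
slot-involutive = toWitness {a? = Fin.all? λ i → Fin.all? λ s → partner (slot i s) ≟D inj₁ (i , s)} tt

port-involutive : ∀ q → partner (inj₁ (port q)) ≡ inj₂ q
port-involutive = toWitness {a? = Fin.all? λ q → partner (inj₁ (port q)) ≟D inj₂ q} tt

slot-loopless : ∀ i s → place (slot i s) ≢ inj₁ i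
slot-loopless = toWitness {a? = Fin.all? λ i → Fin.all? λ s → ¬? (place (slot i s) ≟P inj₁ i)} tt

rank? : ∀ i s d → Dec (Rank isParent height i s d)
rank? i s (inj₁ (j , t)) with isParent i s
... | true = (isParent j t Data.Bool.≟ false) ×-dec (height i <? height j)
... | false = (isParent j t Data.Bool.≟ true) ×-dec (height j <? height i)
rank? i s (inj₂ q) = isParent i s Data.Bool.≟ false

ranked : ∀ i s → Rank isParent height i s (slot i s)
ranked = toWitness {a? = Fin.all? λ i → Fin.all? λ s → rank? i s (slot i s)} tt

height<3 : ∀ i → height i < 3
height<3 = toWitness {a? = Fin.all? λ i → height i <? 3} tt

trailTarget : Fin 20 → Fin 21
trailTarget x = proj₁ (lookup trailTable x) mod 21

trail : Fin 20 → Fin 5 → List QDart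
trail x i = List.map decode (lookup (proj₂ (lookup trailTable x)) i)

joined? : ∀ a ds b → Dec (Joined a ds b)
joined? a [] b = a ≟P b
joined? a (d ∷ ds) b = (place d ≟P a) ×-dec joined? (place (partner d)) ds b

trail-joined : ∀ x i → Joined (inj₂ (suc x)) (trail x i) (inj₂ (trailTarget x))
trail-joined = toWitness {a? = Fin.all? λ x → Fin.all? λ i → joined? (inj₂ (suc x)) (trail x i) (inj₂ (trailTarget x))} tt

trail-earlier : ∀ x → toℕ (trailTarget x) < suc (toℕ x)
trail-earlier = toWitness {a? = Fin.all? λ x → toℕ (trailTarget x) <? suc (toℕ x)} tt

-- Both darts of an edge as numbers, so that disjointness of trails is decided by comparing
-- naturals.
numbers : QDart → ℕ × ℕ
numbers d = number d , number (partner d)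

disjoint : List (ℕ × ℕ) → List (ℕ × ℕ) → Bool
disjoint ds es = all (λ d → all (λ e → not (proj₁ d ≡ᵇ proj₁ e) ∧ not (proj₁ d ≡ᵇ proj₂ e)) es) ds

isParent-unique : ∀ i s t → isParent i s ≡ true → isParent i t ≡ true → s ≡ t
isParent-unique i s t p q = Fin.toℕ-injective (trans (sym (ℕ.≡ᵇ⇒≡ (lookup parentTable i) (toℕ s) (subst T (sym p) tt)))
  (ℕ.≡ᵇ⇒≡ (lookup parentTable i) (toℕ t) (subst T (sym q) tt)))

trail-disjoint : ∀ x i j → i ≢ j → disjoint (List.map numbers (trail x i)) (List.map numbers (trail x j)) ≡ true
trail-disjoint = toWitness {a? = Fin.all? λ x → Fin.all? λ i → Fin.all? λ j →
  ¬? (i ≟ j) →-dec (disjoint (List.map numbers (trail x i)) (List.map numbers (trail x j)) Data.Bool.≟ true)} tt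

-- The Klein four-group and the Petersen graph

⊕-cancel : ∀ x y → x ⊕ y ≡ 𝟘 → x ≡ y
⊕-cancel (true , true) (true , true) e = refl
⊕-cancel (true , false) (true , false) e = refl
⊕-cancel (false , true) (false , true) e = refl
⊕-cancel (false , false) (false , false) e = refl
⊕-cancel (true , true) (true , false) ()
⊕-cancel (true , false) (true , true) ()
⊕-cancel (false , true) (false , false) ()
⊕-cancel (false , false) (false , true) ()

⊕-self : ∀ x → x ⊕ x ≡ 𝟘
⊕-self (a , b) = cong₂ _,_ (Bool.xor-same a) (Bool.xor-same b)

⊕-identityʳ : ∀ x → x ⊕ 𝟘 ≡ x
⊕-identityʳ (a , b) = cong₂ _,_ (Bool.xor-identityʳ a) (Bool.xor-identityʳ b)

⊕-assoc : ∀ x y z → (x ⊕ y) ⊕ z ≡ x ⊕ (y ⊕ z)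
⊕-assoc (a , b) (c , d) (e , f) = cong₂ _,_ (Bool.xor-assoc a c e) (Bool.xor-assoc b d f)

⊕-comm : ∀ x y → x ⊕ y ≡ y ⊕ x
⊕-comm (a , b) (c , d) = cong₂ _,_ (Bool.xor-comm a c) (Bool.xor-comm b d)

unhue : ∀ x → x ≢ 𝟘 → ∃ λ c → x ≡ hue c
unhue (true , false) _ = # 0 , refl
unhue (false , true) _ = # 1 , refl
unhue (true , true) _ = # 2 , refl
unhue (false , false) h = ⊥-elim (h refl)

-- The Petersen graph: edge star v s joins v to its s-th neighbour.

starTable : Vec (Vec ℕ 3) 10
starTable =
  (0 ∷ 1 ∷ 2 ∷ []) ∷ (3 ∷ 4 ∷ 5 ∷ []) ∷ (6 ∷ 7 ∷ 8 ∷ []) ∷ (9 ∷ 10 ∷ 11 ∷ []) ∷ (6 ∷ 9 ∷ 12 ∷ []) ∷ (3 ∷ 10 ∷ 13 ∷ []) ∷ (4 ∷ 7 ∷ 14 ∷ []) ∷ (0 ∷ 11 ∷ 14 ∷ []) ∷ (1 ∷ 8 ∷ 13 ∷ []) ∷ (2 ∷ 5 ∷ 12 ∷ []) ∷ []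

star : Fin 10 → Fin 3 → Fin 15
star v s = lookup (lookup starTable v) s mod 15

flux : (Fin 15 → K₄) → Fin 10 → K₄
flux φ v = φ (star v 0F) ⊕ φ (star v 1F) ⊕ φ (star v 2F)

-- After the first edge each new one meets an edge already coloured, and every inequality is tested
-- as soon as both of its edges have colours; this prunes the exhaustive search.
no-colouring :
  ∀ (x0 : Fin 3) → ∀ (x1 : Fin 3) → x0 ≢ x1 → ∀ (x2 : Fin 3) → x0 ≢ x2 → x1 ≢ x2 → ∀ (x5 : Fin 3) →
  x2 ≢ x5 → ∀ (x12 : Fin 3) → x2 ≢ x12 → x5 ≢ x12 → ∀ (x3 : Fin 3) → x5 ≢ x3 → ∀ (x4 : Fin 3) →
  x5 ≢ x4 → x3 ≢ x4 → ∀ (x13 : Fin 3) → x1 ≢ x13 → x3 ≢ x13 → ∀ (x8 : Fin 3) → x1 ≢ x8 → x13 ≢ x8 →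
  ∀ (x6 : Fin 3) → x12 ≢ x6 → x8 ≢ x6 → ∀ (x7 : Fin 3) → x4 ≢ x7 → x8 ≢ x7 → x6 ≢ x7 →
  ∀ (x14 : Fin 3) → x0 ≢ x14 → x4 ≢ x14 → x7 ≢ x14 → ∀ (x9 : Fin 3) → x12 ≢ x9 → x6 ≢ x9 →
  ∀ (x10 : Fin 3) → x3 ≢ x10 → x13 ≢ x10 → x9 ≢ x10 → ∀ (x11 : Fin 3) → x0 ≢ x11 → x14 ≢ x11 →
  x9 ≢ x11 → x10 ≢ x11 → ⊥
no-colouring = toWitness {a? =
  Fin.all? λ x0 → Fin.all? λ x1 → ¬? (x0 ≟ x1) →-dec Fin.all? λ x2 → ¬? (x0 ≟ x2) →-dec
  ¬? (x1 ≟ x2) →-dec Fin.all? λ x5 → ¬? (x2 ≟ x5) →-dec Fin.all? λ x12 → ¬? (x2 ≟ x12) →-dec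
  ¬? (x5 ≟ x12) →-dec Fin.all? λ x3 → ¬? (x5 ≟ x3) →-dec Fin.all? λ x4 → ¬? (x5 ≟ x4) →-dec
  ¬? (x3 ≟ x4) →-dec Fin.all? λ x13 → ¬? (x1 ≟ x13) →-dec ¬? (x3 ≟ x13) →-dec Fin.all? λ x8 →
  ¬? (x1 ≟ x8) →-dec ¬? (x13 ≟ x8) →-dec Fin.all? λ x6 → ¬? (x12 ≟ x6) →-dec ¬? (x8 ≟ x6) →-dec
  Fin.all? λ x7 → ¬? (x4 ≟ x7) →-dec ¬? (x8 ≟ x7) →-dec ¬? (x6 ≟ x7) →-dec Fin.all? λ x14 →
  ¬? (x0 ≟ x14) →-dec ¬? (x4 ≟ x14) →-dec ¬? (x7 ≟ x14) →-dec Fin.all? λ x9 → ¬? (x12 ≟ x9) →-dec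
  ¬? (x6 ≟ x9) →-dec Fin.all? λ x10 → ¬? (x3 ≟ x10) →-dec ¬? (x13 ≟ x10) →-dec ¬? (x9 ≟ x10) →-dec
  Fin.all? λ x11 → ¬? (x0 ≟ x11) →-dec ¬? (x14 ≟ x11) →-dec ¬? (x9 ≟ x11) →-dec
  ¬? (x10 ≟ x11) →-dec no (λ ())} tt

-- Three nonzero elements of the Klein four-group with sum zero are distinct, so the flow would be a
-- proper 3-edge-colouring.
petersen : (φ : Fin 15 → K₄) → (∀ e → φ e ≢ 𝟘) → (∀ v → flux φ v ≡ 𝟘) → ⊥
petersen φ nz kf = no-colouring
  (c 0F) (c 1F) (d 0F 0F 1F) (c 2F) (d 0F 0F 2F) (d 0F 1F 2F) (c 5F) (d 9F 0F 1F) (c (# 12))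
  (d 9F 0F 2F) (d 9F 1F 2F) (c 3F) (d 1F 2F 0F) (c 4F) (d 1F 2F 1F) (d 1F 0F 1F) (c (# 13))
  (d 8F 0F 2F) (d 5F 0F 2F) (c 8F) (d 8F 0F 1F) (d 8F 2F 1F) (c 6F) (d 4F 2F 0F) (d 2F 2F 0F)
  (c 7F) (d 6F 0F 1F) (d 2F 2F 1F) (d 2F 0F 1F) (c (# 14)) (d 7F 0F 2F) (d 6F 0F 2F) (d 6F 1F 2F)
  (c 9F) (d 4F 2F 1F) (d 4F 0F 1F) (c (# 10)) (d 5F 0F 1F) (d 5F 2F 1F) (d 3F 0F 1F) (c (# 11))
  (d 7F 0F 1F) (d 7F 2F 1F) (d 3F 0F 2F) (d 3F 1F 2F)
  where
  c : Fin 15 → Fin 3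
  c e = proj₁ (unhue (φ e) (nz e))
  c-hue : ∀ e → φ e ≡ hue (c e)
  c-hue e = proj₂ (unhue (φ e) (nz e))
  third : ∀ x y z → x ⊕ y ⊕ z ≡ 𝟘 → (x ≡ y → z ≡ 𝟘) × (x ≡ z → y ≡ 𝟘) × (y ≡ z → x ≡ 𝟘)
  third x y z e =
    (λ { refl → trans (sym (trans (sym (⊕-assoc x x z)) (cong (_⊕ z) (⊕-self x)))) e }) ,
    (λ { refl → trans (sym (trans (cong (x ⊕_) (⊕-comm y x)) (trans (sym (⊕-assoc x x y)) (cong (_⊕ y) (⊕-self x))))) e }) ,
    (λ { refl → trans (sym (trans (cong (x ⊕_) (⊕-self y)) (⊕-identityʳ x))) e })
  d : ∀ v i j → {True (¬? (i ≟ j))} → c (star v i) ≢ c (star v j)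
  d v i j {i≢j} e = go i j (toWitness i≢j) (trans (c-hue _) (trans (cong hue e) (sym (c-hue _))))
    where
    t = third (φ (star v 0F)) (φ (star v 1F)) (φ (star v 2F)) (kf v)
    go : ∀ i j → i ≢ j → φ (star v i) ≢ φ (star v j)
    go zero zero h _ = h refl
    go zero 1F h e = nz _ (proj₁ t e)
    go zero 2F h e = nz _ (proj₁ (proj₂ t) e)
    go 1F zero h e = nz _ (proj₁ t (sym e))
    go 1F 1F h _ = h refl
    go 1F 2F h e = nz _ (proj₂ (proj₂ t) e)
    go 2F zero h e = nz _ (proj₁ (proj₂ t) (sym e))
    go 2F 1F h e = nz _ (proj₂ (proj₂ t) (sym e))
    go 2F 2F h _ = h refl

-- Every edge occurs in exactly two stars, so all terms cancel.
handshake₂ : (f : Fin 15 → Bool) → let s = λ v → f (star v 0F) xor (f (star v 1F) xor f (star v 2F)) in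
  s 0F xor (s 1F xor (s 2F xor (s 3F xor (s 4F xor (s 5F xor (s 6F xor (s 7F xor (s 8F xor (s 9F))))))))) ≡ false
handshake₂ f = solve 15 (λ x0 x1 x2 x3 x4 x5 x6 x7 x8 x9 x10 x11 x12 x13 x14 →
    (x0 :+ (x1 :+ x2)) :+ ((x3 :+ (x4 :+ x5)) :+ ((x6 :+ (x7 :+ x8)) :+ ((x9 :+ (x10 :+ x11)) :+ ((x6 :+ (x9 :+ x12)) :+ ((x3 :+ (x10 :+ x13)) :+ ((x4 :+ (x7 :+ x14)) :+ ((x0 :+ (x11 :+ x14)) :+ ((x1 :+ (x8 :+ x13)) :+ ((x2 :+ (x5 :+ x12)))))))))))
    := con false) refl
    (f 0F) (f 1F) (f 2F) (f 3F) (f 4F) (f 5F) (f 6F) (f 7F) (f 8F) (f 9F) (f (# 10)) (f (# 11)) (f (# 12)) (f (# 13)) (f (# 14))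
  where open xor-∧-Solver

handshake : (φ : Fin 15 → K₄) →
  flux φ 0F ⊕ flux φ 1F ⊕ flux φ 2F ⊕ flux φ 3F ⊕ flux φ 4F ⊕ flux φ 5F ⊕ flux φ 6F ⊕ flux φ 7F ⊕ flux φ 8F ⊕ flux φ 9F ≡ 𝟘
handshake φ = cong₂ _,_ (handshake₂ (proj₁ ∘ φ)) (handshake₂ (proj₂ ∘ φ))

-- Copies of the Petersen graph inside the blueprint

-- The dart representing each edge of the inner, middle and outer copies of the Petersen graph
-- (junk for the edges that are replaced by gadgets), and the numbering of their nodes.
innerRep : Vec (ℕ × ℕ) 15
innerRep = (7 , 0) ∷ (8 , 0) ∷ (9 , 0) ∷ (5 , 0) ∷ (6 , 0) ∷ (9 , 1) ∷ (4 , 0) ∷ (6 , 1) ∷ (8 , 1) ∷ (3 , 0) ∷ (3 , 1) ∷ (3 , 2) ∷ (4 , 2) ∷ (5 , 2) ∷ (6 , 2) ∷ []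

innerNode : Vec ℕ 10
innerNode = 0 ∷ 0 ∷ 0 ∷ 0 ∷ 1 ∷ 2 ∷ 4 ∷ 3 ∷ 5 ∷ 6 ∷ []

middleRep : Vec (ℕ × ℕ) 15
middleRep = (0 , 0) ∷ (8 , 0) ∷ (9 , 0) ∷ (0 , 0) ∷ (6 , 0) ∷ (9 , 1) ∷ (2 , 0) ∷ (2 , 1) ∷ (2 , 2) ∷ (3 , 0) ∷ (3 , 1) ∷ (3 , 2) ∷ (4 , 2) ∷ (8 , 2) ∷ (6 , 2) ∷ []

middleNode : Vec ℕ 10
middleNode = 0 ∷ 0 ∷ 0 ∷ 1 ∷ 2 ∷ 0 ∷ 3 ∷ 0 ∷ 4 ∷ 5 ∷ []

outerRep : Vec (ℕ × ℕ) 15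
outerRep = (0 , 0) ∷ (8 , 0) ∷ (9 , 0) ∷ (1 , 0) ∷ (1 , 1) ∷ (1 , 2) ∷ (0 , 0) ∷ (6 , 1) ∷ (8 , 1) ∷ (0 , 0) ∷ (5 , 1) ∷ (0 , 0) ∷ (9 , 2) ∷ (5 , 2) ∷ (6 , 2) ∷ []

outerNode : Vec ℕ 10
outerNode = 0 ∷ 0 ∷ 0 ∷ 0 ∷ 0 ∷ 1 ∷ 2 ∷ 0 ∷ 3 ∷ 4 ∷ []
dart-at : (ℕ → ℕ) → Vec ℕ 10 → Vec (ℕ × ℕ) 15 → Fin 15 → Fin 85 × Fin 3
dart-at nd node rep e = nd (lookup node (proj₁ (lookup rep e) mod 10)) mod 85 , proj₂ (lookup rep e) mod 3

innerDart : Fin 4 → Fin 2 → Fin 15 → Fin 85 × Fin 3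
innerDart k j = dart-at (λ v → 11 + 20 * toℕ k + 7 * toℕ j + v) innerNode innerRep

middleDart : Fin 4 → Fin 15 → Fin 85 × Fin 3
middleDart k = dart-at (λ v → 5 + 20 * toℕ k + v) middleNode middleRep

outerDart : Fin 15 → Fin 85 × Fin 3
outerDart = dart-at id outerNode outerRep

-- A slot may hold either dart of its edge, whereas only one of the two was chosen to represent the
-- edge.
Matches : Fin 85 → (Fin 15 → Fin 85 × Fin 3) → Fin 10 → Set
Matches i dart v = ∀ s → (i , s) ≡ dart (star v s) ⊎ slot i s ≡ inj₁ (dart (star v s))

matches? : ∀ i dart v → Dec (Matches i dart v)
matches? i dart v = Fin.all? λ s → ≡-dec _≟_ _≟_ (i , s) (dart (star v s)) ⊎-dec (slot i s ≟D inj₁ (dart (star v s)))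

-- The deleted vertices 0, 1, 2 are pairwise nonadjacent and at distance two from 3. What remains is
-- vertex 3 with three paths of length two, listed here by distance from 3.
innerTree : Fin 7 → Fin 10
innerTree v = lookup (3 ∷ 4 ∷ 5 ∷ 7 ∷ 6 ∷ 8 ∷ 9 ∷ []) v mod 10

-- Edges 0 and 3 are replaced, so their ends 0, 7 and 1, 5 become hubs; the other six vertices
-- induce a tree.
middleTree : Fin 6 → Fin 10
middleTree v = lookup (2 ∷ 3 ∷ 4 ∷ 6 ∷ 8 ∷ 9 ∷ []) v mod 10

-- The replaced path runs through 0, 7, 3, 4, 2, which become the hubs 0 to 4; the other five
-- vertices induce a tree.
outerTree : Fin 5 → Fin 10
outerTree v = lookup (1 ∷ 5 ∷ 6 ∷ 8 ∷ 9 ∷ []) v mod 10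

inner-matches : ∀ k j v → Matches ((11 + 20 * toℕ k + 7 * toℕ j + toℕ v) mod 85) (innerDart k j) (innerTree v)
inner-matches = toWitness {a? = Fin.all? λ k → Fin.all? λ j → Fin.all? λ v →
  matches? ((11 + 20 * toℕ k + 7 * toℕ j + toℕ v) mod 85) (innerDart k j) (innerTree v)} tt

middle-matches : ∀ k v → Matches ((5 + 20 * toℕ k + toℕ v) mod 85) (middleDart k) (middleTree v)
middle-matches = toWitness {a? = Fin.all? λ k → Fin.all? λ v →
  matches? ((5 + 20 * toℕ k + toℕ v) mod 85) (middleDart k) (middleTree v)} tt

outer-matches : ∀ v → Matches (toℕ v mod 85) outerDart (outerTree v)
outer-matches = toWitness {a? = Fin.all? λ v → matches? (toℕ v mod 85) outerDart (outerTree v)} tt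

-- The ports of a hub of the k-th middle copy, in terms of the edges of the middle
-- copy and of the inner copy attached to the hub.
middleHub : Fin 4 → Fin 4 → Fin 5 → Fin 85 × Fin 3
middleHub k zero = lookup (middleDart k 1F ∷ middleDart k 2F ∷ innerDart k 0F 0F ∷ innerDart k 0F 1F ∷ innerDart k 0F 2F ∷ [])
middleHub k 1F = lookup (middleDart k (# 11) ∷ middleDart k (# 14) ∷ innerDart k 0F 3F ∷ innerDart k 0F 4F ∷ innerDart k 0F 5F ∷ [])
middleHub k 2F = lookup (middleDart k 4F ∷ middleDart k 5F ∷ innerDart k 1F 0F ∷ innerDart k 1F 1F ∷ innerDart k 1F 2F ∷ [])
middleHub k 3F = lookup (middleDart k (# 10) ∷ middleDart k (# 13) ∷ innerDart k 1F 3F ∷ innerDart k 1F 4F ∷ innerDart k 1F 5F ∷ [])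

middle-ports : ∀ k c i → port ((31 + 20 * toℕ k + 5 * toℕ c + toℕ i) mod 111) ≡ middleHub k c i
middle-ports = toWitness {a? = Fin.all? λ k → Fin.all? λ c → Fin.all? λ i →
  ≡-dec _≟_ _≟_ (port ((31 + 20 * toℕ k + 5 * toℕ c + toℕ i) mod 111)) (middleHub k c i)} tt

-- Grouped by the hubs along the path, with 5, 7, 7, 7, 5 ports. Each end of a gadget brings the
-- edges 6, 7, 8 at vertex 2 of an inner copy, its third terminal.
outerPorts : Fin 31 → Fin 85 × Fin 3
outerPorts = lookup
  ( o 1 ∷ o 2 ∷ z 0 0 6 ∷ z 0 0 7 ∷ z 0 0 8
  ∷ o 14 ∷ z 0 1 6 ∷ z 0 1 7 ∷ z 0 1 8 ∷ z 1 0 6 ∷ z 1 0 7 ∷ z 1 0 8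
  ∷ o 10 ∷ z 1 1 6 ∷ z 1 1 7 ∷ z 1 1 8 ∷ z 2 0 6 ∷ z 2 0 7 ∷ z 2 0 8
  ∷ o 12 ∷ z 2 1 6 ∷ z 2 1 7 ∷ z 2 1 8 ∷ z 3 0 6 ∷ z 3 0 7 ∷ z 3 0 8
  ∷ o 7 ∷ o 8 ∷ z 3 1 6 ∷ z 3 1 7 ∷ z 3 1 8 ∷ [])
  where
  o : ℕ → Fin 85 × Fin 3
  o e = outerDart (e mod 15)
  z : ℕ → ℕ → ℕ → Fin 85 × Fin 3
  z k j e = innerDart (k mod 4) (j mod 2) (e mod 15)

outer-ports : ∀ i → port (toℕ i mod 111) ≡ outerPorts i
outer-ports = toWitness {a? = Fin.all? λ i → ≡-dec _≟_ _≟_ (port (toℕ i mod 111)) (outerPorts i)} tt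

-- Ports are numbered consecutively hub by hub, so each sum reduces to its five terms by
-- computation.
middleHubSum : ∀ (f : Fin 111 → Bool) (k c : Fin 4) → let q = λ i → (31 + 20 * toℕ k + 5 * toℕ c + i) mod 111 in
  hubSum f ((5 + 4 * toℕ k + toℕ c) mod 21) ≡ f (q 0) xor (f (q 1) xor (f (q 2) xor (f (q 3) xor (f (q 4) xor false))))
middleHubSum f zero zero = refl
middleHubSum f zero 1F = refl
middleHubSum f zero 2F = refl
middleHubSum f zero 3F = refl
middleHubSum f 1F zero = refl
middleHubSum f 1F 1F = refl
middleHubSum f 1F 2F = refl
middleHubSum f 1F 3F = refl
middleHubSum f 2F zero = refl
middleHubSum f 2F 1F = refl
middleHubSum f 2F 2F = refl
middleHubSum f 2F 3F = refl
middleHubSum f 3F zero = refl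
middleHubSum f 3F 1F = refl
middleHubSum f 3F 2F = refl
middleHubSum f 3F 3F = refl

-- The blueprint has no nowhere-zero flow

module NoFlow (Q : Flow) where

  open Flow Q

  Fq : ℕ → K₄
  Fq q = F (port (q mod 111))

  tree-flux : ∀ i dart v → Matches i dart v → flux (F ∘ dart) v ≡ 𝟘
  tree-flux i dart v m = trans (sym (cong₂ _⊕_ (eq 0F) (cong₂ _⊕_ (eq 1F) (eq 2F)))) (F-node i)
    where
    eq : ∀ s → F (i , s) ≡ F (dart (star v s))
    eq s with m s
    ... | inj₁ e = cong F e
    ... | inj₂ e = F-slot i s _ e

  middle-hub : ∀ k c → let f = λ i → F (middleHub k c i) in
    f 0F ⊕ f 1F ⊕ f 2F ⊕ f 3F ⊕ f 4F ≡ 𝟘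
  middle-hub k c = begin
    f 0F ⊕ f 1F ⊕ f 2F ⊕ f 3F ⊕ f 4F       ≡⟨ cong₂ _⊕_ (e 0F) (cong₂ _⊕_ (e 1F) (cong₂ _⊕_ (e 2F) (cong₂ _⊕_ (e 3F) (trans (e 4F) (sym (⊕-identityʳ _)))))) ⟩
    g 0 ⊕ g 1 ⊕ g 2 ⊕ g 3 ⊕ g 4 ⊕ 𝟘                       ≡⟨ cong₂ _,_
       (trans (sym (middleHubSum (λ q → proj₁ (F (port q))) k c)) (F-hub₁ ((5 + 4 * toℕ k + toℕ c) mod 21)))
       (trans (sym (middleHubSum (λ q → proj₂ (F (port q))) k c)) (F-hub₂ ((5 + 4 * toℕ k + toℕ c) mod 21))) ⟩
    𝟘                                                      ∎
    where
    open ≡-Reasoning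
    f : Fin 5 → K₄
    f i = F (middleHub k c i)
    g : ℕ → K₄
    g i = Fq (31 + 20 * toℕ k + 5 * toℕ c + i)
    e : ∀ i → f i ≡ g (toℕ i)
    e i = cong F (sym (middle-ports k c i))

  module Inner (k : Fin 4) (j : Fin 2) where

    φ : Fin 15 → K₄
    φ e = F (innerDart k j e)

    α β γ : K₄
    α = flux φ 0F
    β = flux φ 1F
    γ = flux φ 2F

    inner : ∀ v → flux φ (innerTree v) ≡ 𝟘
    inner v = tree-flux _ (innerDart k j) (innerTree v) (inner-matches k j v)

    total : α ⊕ β ⊕ γ ≡ 𝟘
    total = trans (cong (λ x → α ⊕ β ⊕ x) (trans (sym (⊕-identityʳ γ)) (cong (γ ⊕_) (sym rest)))) (handshake φ)
      where
      rest : flux φ 3F ⊕ flux φ 4F ⊕ flux φ 5F ⊕ flux φ 6F ⊕ flux φ 7F ⊕ flux φ 8F ⊕ flux φ 9F ≡ 𝟘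
      rest = cong₂ _⊕_ (inner 0F) (cong₂ _⊕_ (inner 1F) (cong₂ _⊕_ (inner 2F) (cong₂ _⊕_ (inner 4F)
        (cong₂ _⊕_ (inner 3F) (cong₂ _⊕_ (inner 5F) (inner 6F))))))

    -- With zero flux at the three deleted vertices as well, the values would form a nowhere-zero
    -- flow on the whole Petersen graph.
    not-closed : α ≡ 𝟘 → β ≡ 𝟘 → γ ≡ 𝟘 → ⊥
    not-closed a b c = petersen φ (λ e → F-nz _) λ
      { 0F → a
      ; 1F → b
      ; 2F → c
      ; 3F → inner 0F
      ; 4F → inner 1F
      ; 5F → inner 2F
      ; 6F → inner 4F
      ; 7F → inner 3F
      ; 8F → inner 5F
      ; 9F → inner 6F }

  ⊕-shuffle : ∀ p q x → p ⊕ q ⊕ x ≡ 𝟘 → x ⊕ p ⊕ q ≡ 𝟘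
  ⊕-shuffle p q x e = trans (⊕-comm x (p ⊕ q)) (trans (⊕-assoc p q x) e)

  -- The k-th middle copy with its two inner copies transmits a nonzero value
  -- between the two outer hubs that it joins.
  module Middle (k : Fin 4) where

    module I₀ = Inner k 0F
    module I₁ = Inner k 1F

    -- The middle copy with its two replaced edges put back, carrying the trial values x and y.
    ψ : K₄ → K₄ → Fin 15 → K₄
    ψ x y zero = x
    ψ x y 3F = y
    ψ x y e = F (middleDart k e)

    module Flux (x y : K₄) where
      tree : ∀ v → flux (F ∘ middleDart k) (middleTree v) ≡ 𝟘
      tree v = tree-flux _ (middleDart k) (middleTree v) (middle-matches k v)

      close : ∀ x p q a → p ⊕ q ⊕ a ≡ 𝟘 → x ⊕ p ⊕ q ≡ x ⊕ a
      close x p q a e = cong (x ⊕_) (⊕-cancel (p ⊕ q) a (trans (⊕-assoc p q a) e))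

      f₂ : flux (ψ x y) 2F ≡ 𝟘
      f₂ = tree 0F
      f₃ : flux (ψ x y) 3F ≡ 𝟘
      f₃ = tree 1F
      f₄ : flux (ψ x y) 4F ≡ 𝟘
      f₄ = tree 2F
      f₆ : flux (ψ x y) 6F ≡ 𝟘
      f₆ = tree 3F
      f₈ : flux (ψ x y) 8F ≡ 𝟘
      f₈ = tree 4F
      f₉ : flux (ψ x y) 9F ≡ 𝟘
      f₉ = tree 5F

      f₀ : flux (ψ x y) 0F ≡ x ⊕ I₀.α
      f₀ = close x (F (middleDart k 1F)) (F (middleDart k 2F)) I₀.α (middle-hub k 0F)
      f₇ : flux (ψ x y) 7F ≡ x ⊕ I₀.β
      f₇ = close x (F (middleDart k (# 11))) (F (middleDart k (# 14))) I₀.β (middle-hub k 1F)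
      f₁ : flux (ψ x y) 1F ≡ y ⊕ I₁.α
      f₁ = close y (F (middleDart k 4F)) (F (middleDart k 5F)) I₁.α (middle-hub k 2F)
      f₅ : flux (ψ x y) 5F ≡ y ⊕ I₁.β
      f₅ = close y (F (middleDart k (# 10))) (F (middleDart k (# 13))) I₁.β (middle-hub k 3F)

    open Flux

    -- With zero on both restored edges, only their four ends can have nonzero flux, and it equals
    -- what the inner copies send there; the handshake does the rest.
    balance : I₀.α ⊕ I₁.α ⊕ I₁.β ⊕ I₀.β ≡ 𝟘
    balance = trans (sym (cong₂ _⊕_ (f₀ 𝟘 𝟘) (cong₂ _⊕_ (f₁ 𝟘 𝟘) (cong₂ _⊕_ (f₂ 𝟘 𝟘) (cong₂ _⊕_ (f₃ 𝟘 𝟘)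
      (cong₂ _⊕_ (f₄ 𝟘 𝟘) (cong₂ _⊕_ (f₅ 𝟘 𝟘) (cong₂ _⊕_ (f₆ 𝟘 𝟘) (trans (cong₂ _⊕_ (f₇ 𝟘 𝟘) (cong₂ _⊕_ (f₈ 𝟘 𝟘)
      (f₉ 𝟘 𝟘))) (⊕-identityʳ _)))))))))) (handshake (ψ 𝟘 𝟘))

    γ-equal : I₀.γ ≡ I₁.γ
    γ-equal = ⊕-cancel _ _ (begin
      I₀.γ ⊕ I₁.γ                                   ≡⟨ cong₂ _⊕_ (sym g₀) (sym g₁) ⟩
      (I₀.α ⊕ I₀.β) ⊕ (I₁.α ⊕ I₁.β)                 ≡⟨ ⊕-assoc I₀.α I₀.β _ ⟩
      I₀.α ⊕ I₀.β ⊕ I₁.α ⊕ I₁.β                     ≡⟨ cong (I₀.α ⊕_) (trans (⊕-comm I₀.β _) (⊕-assoc I₁.α I₁.β I₀.β)) ⟩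
      I₀.α ⊕ I₁.α ⊕ I₁.β ⊕ I₀.β                     ≡⟨ balance ⟩
      𝟘                                             ∎)
      where
      open ≡-Reasoning
      g₀ : I₀.α ⊕ I₀.β ≡ I₀.γ
      g₀ = ⊕-cancel _ _ (trans (⊕-assoc I₀.α I₀.β I₀.γ) I₀.total)
      g₁ : I₁.α ⊕ I₁.β ≡ I₁.γ
      g₁ = ⊕-cancel _ _ (trans (⊕-assoc I₁.α I₁.β I₁.γ) I₁.total)

    -- If it vanished, each inner copy would pass one value from end to end of its edge, nonzero by
    -- `not-closed`. These two values on the restored edges would complete a nowhere-zero flow on
    -- the Petersen graph.
    γ-nonzero : I₀.γ ≢ 𝟘
    γ-nonzero z = petersen (ψ I₀.α I₁.α) nz λ
      { 0F → trans (f₀ I₀.α I₁.α) (⊕-self I₀.α)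
      ; 1F → trans (f₁ I₀.α I₁.α) (⊕-self I₁.α)
      ; 2F → f₂ I₀.α I₁.α
      ; 3F → f₃ I₀.α I₁.α
      ; 4F → f₄ I₀.α I₁.α
      ; 5F → trans (f₅ I₀.α I₁.α) (trans (cong (_⊕ I₁.β) e₁) (⊕-self I₁.β))
      ; 6F → f₆ I₀.α I₁.α
      ; 7F → trans (f₇ I₀.α I₁.α) (trans (cong (_⊕ I₀.β) e₀) (⊕-self I₀.β))
      ; 8F → f₈ I₀.α I₁.α
      ; 9F → f₉ I₀.α I₁.α }
      where
      equal : ∀ a b c → a ⊕ b ⊕ c ≡ 𝟘 → c ≡ 𝟘 → a ≡ b
      equal a b c e refl = ⊕-cancel a b (trans (cong (a ⊕_) (sym (⊕-identityʳ b))) e)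
      e₀ : I₀.α ≡ I₀.β
      e₀ = equal _ _ _ I₀.total z
      e₁ : I₁.α ≡ I₁.β
      e₁ = equal _ _ _ I₁.total (trans (sym γ-equal) z)
      α₀≢ : I₀.α ≢ 𝟘
      α₀≢ a = I₀.not-closed a (trans (sym e₀) a) z
      α₁≢ : I₁.α ≢ 𝟘
      α₁≢ a = I₁.not-closed a (trans (sym e₁) a) (trans (sym γ-equal) z)
      nz : ∀ e → ψ I₀.α I₁.α e ≢ 𝟘
      nz zero = α₀≢
      nz 1F = F-nz _
      nz 2F = F-nz _
      nz 3F = α₁≢
      nz (suc (suc (suc (suc e)))) = F-nz _

  γ : Fin 4 → K₄
  γ k = Middle.I₀.γ k

  -- The outer copy, with the path of edges 0, 11, 9, 6 replaced.
  χ : Fin 15 → K₄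
  χ e with toℕ e
  ... | 0 = γ 0F
  ... | 11 = γ 1F
  ... | 9 = γ 2F
  ... | 6 = γ 3F
  ... | _ = F (outerDart e)

  open Inner using () renaming (γ to γ′)

  p : ℕ → K₄
  p i = F (outerPorts (i mod 31))

  five : ∀ a b c d e → a ⊕ b ⊕ c ⊕ d ⊕ e ⊕ 𝟘 ≡ 𝟘 → a ⊕ b ⊕ c ⊕ d ⊕ e ≡ 𝟘
  five a b c d e h = trans (cong (λ x → a ⊕ b ⊕ c ⊕ d ⊕ x) (sym (⊕-identityʳ e))) h

  seven : ∀ a b c d e f g → a ⊕ b ⊕ c ⊕ d ⊕ e ⊕ f ⊕ g ⊕ 𝟘 ≡ 𝟘 → a ⊕ (b ⊕ c ⊕ d) ⊕ (e ⊕ f ⊕ g) ≡ 𝟘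
  seven a b c d e f g h = trans (cong (a ⊕_) (trans (⊕-assoc b (c ⊕ d) _) (cong (b ⊕_) (trans (⊕-assoc c d _)
    (cong (λ x → c ⊕ d ⊕ e ⊕ f ⊕ x) (sym (⊕-identityʳ g))))))) h

  Fport : ∀ i → F (port (toℕ {31} i mod 111)) ≡ F (outerPorts i)
  Fport i = cong F (outer-ports i)

  h₀ : p 0 ⊕ p 1 ⊕ γ 0F ≡ 𝟘
  h₀ = five (p 0) (p 1) (p 2) (p 3) (p 4) (trans (sym (cong₂ _⊕_ (Fport 0F) (cong₂ _⊕_ (Fport 1F) (cong₂ _⊕_ (Fport 2F)
    (cong₂ _⊕_ (Fport 3F) (cong (_⊕ 𝟘) (Fport 4F))))))) (cong₂ _,_ (F-hub₁ 0F) (F-hub₂ 0F)))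

  h₄ : p 26 ⊕ p 27 ⊕ γ′ 3F 1F ≡ 𝟘
  h₄ = five (p 26) (p 27) (p 28) (p 29) (p 30) (trans (sym (cong₂ _⊕_ (Fport (# 26)) (cong₂ _⊕_ (Fport (# 27)) (cong₂ _⊕_ (Fport (# 28))
    (cong₂ _⊕_ (Fport (# 29)) (cong (_⊕ 𝟘) (Fport (# 30)))))))) (cong₂ _,_ (F-hub₁ 4F) (F-hub₂ 4F)))

  h₁ : p 5 ⊕ γ′ 0F 1F ⊕ γ 1F ≡ 𝟘
  h₁ = seven (p 5) (p 6) (p 7) (p 8) (p 9) (p 10) (p 11) (trans (sym (cong₂ _⊕_ (Fport 5F) (cong₂ _⊕_ (Fport 6F) (cong₂ _⊕_ (Fport 7F)
    (cong₂ _⊕_ (Fport 8F) (cong₂ _⊕_ (Fport 9F) (cong₂ _⊕_ (Fport (# 10)) (cong (_⊕ 𝟘) (Fport (# 11))))))))))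
    (cong₂ _,_ (F-hub₁ 1F) (F-hub₂ 1F)))

  h₂ : p 12 ⊕ γ′ 1F 1F ⊕ γ 2F ≡ 𝟘
  h₂ = seven (p 12) (p 13) (p 14) (p 15) (p 16) (p 17) (p 18) (trans (sym (cong₂ _⊕_ (Fport (# 12)) (cong₂ _⊕_ (Fport (# 13)) (cong₂ _⊕_ (Fport (# 14))
    (cong₂ _⊕_ (Fport (# 15)) (cong₂ _⊕_ (Fport (# 16)) (cong₂ _⊕_ (Fport (# 17)) (cong (_⊕ 𝟘) (Fport (# 18))))))))))
    (cong₂ _,_ (F-hub₁ 2F) (F-hub₂ 2F)))

  h₃ : p 19 ⊕ γ′ 2F 1F ⊕ γ 3F ≡ 𝟘
  h₃ = seven (p 19) (p 20) (p 21) (p 22) (p 23) (p 24) (p 25) (trans (sym (cong₂ _⊕_ (Fport (# 19)) (cong₂ _⊕_ (Fport (# 20)) (cong₂ _⊕_ (Fport (# 21))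
    (cong₂ _⊕_ (Fport (# 22)) (cong₂ _⊕_ (Fport (# 23)) (cong₂ _⊕_ (Fport (# 24)) (cong (_⊕ 𝟘) (Fport (# 25))))))))))
    (cong₂ _,_ (F-hub₁ 3F) (F-hub₂ 3F)))

  rot : ∀ x y z → x ⊕ y ⊕ z ≡ 𝟘 → y ⊕ z ⊕ x ≡ 𝟘
  rot x y z e = trans (sym (⊕-assoc y z x)) (trans (⊕-comm (y ⊕ z) x) e)

  swap₂ : ∀ x y z → x ⊕ y ⊕ z ≡ 𝟘 → x ⊕ z ⊕ y ≡ 𝟘
  swap₂ x y z e = trans (cong (x ⊕_) (⊕-comm z y)) e

  γ≡ : ∀ k → γ k ≡ γ′ k 1F
  γ≡ k = Middle.γ-equal k

  outer-tree : ∀ v → flux (F ∘ outerDart) (outerTree v) ≡ 𝟘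
  outer-tree v = tree-flux _ outerDart (outerTree v) (outer-matches v)

  -- The third-terminal values at the two ends of a gadget agree and are nonzero, so each gadget
  -- acts like the edge it replaces.
  no-flow : ⊥
  no-flow = petersen χ nz λ
    { 0F → ⊕-shuffle (p 0) (p 1) (γ 0F) h₀
    ; 1F → outer-tree 0F
    ; 2F → ⊕-shuffle (p 26) (p 27) (γ 3F) (subst (λ x → p 26 ⊕ p 27 ⊕ x ≡ 𝟘) (sym (γ≡ 3F)) h₄)
    ; 3F → swap₂ (γ 2F) (γ 1F) (p 12) (rot (p 12) (γ 2F) (γ 1F) (swap₂ (p 12) (γ 1F) (γ 2F)
         (subst (λ x → p 12 ⊕ x ⊕ γ 2F ≡ 𝟘) (sym (γ≡ 1F)) h₂)))
    ; 4F → rot (p 19) (γ 3F) (γ 2F) (swap₂ (p 19) (γ 2F) (γ 3F)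
         (subst (λ x → p 19 ⊕ x ⊕ γ 3F ≡ 𝟘) (sym (γ≡ 2F)) h₃))
    ; 5F → outer-tree 1F
    ; 6F → outer-tree 2F
    ; 7F → rot (p 5) (γ 0F) (γ 1F)
         (subst (λ x → p 5 ⊕ x ⊕ γ 1F ≡ 𝟘) (sym (γ≡ 0F)) h₁)
    ; 8F → outer-tree 3F
    ; 9F → outer-tree 4F }
    where
    nz : ∀ e → χ e ≢ 𝟘
    nz e with toℕ e
    ... | 0 = Middle.γ-nonzero 0F
    ... | 1 = F-nz _
    ... | 2 = F-nz _
    ... | 3 = F-nz _
    ... | 4 = F-nz _
    ... | 5 = F-nz _
    ... | 6 = Middle.γ-nonzero 3F
    ... | 7 = F-nz _
    ... | 8 = F-nz _
    ... | 9 = Middle.γ-nonzero 2F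
    ... | 10 = F-nz _
    ... | 11 = Middle.γ-nonzero 1F
    ... | suc (suc (suc (suc (suc (suc (suc (suc (suc (suc (suc (suc _))))))))))) = F-nz _

-- Assembling the blueprint

all-∈ : ∀ {A : Set} (p : A → Bool) {xs x} → all p xs ≡ true → x ∈ xs → p x ≡ true
all-∈ p {x ∷ xs} e m with p x in px
all-∈ p {x ∷ xs} e (here refl) | true = px
all-∈ p {x ∷ xs} e (there m) | true = all-∈ p e m

apart : ∀ x i j → i ≢ j → ∀ {d e} → d ∈ trail x i → e ∈ trail x j → d ≢ e × d ≢ partner e
apart x i j i≢j {d} {e} d∈ e∈ = split
    (all-∈ (λ e → not (number d ≡ᵇ proj₁ e) ∧ not (number d ≡ᵇ proj₂ e))
      (all-∈ (λ d → all (λ e → not (proj₁ d ≡ᵇ proj₁ e) ∧ not (proj₁ d ≡ᵇ proj₂ e)) (List.map numbers (trail x j)))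
        (trail-disjoint x i j i≢j) (∈-map⁺ numbers d∈)) (∈-map⁺ numbers e∈))
  where
  ≡ᵇ-refl : ∀ n → (n ≡ᵇ n) ≡ true
  ≡ᵇ-refl zero = refl
  ≡ᵇ-refl (suc n) = ≡ᵇ-refl n
  split : not (number d ≡ᵇ number e) ∧ not (number d ≡ᵇ number (partner e)) ≡ true → d ≢ e × d ≢ partner e
  split h = (λ eq → clash h (inj₁ (cong number eq))) , λ eq → clash h (inj₂ (cong number eq))
    where
    clash : ∀ {a b c} → not (a ≡ᵇ b) ∧ not (a ≡ᵇ c) ≡ true → a ≡ b ⊎ a ≡ c → ⊥
    clash {a} h (inj₁ refl) rewrite ≡ᵇ-refl a with h
    ... | ()
    clash {a} {b} h (inj₂ refl) rewrite ≡ᵇ-refl a with not (a ≡ᵇ b) | h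
    ... | true | ()
    ... | false | ()

blueprint : Blueprint
blueprint = record
  { nodes = 85 ; ports = 111 ; hubs = 20 ; slot = slot ; port = port ; hub = hub
  ; slot-involutive = slot-involutive ; port-involutive = port-involutive ; slot-loopless = slot-loopless
  ; isParent = isParent ; isParent-unique = isParent-unique ; height = height ; height<3 = height<3 ; ranked = ranked
  ; target = trailTarget ; earlier = trail-earlier ; trail = trail ; joined = trail-joined ; apart = apart
  ; no-flow = NoFlow.no-flow }

theorem5p3 : ∀ (g : ℕ) → 5 ≤ g → ∀ (N : ℕ) →
    Σ Graph (λ G → N ≤ Graph.n G × IsSnark G × CyclicallyEdgeConnected G 5 × HasGirth G g)
theorem5p3 = snarks blueprint
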